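{- Fix a prime power $q$. (i) Let $r\to\infty$ through odd integers, and let $N=(3r-1)/2$. For a uniformly random alternating bilinear form $B:\Lambda^2\mathbb F_q^N\to\mathbb F_q$, the number $X_{N,r}$ of totally isotropic $r$-dimensional subspaces satisfies $$\mathbb E X_{N,r}\to C_q,\qquad\mathbb P(X_{N,r}>0)\le C_q\,q^{ -(r^2-1)/8}\to0 .$$ Hence $X_{N,r}\to0$ in probability. (ii) Let $N=2r-1$ and choose $B=(B_1,B_2):\Lambda^2\mathbb F_q^N\to\mathbb F_q^2$ uniformly at random. Every pair $(B_1,B_2)$ has a common totally isotropic $r$-dimensional subspace, so the number $X_{N,r}$ of common totally isotropic $r$-dimensional subspaces satisfies $X_{N,r}\ge1$ deterministically, while $$\frac{\mathbb E\bigl[X_{N,r}(X_{N,r}-1)\bigr]}{(\mathbb E X_{N,r})^2}\ge\frac{r-1}{C_q}.$$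
   Context: A subspace $H$ is totally isotropic for a linear map $B:\Lambda^2\mathbb F_q^N\to\mathbb F_q^m$ if $B(\Lambda^2H)=0$ (equivalently, all $m$ alternating forms vanish on $H\times H$). Uniform means uniform in the finite space $\mathrm{Hom}(\Lambda^2\mathbb F_q^N,\mathbb F_q^m)$. $C_q=\prod_{j\ge1}(1-q^{ -j})^{ -1}$. -}

module Defs where

open import Algebra.Bundles using (CommutativeRing)
open import Algebra.Definitions using (Invertible)
open import Algebra.Structures using (IsCommutativeRing)
open import Data.Empty using (⊥-elim)
open import Data.Fin.Base as Fin using (Fin; funToFin; finToFun; combine)
import Data.Fin.Properties as Fin
import Data.Fin.Subset as Subset
import Data.Fin.Subset.Properties as Subset
open import Data.Bool.Base using (Bool)
import Data.Integer.Base as ℤ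
import Data.Integer.Properties as ℤ
open import Data.List.Base as List using (List; []; _∷_)
open import Data.List.Membership.Propositional using (_∈_)
import Data.List.Membership.Propositional.Properties as ∈ₚ
open import Data.Nat.Base as ℕ using (ℕ; zero; suc; NonZero; NonTrivial)
open import Data.Nat.Primality using (Prime; prime⇒nonTrivial)
open import Data.Nat.ListAction using (sum)
import Data.Nat.Properties as ℕ
open import Data.Product.Base using (∃; ∃₂; ∃-syntax; _×_; _,_; proj₁; proj₂)
open import Data.Rational.Base as ℚ using (ℚ; 0ℚ; 1ℚ; ½)
import Data.Rational.Properties as ℚ
open import Data.Rational.Solver using (module +-*-Solver)
import Data.Rational.Unnormalised.Base as ℚᵘ
import Data.Rational.Unnormalised.Properties as ℚᵘ
open import Data.Sum.Base using (inj₁; inj₂)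
open import Data.Vec.Base as Vec using (Vec; []; _∷_; lookup; tabulate; replicate)
import Data.Vec.Properties as Vec
open import Function.Base using (_∘_)
open import Function.Bundles using (_↔_; mk↔ₛ′; module Inverse)
open import Function.Properties.Inverse using (↔⇒↣)
open import Level using (0ℓ)
open import Relation.Binary.Definitions using (DecidableEquality)
open import Relation.Binary.PropositionalEquality
open import Relation.Nullary.Decidable
  using (Dec; map′; _×-dec_; _→-dec_; via-injection)
open import Relation.Unary using (Pred; Decidable)

import Algebra.Definitions.RawSemiring ℚ.+-*-rawSemiring as ℚ^
import Algebra.Properties.Monoid.Sum

IsPrimePower : ℕ → Set
IsPrimePower q = ∃₂ λ p k → Prime p × 1 ℕ.≤ k × q ≡ p ℕ.^ k

primePower⇒nonTrivial : ∀ {q} → IsPrimePower q → NonTrivial q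
primePower⇒nonTrivial (p , suc k , pp , _ , refl) =
  ℕ.n>1⇒nonTrivial (ℕ.≤-trans (ℕ.nonTrivial⇒n>1 p) (ℕ.m≤m*n p (p ℕ.^ k)))
  where instance
    p-nt = prime⇒nonTrivial pp
    p-nz = ℕ.nonTrivial⇒nonZero p
    pk-nz = ℕ.m^n≢0 p k

Odd : ℕ → Set
Odd r = r ℕ.% 2 ≡ 1

module _ {A : Set} {n : ℕ} (fin : A ↔ Fin n) where
  open Inverse fin

  elements : List A
  elements = List.map from (List.allFin n)

  ∈-elements : ∀ x → x ∈ elements
  ∈-elements x =
    subst (_∈ elements) (strictlyInverseʳ x)
      (∈ₚ.∈-map⁺ from (∈ₚ.∈-allFin (to x)))

  ∀? : ∀ {p} {P : Pred A p} → Decidable P → Dec (∀ x → P x)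
  ∀? {P = P} P? =
    map′ (λ h x → subst P (strictlyInverseʳ x) (h (to x))) (λ h i → h (from i))
      (Fin.all? (P? ∘ from))

  ∃? : ∀ {p} {P : Pred A p} → Decidable P → Dec (∃ P)
  ∃? {P = P} P? =
    map′ (λ (i , h) → from i , h)
      (λ (x , h) → to x , subst P (sym (strictlyInverseʳ x)) h)
      (Fin.any? (P? ∘ from))

  finite⇒≟ : DecidableEquality A
  finite⇒≟ = via-injection (↔⇒↣ fin) Fin._≟_

  count : ∀ {p} {P : Pred A p} → Decidable P → ℕ
  count P? = List.length (List.filter P? elements)

funToFin-cong : ∀ {m n} {f g : Fin m → Fin n} → f ≗ g → funToFin f ≡ funToFin g
funToFin-cong {zero}  f≗g = refl
funToFin-cong {suc m} f≗g = cong₂ combine (f≗g Fin.zero) (funToFin-cong (f≗g ∘ Fin.suc))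

vec-finite : ∀ {A : Set} {k} → A ↔ Fin k → ∀ n → Vec A n ↔ Fin (k ℕ.^ n)
vec-finite {A} {k} fin n = mk↔ₛ′ index vector index-vector vector-index
  where
  open Inverse fin
  index : Vec A n → Fin (k ℕ.^ n)
  index v = funToFin (to ∘ lookup v)
  vector : Fin (k ℕ.^ n) → Vec A n
  vector i = tabulate (from ∘ finToFun i)
  index-vector : ∀ i → index (vector i) ≡ i
  index-vector i = trans
    (funToFin-cong {n} λ j → trans (cong to (Vec.lookup∘tabulate _ j)) (strictlyInverseˡ _))
    (Fin.funToFin-finToFin {n} {k} i)
  vector-index : ∀ v → vector (index v) ≡ v
  vector-index v = trans
    (Vec.tabulate-cong λ j →
      trans (cong from (Fin.finToFun-funToFin (to ∘ lookup v) j)) (strictlyInverseʳ _))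
    (Vec.tabulate∘lookup v)

subset-finite : ∀ n → Subset.Subset n ↔ Fin (2 ℕ.^ n)
subset-finite = vec-finite bool-finite
  where
  bool-finite : Bool ↔ Fin 2
  bool-finite = mk↔ₛ′
    (λ { Bool.false → Fin.zero ; Bool.true → Fin.suc Fin.zero })
    (λ { Fin.zero → Bool.false ; (Fin.suc Fin.zero) → Bool.true })
    (λ { Fin.zero → refl ; (Fin.suc Fin.zero) → refl })
    (λ { Bool.false → refl ; Bool.true → refl })

-- The uniform measure on Ω = ω, provided ω lists its elements without
-- repetition.

module _ {Ω : Set} (ω : List Ω) .{{_ : NonZero (List.length ω)}} where

  expectation : (Ω → ℕ) → ℚ
  expectation X = ℤ.+ sum (List.map X ω) ℚ./ List.length ω

  probability : ∀ {p} {P : Pred Ω p} → Decidable P → ℚ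
  probability P? = ℤ.+ List.length (List.filter P? ω) ℚ./ List.length ω

record FiniteField (q : ℕ) : Set₁ where
  infixl 7 _*_
  infixl 6 _+_
  infix  8 -_
  field
    Carrier           : Set
    _+_ _*_           : Carrier → Carrier → Carrier
    -_                : Carrier → Carrier
    0# 1#             : Carrier
    isCommutativeRing : IsCommutativeRing _≡_ _+_ _*_ -_ 0# 1#
    1≢0               : 1# ≢ 0#
    invertible        : ∀ {x} → x ≢ 0# → Invertible _≡_ 1# _*_ x
    finite            : Carrier ↔ Fin q

  commutativeRing : CommutativeRing 0ℓ 0ℓ
  commutativeRing = record { isCommutativeRing = isCommutativeRing }

module LinearAlgebra {q : ℕ} (F : FiniteField q) where
  open FiniteField F
  open CommutativeRing commutativeRing using (+-monoid; zeroˡ; zeroʳ)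
  open Algebra.Properties.Monoid.Sum +-monoid
    using (sum-cong-≗; sum-replicate-zero) renaming (sum to ∑)

  Vector : ℕ → Set
  Vector = Vec Carrier

  vectors : ∀ n → Vector n ↔ Fin (q ℕ.^ n)
  vectors = vec-finite finite

  _≟_ : ∀ {n} → DecidableEquality (Vector n)
  _≟_ {n} = finite⇒≟ (vectors n)

  infixl 6 _+ᵥ_
  infixr 7 _·ᵥ_

  0ᵥ : ∀ {n} → Vector n
  0ᵥ = replicate _ 0#

  _+ᵥ_ : ∀ {n} → Vector n → Vector n → Vector n
  _+ᵥ_ = Vec.zipWith _+_

  _·ᵥ_ : ∀ {n} → Carrier → Vector n → Vector n
  a ·ᵥ v = Vec.map (a *_) v

  combination : ∀ {r n} → Vec Carrier r → Vec (Vector n) r → Vector n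
  combination c b = Vec.foldr′ _+ᵥ_ 0ᵥ (Vec.zipWith _·ᵥ_ c b)

  -- Subsets of F^N are bit vectors over the enumeration of F^N, so that
  -- propositionally distinct codes are distinct subsets.
  VSubset : ℕ → Set
  VSubset N = Subset.Subset (q ℕ.^ N)

  infix 4 _∈ᵥ_ _∈ᵥ?_

  _∈ᵥ_ : ∀ {N} → Vector N → VSubset N → Set
  _∈ᵥ_ {N} v H = Inverse.to (vectors N) v Subset.∈ H

  _∈ᵥ?_ : ∀ {N} (v : Vector N) (H : VSubset N) → Dec (v ∈ᵥ H)
  _∈ᵥ?_ {N} v H = Inverse.to (vectors N) v Subset.∈? H

  IsSubspace : ∀ N → VSubset N → Set
  IsSubspace N H =
      0ᵥ {N} ∈ᵥ H
    × (∀ (u v : Vector N) → u ∈ᵥ H → v ∈ᵥ H → (u +ᵥ v) ∈ᵥ H)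
    × (∀ a (v : Vector N) → v ∈ᵥ H → (a ·ᵥ v) ∈ᵥ H)

  isSubspace? : ∀ N → Decidable (IsSubspace N)
  isSubspace? N H =
          (0ᵥ {N} ∈ᵥ? H)
    ×-dec (∀? (vectors N) λ u → ∀? (vectors N) λ v →
            (u ∈ᵥ? H) →-dec ((v ∈ᵥ? H) →-dec ((u +ᵥ v) ∈ᵥ? H)))
    ×-dec (∀? finite λ a → ∀? (vectors N) λ v →
            (v ∈ᵥ? H) →-dec ((a ·ᵥ v) ∈ᵥ? H))

  LinearlyIndependent : ∀ {N r} → Vec (Vector N) r → Set
  LinearlyIndependent b = ∀ c → combination c b ≡ 0ᵥ → c ≡ 0ᵥ

  IsBasisOf : ∀ {N r} → VSubset N → Vec (Vector N) r → Set
  IsBasisOf H b =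
      LinearlyIndependent b
    × (∀ i → lookup b i ∈ᵥ H)
    × (∀ v → v ∈ᵥ H → ∃[ c ] combination c b ≡ v)

  HasDimension : ∀ N → VSubset N → ℕ → Set
  HasDimension N H r = ∃[ b ] IsBasisOf {N} {r} H b

  hasDimension? : ∀ N (H : VSubset N) r → Dec (HasDimension N H r)
  hasDimension? N H r = ∃? (vec-finite (vectors N) r) λ b →
          (∀? (vectors r) λ c → (combination c b ≟ 0ᵥ) →-dec (c ≟ 0ᵥ))
    ×-dec (Fin.all? λ i → lookup b i ∈ᵥ? H)
    ×-dec (∀? (vectors N) λ v → (v ∈ᵥ? H) →-dec
            (∃? (vectors r) λ c → combination c b ≟ v))

  -- A bilinear map F^N × F^N → F^m is encoded by the Gram matrices of its m
  -- components; every bilinear map has exactly one such encoding.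
  Bilinear : ℕ → ℕ → Set
  Bilinear N m = Vec (Vec (Vec Carrier N) N) m

  bilinear-finite : ∀ N m → Bilinear N m ↔ Fin (((q ℕ.^ N) ℕ.^ N) ℕ.^ m)
  bilinear-finite N m = vec-finite (vec-finite (vectors N) N) m

  gram : ∀ {N} → Vec (Vec Carrier N) N → Vector N → Vector N → Carrier
  gram A u v = ∑ λ i → ∑ λ j → lookup u i * (lookup (lookup A i) j * lookup v j)

  evaluate : ∀ {N m} → Bilinear N m → Vector N → Vector N → Vector m
  evaluate B u v = Vec.map (λ A → gram A u v) B

  IsAlternating : ∀ {N m} → Bilinear N m → Set
  IsAlternating B = ∀ v → evaluate B v v ≡ 0ᵥ

  isAlternating? : ∀ {N m} → Decidable (IsAlternating {N} {m})
  isAlternating? {N} B = ∀? (vectors N) λ v → evaluate B v v ≟ 0ᵥ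

  -- Hom(Λ²F^N, F^m): by the universal property of the exterior square, the
  -- linear maps Λ²F^N → F^m are the alternating bilinear maps.
  hom-Λ² : ∀ N m → List (Bilinear N m)
  hom-Λ² N m = List.filter isAlternating? (elements (bilinear-finite N m))

  zero-form : ∀ N m → Bilinear N m
  zero-form N m = replicate m (replicate N (replicate N 0#))

  zero-alternating : ∀ N m → IsAlternating (zero-form N m)
  zero-alternating N m v =
    trans (Vec.map-replicate _ _ m) (cong (replicate m) zero-gram)
    where
    entry : ∀ i j →
      lookup v i * (lookup (lookup (replicate N (replicate N 0#)) i) j * lookup v j) ≡ 0#
    entry i j
      rewrite Vec.lookup-replicate i (replicate N 0#) | Vec.lookup-replicate j 0#
      = trans (cong (lookup v i *_) (zeroˡ _)) (zeroʳ _)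
    zero-gram : gram (replicate N (replicate N 0#)) v v ≡ 0#
    zero-gram = trans
      (sum-cong-≗ λ i → trans (sum-cong-≗ (entry i)) (sum-replicate-zero N))
      (sum-replicate-zero N)

  hom-Λ²-nonEmpty : ∀ N m → NonZero (List.length (hom-Λ² N m))
  hom-Λ²-nonEmpty N m =
    nonEmpty (∈ₚ.∈-filter⁺ isAlternating?
      (∈-elements (bilinear-finite N m) (zero-form N m)) (zero-alternating N m))
    where
    nonEmpty : ∀ {A : Set} {x : A} {xs} → x ∈ xs → NonZero (List.length xs)
    nonEmpty {xs = _ ∷ _} _ = _

  -- Λ²H is spanned by the u ∧ v with u, v ∈ H, so this is B(Λ²H) = 0.
  TotallyIsotropic : ∀ {N m} → Bilinear N m → VSubset N → Set
  TotallyIsotropic B H = ∀ u v → u ∈ᵥ H → v ∈ᵥ H → evaluate B u v ≡ 0ᵥ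

  totallyIsotropic? : ∀ {N m} (B : Bilinear N m) → Decidable (TotallyIsotropic B)
  totallyIsotropic? {N} B H = ∀? (vectors N) λ u → ∀? (vectors N) λ v →
    (u ∈ᵥ? H) →-dec ((v ∈ᵥ? H) →-dec (evaluate B u v ≟ 0ᵥ))

  IsIsotropicSubspace : ∀ {N m} → ℕ → Bilinear N m → VSubset N → Set
  IsIsotropicSubspace {N} r B H = IsSubspace N H × HasDimension N H r × TotallyIsotropic B H

  isIsotropicSubspace? : ∀ {N m} r (B : Bilinear N m) → Decidable (IsIsotropicSubspace r B)
  isIsotropicSubspace? {N} r B H =
    isSubspace? N H ×-dec hasDimension? N H r ×-dec totallyIsotropic? B H

  X : ∀ {N m} → ℕ → Bilinear N m → ℕ
  X {N} r B = count (subset-finite (q ℕ.^ N)) (isIsotropicSubspace? r B)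

  𝔼 : ∀ N m → (Bilinear N m → ℕ) → ℚ
  𝔼 N m = expectation (hom-Λ² N m) {{hom-Λ²-nonEmpty N m}}

  ℙ : ∀ N m {p} {P : Pred (Bilinear N m) p} → Decidable P → ℚ
  ℙ N m = probability (hom-Λ² N m) {{hom-Λ²-nonEmpty N m}}

fromℕ : ℕ → ℚ
fromℕ n = ℤ.+ n ℚ./ 1

record ℝ : Set where
  field
    approx : ℕ → ℚ
    cauchy : ∀ ε → 0ℚ ℚ.< ε →
             ∃[ K ] ∀ m n → K ℕ.≤ m → K ℕ.≤ n → ℚ.∣ approx m ℚ.- approx n ∣ ℚ.≤ ε

open ℝ

fromℚ : ℚ → ℝ
fromℚ p = record
  { approx = λ _ → p
  ; cauchy = λ ε ε>0 → 0 , λ _ _ _ _ →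
      subst (ℚ._≤ ε) (sym (cong ℚ.∣_∣ (ℚ.+-inverseʳ p))) (ℚ.<⇒≤ ε>0)
  }

infix 4 _≤ᴿ_

_≤ᴿ_ : ℝ → ℝ → Set
x ≤ᴿ y = ∀ ε → 0ℚ ℚ.< ε → ∃[ K ] ∀ n → K ℕ.≤ n → approx x n ℚ.≤ approx y n ℚ.+ ε

-- |x - y| ≤ ε, stated without forming the real number |x - y|.
Within : ℚ → ℝ → ℝ → Set
Within ε x y = ∀ δ → 0ℚ ℚ.< δ →
  ∃[ K ] ∀ n → K ℕ.≤ n → ℚ.∣ approx x n ℚ.- approx y n ∣ ℚ.≤ ε ℚ.+ δ

-- x r → L as r → ∞ through the r satisfying P
infix 4 _⟶_along_

_⟶_along_ : ∀ {p} → (ℕ → ℝ) → ℝ → Pred ℕ p → Set p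
x ⟶ L along P = ∀ ε → 0ℚ ℚ.< ε → ∃[ R ] ∀ r → R ℕ.≤ r → P r → Within ε (x r) L

private
  pos : ∀ {p} → 0ℚ ℚ.< p → ℚ.Positive p
  pos = ℚ.positive

  nonNeg : ∀ {p} → 0ℚ ℚ.≤ p → ℚ.NonNegative p
  nonNeg = ℚ.nonNegative

  cancel-middle : ∀ a b c → a ℚ.* (b ℚ.- c) ≡ a ℚ.* b ℚ.- a ℚ.* c
  cancel-middle = solve 3 (λ a b c → a :* (b :- c) := a :* b :- a :* c) refl
    where open +-*-Solver

infixr 7 _·ᴿ_

_·ᴿ_ : ℚ → ℝ → ℝ
approx (c ·ᴿ x) n = c ℚ.* approx x n
cauchy (c ·ᴿ x) ε ε>0 =
  let K , h = cauchy x ε′ (ℚ.positive⁻¹ ε′ {{ε′-pos}})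
  in K , λ m n K≤m K≤n → begin
    ℚ.∣ c ℚ.* approx x m ℚ.- c ℚ.* approx x n ∣
      ≡⟨ cong ℚ.∣_∣ (cancel-middle c (approx x m) (approx x n)) ⟨
    ℚ.∣ c ℚ.* (approx x m ℚ.- approx x n) ∣
      ≡⟨ ℚ.∣p*q∣≡∣p∣*∣q∣ c _ ⟩
    ℚ.∣ c ∣ ℚ.* ℚ.∣ approx x m ℚ.- approx x n ∣
      ≤⟨ ℚ.*-monoˡ-≤-nonNeg ℚ.∣ c ∣ {{ℚ.∣-∣-nonNeg c}} (h m n K≤m K≤n) ⟩
    ℚ.∣ c ∣ ℚ.* ε′
      ≤⟨ ℚ.*-monoʳ-≤-nonNeg ε′ {{ℚ.pos⇒nonNeg ε′ {{ε′-pos}}}} ∣c∣≤b ⟩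
    b ℚ.* (ℚ.1/ b ℚ.* ε)
      ≡⟨ ℚ.*-assoc b (ℚ.1/ b) ε ⟨
    b ℚ.* ℚ.1/ b ℚ.* ε
      ≡⟨ cong (ℚ._* ε) (ℚ.*-inverseʳ b) ⟩
    1ℚ ℚ.* ε
      ≡⟨ ℚ.*-identityˡ ε ⟩
    ε ∎
  where
  open ℚ.≤-Reasoning
  b = 1ℚ ℚ.+ ℚ.∣ c ∣
  instance
    ε-pos = pos ε>0
    c-nonNeg = ℚ.∣-∣-nonNeg c
    b-pos : ℚ.Positive b
    b-pos = ℚ.pos+nonNeg⇒pos 1ℚ ℚ.∣ c ∣
    b-nonZero = ℚ.pos⇒nonZero b
    1/b-pos = ℚ.1/pos⇒pos b
  ε′ = ℚ.1/ b ℚ.* ε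
  ε′-pos : ℚ.Positive ε′
  ε′-pos = ℚ.pos*pos⇒pos (ℚ.1/ b) ε
  ∣c∣≤b : ℚ.∣ c ∣ ℚ.≤ b
  ∣c∣≤b = subst (ℚ._≤ b) (ℚ.+-identityˡ ℚ.∣ c ∣)
    (ℚ.+-monoˡ-≤ ℚ.∣ c ∣ {0ℚ} {1ℚ} (ℚ.nonNegative⁻¹ 1ℚ))

module Reciprocal (x : ℝ) (x≥1 : ∀ n → 1ℚ ℚ.≤ approx x n) where

  private instance
    approx-pos : ∀ {n} → ℚ.Positive (approx x n)
    approx-pos {n} = pos (ℚ.<-≤-trans (ℚ.positive⁻¹ 1ℚ) (x≥1 n))
    approx-nonZero : ∀ {n} → ℚ.NonZero (approx x n)
    approx-nonZero {n} = ℚ.pos⇒nonZero (approx x n)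

  reciprocal : ℝ
  approx reciprocal n = ℚ.1/ approx x n
  cauchy reciprocal ε ε>0 =
    let K , h = cauchy x ε ε>0
    in K , λ m n K≤m K≤n → begin
      ℚ.∣ ℚ.1/ approx x m ℚ.- ℚ.1/ approx x n ∣
        ≡⟨ ℚ.*-identityʳ _ ⟨
      ℚ.∣ ℚ.1/ approx x m ℚ.- ℚ.1/ approx x n ∣ ℚ.* 1ℚ
        ≤⟨ ℚ.*-monoˡ-≤-nonNeg ℚ.∣ ℚ.1/ approx x m ℚ.- ℚ.1/ approx x n ∣
             {{ℚ.∣-∣-nonNeg (ℚ.1/ approx x m ℚ.- ℚ.1/ approx x n)}} (1≤ab (approx x m) (approx x n) (x≥1 m) (x≥1 n)) ⟩
      ℚ.∣ ℚ.1/ approx x m ℚ.- ℚ.1/ approx x n ∣ ℚ.* ℚ.∣ approx x n ℚ.* approx x m ∣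
        ≡⟨ ℚ.∣p*q∣≡∣p∣*∣q∣ (ℚ.1/ approx x m ℚ.- ℚ.1/ approx x n) (approx x n ℚ.* approx x m) ⟨
      ℚ.∣ (ℚ.1/ approx x m ℚ.- ℚ.1/ approx x n) ℚ.* (approx x n ℚ.* approx x m) ∣
        ≡⟨ cong ℚ.∣_∣ (clear (approx x m) (approx x n)) ⟩
      ℚ.∣ approx x n ℚ.- approx x m ∣
        ≤⟨ h n m K≤n K≤m ⟩
      ε ∎
    where
    open ℚ.≤-Reasoning
    1≤ab : ∀ a b → 1ℚ ℚ.≤ a → 1ℚ ℚ.≤ b → 1ℚ ℚ.≤ ℚ.∣ b ℚ.* a ∣
    1≤ab a b 1≤a 1≤b = begin
      1ℚ            ≤⟨ 1≤b ⟩
      b             ≡⟨ ℚ.*-identityʳ b ⟨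
      b ℚ.* 1ℚ      ≤⟨ ℚ.*-monoˡ-≤-nonNeg b {{nonNeg (ℚ.≤-trans (ℚ.nonNegative⁻¹ 1ℚ) 1≤b)}} 1≤a ⟩
      b ℚ.* a       ≤⟨ p≤∣p∣ (b ℚ.* a) ⟩
      ℚ.∣ b ℚ.* a ∣ ∎
      where
      p≤∣p∣ : ∀ p → p ℚ.≤ ℚ.∣ p ∣
      p≤∣p∣ p with ℚ.≤-total 0ℚ p
      ... | inj₁ 0≤p = ℚ.≤-reflexive (sym (ℚ.0≤p⇒∣p∣≡p 0≤p))
      ... | inj₂ p≤0 = ℚ.≤-trans p≤0 (ℚ.0≤∣p∣ p)
    clear : ∀ a b .{{_ : ℚ.NonZero a}} .{{_ : ℚ.NonZero b}} →
            (ℚ.1/ a ℚ.- ℚ.1/ b) ℚ.* (b ℚ.* a) ≡ b ℚ.- a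
    clear a b = begin-equality
      (ℚ.1/ a ℚ.- ℚ.1/ b) ℚ.* (b ℚ.* a)
        ≡⟨ solve 4 (λ a b a′ b′ →
             (a′ :- b′) :* (b :* a) := b :* (a′ :* a) :- a :* (b′ :* b)) refl
             a b (ℚ.1/ a) (ℚ.1/ b) ⟩
      b ℚ.* (ℚ.1/ a ℚ.* a) ℚ.- a ℚ.* (ℚ.1/ b ℚ.* b)
        ≡⟨ cong₂ (λ s t → b ℚ.* s ℚ.- a ℚ.* t) (ℚ.*-inverseˡ a) (ℚ.*-inverseˡ b) ⟩
      b ℚ.* 1ℚ ℚ.- a ℚ.* 1ℚ
        ≡⟨ cong₂ ℚ._-_ (ℚ.*-identityʳ b) (ℚ.*-identityʳ a) ⟩
      b ℚ.- a ∎
      where open +-*-Solver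

infixr 8 _^-_

_^-_ : (q : ℕ) .{{_ : NonTrivial q}} → ℕ → ℚ
q ^- j = ((ℤ.+ 1) ℚ./ q) ℚ^.^ j
  where instance q-nonZero = ℕ.nonTrivial⇒nonZero q

module EulerProduct (q : ℕ) .{{_ : NonTrivial q}} where

  instance
    q-nonZero = ℕ.nonTrivial⇒nonZero q

  ℚ2 : ℚ
  ℚ2 = ℤ.+ 2 ℚ./ 1

  p : ℚ
  p = ℤ.+ 1 ℚ./ q

  t : ℕ → ℚ
  t = q ^-_

  p-pos : ℚ.Positive p
  p-pos = ℚ.normalize-pos 1 q

  t-pos : ∀ j → ℚ.Positive (t j)
  t-pos zero    = _
  t-pos (suc j) = ℚ.pos*pos⇒pos p {{p-pos}} (t j) {{t-pos j}}

  t≥0 : ∀ j → ℚ.NonNegative (t j)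
  t≥0 j = ℚ.pos⇒nonNeg (t j) {{t-pos j}}

  p≤½ : p ℚ.≤ ½
  p≤½ = ℚ.toℚᵘ-cancel-≤ (ℚᵘ.≤-respˡ-≃ (ℚᵘ.≃-sym (toℚᵘ-p q)) (1/q≤½ q))
    where
    toℚᵘ-p : ∀ q .{{_ : NonZero q}} → ℚ.toℚᵘ (ℤ.+ 1 ℚ./ q) ℚᵘ.≃ (ℤ.+ 1 ℚᵘ./ q)
    toℚᵘ-p (suc q) = ℚ.toℚᵘ-fromℚᵘ (ℚᵘ.mkℚᵘ (ℤ.+ 1) q)
    1/q≤½ : ∀ q .{{_ : NonTrivial q}} .{{_ : NonZero q}} → (ℤ.+ 1 ℚᵘ./ q) ℚᵘ.≤ ℚᵘ.½
    1/q≤½ (suc (suc q)) = ℚᵘ.*≤* (ℤ.+≤+ (ℕ.s≤s (ℕ.s≤s ℕ.z≤n)))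

  halve : ∀ j → t (suc j) ℚ.≤ ½ ℚ.* t j
  halve j = ℚ.*-monoʳ-≤-nonNeg (t j) {{t≥0 j}} p≤½

  t≤1 : ∀ j → t j ℚ.≤ 1ℚ
  t-suc≤½ : ∀ j → t (suc j) ℚ.≤ ½
  t≤1 zero    = ℚ.≤-refl
  t≤1 (suc j) = ℚ.≤-trans (t-suc≤½ j) (ℚ.toℚᵘ-cancel-≤ (ℚᵘ.*≤* (ℤ.+≤+ (ℕ.s≤s ℕ.z≤n))))
  t-suc≤½ j   = ℚ.≤-trans (halve j) (ℚ.*-monoˡ-≤-nonNeg ½ (t≤1 j))

  ½≤factor : ∀ j → ½ ℚ.≤ 1ℚ ℚ.- t (suc j)
  ½≤factor j = ℚ.+-monoʳ-≤ 1ℚ (ℚ.neg-antimono-≤ (t-suc≤½ j))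

  factor-pos : ∀ j → ℚ.Positive (1ℚ ℚ.- q ^- suc j)
  factor-pos j = pos (ℚ.<-≤-trans (ℚ.positive⁻¹ ½) (½≤factor j))

  factor-nonZero : ∀ j → ℚ.NonZero (1ℚ ℚ.- q ^- suc j)
  factor-nonZero j = ℚ.pos⇒nonZero (1ℚ ℚ.- q ^- suc j) {{factor-pos j}}

  partialProduct : ℕ → ℚ
  partialProduct zero    = 1ℚ
  partialProduct (suc k) =
    partialProduct k ℚ.* (ℚ.1/ (1ℚ ℚ.- q ^- suc k)) {{factor-nonZero k}}

  P : ℕ → ℚ
  P = partialProduct

  P-pos : ∀ k → ℚ.Positive (P k)
  P-pos zero    = _
  P-pos (suc k) = ℚ.pos*pos⇒pos (P k) {{P-pos k}}
    ((ℚ.1/ (1ℚ ℚ.- t (suc k))) {{factor-nonZero k}})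
    {{ℚ.1/pos⇒pos (1ℚ ℚ.- t (suc k)) {{factor-pos k}}}}

  P≥0 : ∀ k → ℚ.NonNegative (P k)
  P≥0 k = ℚ.pos⇒nonNeg (P k) {{P-pos k}}

  P-step : ∀ k → P (suc k) ℚ.* (1ℚ ℚ.- t (suc k)) ≡ P k
  P-step k = trans (ℚ.*-assoc (P k) ((ℚ.1/ f) {{factor-nonZero k}}) f)
    (trans (cong (P k ℚ.*_) (ℚ.*-inverseˡ f {{factor-nonZero k}})) (ℚ.*-identityʳ (P k)))
    where f = 1ℚ ℚ.- t (suc k)

  open ℚ.≤-Reasoning

  x≤x*[1+y] : ∀ x y → ℚ.NonNegative x → ℚ.NonNegative y → x ℚ.≤ x ℚ.* (1ℚ ℚ.+ y)
  x≤x*[1+y] x y x≥0 y≥0 = begin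
    x                  ≡⟨ ℚ.*-identityʳ x ⟨
    x ℚ.* 1ℚ           ≤⟨ ℚ.*-monoˡ-≤-nonNeg x {{x≥0}}
                            (ℚ.+-monoʳ-≤ 1ℚ (ℚ.nonNegative⁻¹ y {{y≥0}})) ⟩
    x ℚ.* (1ℚ ℚ.+ y)   ∎

  P-mono-suc : ∀ k → P k ℚ.≤ P (suc k)
  P-mono-suc k = begin
    P k                                ≡⟨ P-step k ⟨
    P (suc k) ℚ.* (1ℚ ℚ.- t (suc k))   ≤⟨ ℚ.*-monoˡ-≤-nonNeg (P (suc k)) {{P≥0 (suc k)}}
                                           (ℚ.+-monoʳ-≤ 1ℚ {ℚ.- t (suc k)} {0ℚ}
                                             (ℚ.neg-antimono-≤
                                               (ℚ.nonNegative⁻¹ (t (suc k)) {{t≥0 (suc k)}}))) ⟩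
    P (suc k) ℚ.* 1ℚ                   ≡⟨ ℚ.*-identityʳ (P (suc k)) ⟩
    P (suc k)                          ∎

  P-mono : ∀ d k → P k ℚ.≤ P (d ℕ.+ k)
  P-mono zero    k = ℚ.≤-refl
  P-mono (suc d) k = ℚ.≤-trans (P-mono d k) (P-mono-suc (d ℕ.+ k))

  -- P k (1 + 2 q⁻ᵏ) is nonincreasing for k ≥ 1, which bounds the tails of P.
  U : ℕ → ℚ
  U k = P k ℚ.* (1ℚ ℚ.+ ℚ2 ℚ.* t k)

  U-anti-suc : ∀ j → U (suc (suc j)) ℚ.≤ U (suc j)
  U-anti-suc j = begin
    P (suc k) ℚ.* (1ℚ ℚ.+ ℚ2 ℚ.* t (suc k))
      ≤⟨ ℚ.*-monoˡ-≤-nonNeg (P (suc k)) {{P≥0 (suc k)}} key ⟩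
    P (suc k) ℚ.* ((1ℚ ℚ.- t (suc k)) ℚ.* (1ℚ ℚ.+ ℚ2 ℚ.* t k))
      ≡⟨ ℚ.*-assoc (P (suc k)) (1ℚ ℚ.- t (suc k)) (1ℚ ℚ.+ ℚ2 ℚ.* t k) ⟨
    P (suc k) ℚ.* (1ℚ ℚ.- t (suc k)) ℚ.* (1ℚ ℚ.+ ℚ2 ℚ.* t k)
      ≡⟨ cong (ℚ._* (1ℚ ℚ.+ ℚ2 ℚ.* t k)) (P-step k) ⟩
    P k ℚ.* (1ℚ ℚ.+ ℚ2 ℚ.* t k) ∎
    where
    k = suc j
    open +-*-Solver
    c = 1ℚ ℚ.+ ℚ2 ℚ.+ ℚ2 ℚ.* t k
    c≤4 : c ℚ.≤ ℤ.+ 4 ℚ./ 1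
    c≤4 = ℚ.+-monoʳ-≤ (1ℚ ℚ.+ ℚ2) (ℚ.*-monoˡ-≤-nonNeg ℚ2 (t-suc≤½ j))
    small : t (suc k) ℚ.* c ℚ.≤ ℚ2 ℚ.* t k
    small = begin
      t (suc k) ℚ.* c
        ≤⟨ ℚ.*-monoˡ-≤-nonNeg (t (suc k)) {{t≥0 (suc k)}} c≤4 ⟩
      t (suc k) ℚ.* (ℤ.+ 4 ℚ./ 1)
        ≤⟨ ℚ.*-monoʳ-≤-nonNeg (ℤ.+ 4 ℚ./ 1) (halve k) ⟩
      ½ ℚ.* t k ℚ.* (ℤ.+ 4 ℚ./ 1)
        ≡⟨ solve 1 (λ x → con ½ :* x :* con (ℤ.+ 4 ℚ./ 1) := con ℚ2 :* x) refl (t k) ⟩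
      ℚ2 ℚ.* t k ∎
    key : 1ℚ ℚ.+ ℚ2 ℚ.* t (suc k) ℚ.≤ (1ℚ ℚ.- t (suc k)) ℚ.* (1ℚ ℚ.+ ℚ2 ℚ.* t k)
    key = begin
      1ℚ ℚ.+ ℚ2 ℚ.* t (suc k)
        ≡⟨ solve 2 (λ x y →
             con 1ℚ :+ con ℚ2 :* y :=
             (con 1ℚ :+ con ℚ2 :* y :- y :* (con 1ℚ :+ con ℚ2 :+ con ℚ2 :* x))
               :+ y :* (con 1ℚ :+ con ℚ2 :+ con ℚ2 :* x))
             refl (t k) (t (suc k)) ⟩
      (1ℚ ℚ.+ ℚ2 ℚ.* t (suc k) ℚ.- t (suc k) ℚ.* c) ℚ.+ t (suc k) ℚ.* c
        ≤⟨ ℚ.+-monoʳ-≤ (1ℚ ℚ.+ ℚ2 ℚ.* t (suc k) ℚ.- t (suc k) ℚ.* c) small ⟩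
      (1ℚ ℚ.+ ℚ2 ℚ.* t (suc k) ℚ.- t (suc k) ℚ.* c) ℚ.+ ℚ2 ℚ.* t k
        ≡⟨ solve 2 (λ x y →
             (con 1ℚ :+ con ℚ2 :* y :- y :* (con 1ℚ :+ con ℚ2 :+ con ℚ2 :* x))
               :+ con ℚ2 :* x :=
             (con 1ℚ :- y) :* (con 1ℚ :+ con ℚ2 :* x))
             refl (t k) (t (suc k)) ⟩
      (1ℚ ℚ.- t (suc k)) ℚ.* (1ℚ ℚ.+ ℚ2 ℚ.* t k) ∎

  U-anti : ∀ d j → U (d ℕ.+ suc j) ℚ.≤ U (suc j)
  U-anti zero    j = ℚ.≤-refl
  U-anti (suc d) j = ℚ.≤-trans
    (subst (λ i → U (suc i) ℚ.≤ U i) (sym (ℕ.+-suc d j)) (U-anti-suc (d ℕ.+ j)))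
    (U-anti d j)

  P≤U : ∀ k → P k ℚ.≤ U k
  P≤U k = x≤x*[1+y] (P k) (ℚ2 ℚ.* t k) (P≥0 k)
    (ℚ.nonNeg*nonNeg⇒nonNeg ℚ2 (t k) {{t≥0 k}})

  P1≤2 : P 1 ℚ.≤ ℚ2
  P1≤2 = ℚ.*-cancelʳ-≤-pos ½ (begin
    P 1 ℚ.* ½              ≤⟨ ℚ.*-monoˡ-≤-nonNeg (P 1) {{P≥0 1}} (½≤factor 0) ⟩
    P 1 ℚ.* (1ℚ ℚ.- t 1)   ≡⟨ P-step 0 ⟩
    1ℚ                     ∎)

  P-suc≤4 : ∀ j → P (suc j) ℚ.≤ ℤ.+ 4 ℚ./ 1
  P-suc≤4 j = begin
    P (suc j)      ≤⟨ P≤U (suc j) ⟩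
    U (suc j)      ≡⟨ cong U (ℕ.+-comm j 1) ⟨
    U (j ℕ.+ 1)    ≤⟨ U-anti j 0 ⟩
    P 1 ℚ.* (1ℚ ℚ.+ ℚ2 ℚ.* t 1)
                   ≤⟨ ℚ.*-monoˡ-≤-nonNeg (P 1) {{P≥0 1}}
                        (ℚ.+-monoʳ-≤ 1ℚ (ℚ.*-monoˡ-≤-nonNeg ℚ2 (t-suc≤½ 0))) ⟩
    P 1 ℚ.* ℚ2     ≤⟨ ℚ.*-monoʳ-≤-nonNeg ℚ2 P1≤2 ⟩
    ℚ2 ℚ.* ℚ2      ∎

  ℚ8 : ℚ
  ℚ8 = ℤ.+ 8 ℚ./ 1

  tail : ∀ d j → P (d ℕ.+ suc j) ℚ.≤ P (suc j) ℚ.+ ℚ8 ℚ.* t (suc j)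
  tail d j = begin
    P (d ℕ.+ suc j)                          ≤⟨ P≤U (d ℕ.+ suc j) ⟩
    U (d ℕ.+ suc j)                          ≤⟨ U-anti d j ⟩
    P k ℚ.* (1ℚ ℚ.+ ℚ2 ℚ.* t k)              ≡⟨ solve 2 (λ a x →
                                                  a :* (con 1ℚ :+ con ℚ2 :* x) :=
                                                  a :+ a :* (con ℚ2 :* x)) refl (P k) (t k) ⟩
    P k ℚ.+ P k ℚ.* (ℚ2 ℚ.* t k)             ≤⟨ ℚ.+-monoʳ-≤ (P k)
                                                  (ℚ.*-monoʳ-≤-nonNeg (ℚ2 ℚ.* t k)
                                                    {{ℚ.nonNeg*nonNeg⇒nonNeg ℚ2 (t k) {{t≥0 k}}}}
                                                    (P-suc≤4 j)) ⟩
    P k ℚ.+ (ℤ.+ 4 ℚ./ 1) ℚ.* (ℚ2 ℚ.* t k)   ≡⟨ cong (P k ℚ.+_)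
                                                  (ℚ.*-assoc (ℤ.+ 4 ℚ./ 1) ℚ2 (t k)) ⟨
    P k ℚ.+ ℚ8 ℚ.* t k                       ∎
    where
    k = suc j
    open +-*-Solver

  toℚᵘ-fromℕ : ∀ n → ℚ.toℚᵘ (fromℕ n) ℚᵘ.≃ ℚᵘ.mkℚᵘ (ℤ.+ n) 0
  toℚᵘ-fromℕ n = ℚ.toℚᵘ-fromℚᵘ (ℚᵘ.mkℚᵘ (ℤ.+ n) 0)

  fromℕ-suc : ∀ n → fromℕ (suc n) ≡ 1ℚ ℚ.+ fromℕ n
  fromℕ-suc n = ℚ.toℚᵘ-injective
    (ℚᵘ.≃-trans (toℚᵘ-fromℕ (suc n))
    (ℚᵘ.≃-trans (ℚᵘ.*≡* (cong (ℤ._* ℤ.1ℤ) (cong (λ i → ℤ.+ 1 ℤ.+ i) (sym (ℤ.*-identityʳ (ℤ.+ n))))))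
    (ℚᵘ.≃-sym (ℚᵘ.≃-trans (ℚ.toℚᵘ-homo-+ 1ℚ (fromℕ n))
      (ℚᵘ.+-congʳ ℚᵘ.1ℚᵘ (toℚᵘ-fromℕ n))))))

  archimedean : ∀ ε → 0ℚ ℚ.< ε → ∃[ b ] 1ℚ ℚ.≤ fromℕ (suc b) ℚ.* ε
  archimedean ε ε>0 = go ε (pos ε>0)
    where
    go : ∀ ε → ℚ.Positive ε → ∃[ b ] 1ℚ ℚ.≤ fromℕ (suc b) ℚ.* ε
    go ε@(ℚ.mkℚ (ℤ.+ suc n) b _) _ = b , ℚ.toℚᵘ-cancel-≤
      (ℚᵘ.≤-respʳ-≃
        (ℚᵘ.≃-sym (ℚᵘ.≃-trans (ℚ.toℚᵘ-homo-* (fromℕ (suc b)) ε)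
          (ℚᵘ.*-congʳ {ℚ.toℚᵘ ε} (toℚᵘ-fromℕ (suc b)))))
        (ℚᵘ.*≤* (ℤ.+≤+ 1≤)))
      where
      1≤ : 1 ℕ.* (1 ℕ.* suc b) ℕ.≤ (suc b ℕ.* suc n) ℕ.* 1
      1≤ = ℕ.≤-trans (ℕ.≤-reflexive (trans (ℕ.*-identityˡ _) (ℕ.*-identityˡ _)))
        (ℕ.≤-trans (ℕ.m≤m*n (suc b) (suc n)) (ℕ.≤-reflexive (sym (ℕ.*-identityʳ _))))

  n*t≤1 : ∀ n → fromℕ n ℚ.* t n ℚ.≤ 1ℚ
  n*t≤1 zero    = ℚ.≤-trans (ℚ.≤-reflexive (ℚ.*-zeroˡ 1ℚ)) (ℚ.nonNegative⁻¹ 1ℚ)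
  n*t≤1 (suc n) = begin
    fromℕ (suc n) ℚ.* t (suc n)
      ≤⟨ ℚ.*-monoˡ-≤-nonNeg (fromℕ (suc n)) {{ℚ.normalize-nonNeg (suc n) 1}} (halve n) ⟩
    fromℕ (suc n) ℚ.* (½ ℚ.* t n)
      ≡⟨ cong (ℚ._* (½ ℚ.* t n)) (fromℕ-suc n) ⟩
    (1ℚ ℚ.+ fromℕ n) ℚ.* (½ ℚ.* t n)
      ≡⟨ solve 2 (λ a x → (con 1ℚ :+ a) :* (con ½ :* x) := con ½ :* (x :+ a :* x))
           refl (fromℕ n) (t n) ⟩
    ½ ℚ.* (t n ℚ.+ fromℕ n ℚ.* t n)
      ≤⟨ ℚ.*-monoˡ-≤-nonNeg ½ (ℚ.+-mono-≤ (t≤1 n) (n*t≤1 n)) ⟩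
    1ℚ ∎
    where open +-*-Solver

  ∣x-y∣≤e : ∀ a e {x y} → a ℚ.≤ x → x ℚ.≤ a ℚ.+ e → a ℚ.≤ y → y ℚ.≤ a ℚ.+ e →
            ℚ.∣ x ℚ.- y ∣ ℚ.≤ e
  ∣x-y∣≤e a e {x} {y} a≤x x≤ a≤y y≤ with ℚ.∣p∣≡p∨∣p∣≡-p (x ℚ.- y)
  ... | inj₁ eq = subst (ℚ._≤ e) (sym eq) (begin
    x ℚ.- y            ≤⟨ ℚ.+-mono-≤ x≤ (ℚ.neg-antimono-≤ a≤y) ⟩
    a ℚ.+ e ℚ.- a      ≡⟨ solve 2 (λ a e → a :+ e :- a := e) refl a e ⟩
    e                  ∎)
    where open +-*-Solver
  ... | inj₂ eq = subst (ℚ._≤ e) (sym eq) (begin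
    ℚ.- (x ℚ.- y)      ≡⟨ solve 2 (λ x y → :- (x :- y) := y :- x) refl x y ⟩
    y ℚ.- x            ≤⟨ ℚ.+-mono-≤ y≤ (ℚ.neg-antimono-≤ a≤x) ⟩
    a ℚ.+ e ℚ.- a      ≡⟨ solve 2 (λ a e → a :+ e :- a := e) refl a e ⟩
    e                  ∎)
    where open +-*-Solver

  P-cauchy : ∀ ε → 0ℚ ℚ.< ε →
    ∃[ K ] ∀ m n → K ℕ.≤ m → K ℕ.≤ n → ℚ.∣ P m ℚ.- P n ∣ ℚ.≤ ε
  P-cauchy ε ε>0 = k , λ m n k≤m k≤n → ℚ.≤-trans
    (∣x-y∣≤e (P k) (ℚ8 ℚ.* t k) (lower k≤m) (upper k≤m) (lower k≤n) (upper k≤n)) small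
    where
    open +-*-Solver
    ⅛ = ℤ.+ 1 ℚ./ 8
    instance
      ε-pos = pos ε>0
      ε⅛-pos = ℚ.pos*pos⇒pos ε ⅛
    arch = archimedean (ε ℚ.* ⅛) (ℚ.positive⁻¹ (ε ℚ.* ⅛))
    j = proj₁ arch
    k = suc j
    lower : ∀ {n} → k ℕ.≤ n → P k ℚ.≤ P n
    lower {n} k≤n = subst (λ i → P k ℚ.≤ P i) (ℕ.m∸n+n≡m k≤n) (P-mono (n ℕ.∸ k) k)
    upper : ∀ {n} → k ℕ.≤ n → P n ℚ.≤ P k ℚ.+ ℚ8 ℚ.* t k
    upper {n} k≤n = subst (λ i → P i ℚ.≤ P k ℚ.+ ℚ8 ℚ.* t k) (ℕ.m∸n+n≡m k≤n)
      (tail (n ℕ.∸ k) j)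
    8t-nonNeg : ℚ.NonNegative (ℚ8 ℚ.* t k)
    8t-nonNeg = ℚ.nonNeg*nonNeg⇒nonNeg ℚ8 (t k) {{t≥0 k}}
    small : ℚ8 ℚ.* t k ℚ.≤ ε
    small = begin
      ℚ8 ℚ.* t k
        ≡⟨ ℚ.*-identityʳ (ℚ8 ℚ.* t k) ⟨
      ℚ8 ℚ.* t k ℚ.* 1ℚ
        ≤⟨ ℚ.*-monoˡ-≤-nonNeg (ℚ8 ℚ.* t k) {{8t-nonNeg}} (proj₂ arch) ⟩
      ℚ8 ℚ.* t k ℚ.* (fromℕ k ℚ.* (ε ℚ.* ⅛))
        ≡⟨ solve 3 (λ x f e →
             con ℚ8 :* x :* (f :* (e :* con ⅛)) := f :* x :* e) refl (t k) (fromℕ k) ε ⟩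
      fromℕ k ℚ.* t k ℚ.* ε
        ≤⟨ ℚ.*-monoʳ-≤-nonNeg ε {{ℚ.pos⇒nonNeg ε}} (n*t≤1 k) ⟩
      1ℚ ℚ.* ε
        ≡⟨ ℚ.*-identityˡ ε ⟩
      ε ∎

  -- C_q = ∏_{j≥1} (1 - q⁻ʲ)⁻¹
  C : ℝ
  C = record { approx = partialProduct ; cauchy = P-cauchy }

  1≤C : ∀ n → 1ℚ ℚ.≤ approx C n
  1≤C zero    = ℚ.≤-refl
  1≤C (suc n) = ℚ.≤-trans (1≤C n) (P-mono-suc n)

  1/C : ℝ
  1/C = Reciprocal.reciprocal C 1≤C

{-# OPTIONS --safe #-}

module Submission where

-- X is counted through bases: if gl is the number of ordered bases of F^r, then
-- gl · X is the number of linearly independent r-tuples on which B vanishes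
-- pairwise.  Imposing B(u,v) = 0 on a linear space of forms divides its cardinality
-- by at most q^m, and by exactly q^m for the pairs of a linearly independent family,
-- as the forms φ ∧ ψ of separating functionals show.  With P_k = ∏_{j≤k} (1 - q⁻ʲ)⁻¹
-- and N = r + s this gives 𝔼X = P_s P_r / P_N in both parts, so 𝔼X ≤ P_r ≤ C_q.
-- (i) An isotropic subspace of dimension r = 2s+1 in dimension 3s+1 contains s+1
-- independent radical vectors, and the expected number of (s+1)-dimensional
-- subspaces of the radical is at most P_{s+1} q^{-s(s+1)/2}.
-- (ii) On an odd-dimensional space B₁ has a radical vector v; pass to the
-- complement of v in the kernel of B₂(v,·) and induct.  For the second moment, fix
-- an isotropic H and 1 ≤ d ≤ r.  There are q^p subspaces K with dim (H ∩ K) = d that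
-- are explicit graphs, and making one of them isotropic in addition costs at most
-- the same factor q^p.  Summing over d gives 𝔼X² ≥ r 𝔼X, that is
-- 𝔼X(X-1) ≥ (r-1) 𝔼X, which is divided by (𝔼X)² ≤ C_q 𝔼X.

open import Defs
open import Algebra.Bundles using (CommutativeRing)
import Algebra.Properties.CommutativeMonoid.Sum
import Algebra.Properties.CommutativeSemigroup
import Algebra.Properties.Monoid.Sum
import Algebra.Properties.Ring
import Algebra.Properties.Semiring.Sum
open import Data.Bool.Base using (true; if_then_else_)
open import Data.Fin.Base as Fin using (Fin; toℕ)
import Data.Fin.Properties as Fin
import Data.Fin.Subset as Subset
import Data.Fin.Subset.Properties as Subset
open import Data.Integer.Base as ℤ using ()
import Data.Integer.Properties as ℤ
open import Data.List.Base as List using (List; []; _∷_; length; filter)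
import Data.List.Properties as List
open import Data.List.Membership.Propositional using (_∈_)
open import Data.List.Relation.Unary.All as All using (All; []; _∷_)
import Data.List.Relation.Unary.All.Properties as All
open import Data.List.Relation.Unary.Any using (here; there)
open import Data.List.Relation.Unary.Unique.Propositional using (Unique; []; _∷_)
import Data.List.Relation.Unary.Unique.Propositional.Properties as Unique
open import Data.Nat.Base as ℕ using (ℕ; zero; suc; _+_; _*_; _∸_; _/_; _≤_; z≤n; s≤s; _^_; NonTrivial; NonZero)
import Data.Nat.DivMod as ℕ
open import Data.Nat.ListAction using (sum)
open import Data.Nat.ListAction.Properties using (sum-++)
open import Data.Nat.Properties as ℕₚ using (_<?_)
open import Data.Nat.Tactic.RingSolver using (solve-∀)
open import Data.Product.Base using (Σ; _×_; ∃-syntax; _,_; proj₁; proj₂)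
open import Data.Product.Properties using (≡-dec)
open import Data.Rational.Base as ℚ using (ℚ; 0ℚ; 1ℚ; ½)
open import Data.Rational.Properties as ℚₚ using ()
open import Data.Rational.Solver using (module +-*-Solver)
import Data.Rational.Unnormalised.Base as ℚᵘ
import Data.Rational.Unnormalised.Properties as ℚᵘₚ
open import Data.Sum.Base using (_⊎_; inj₁; inj₂)
open import Data.Unit.Base using (⊤; tt)
open import Data.Vec.Base as Vec using (Vec; []; _∷_; lookup)
import Data.Vec.Properties as Vec
open import Data.Vec.Relation.Unary.All as Allᵛ using ([]; _∷_) renaming (All to Allᵛ)
import Data.Vec.Relation.Unary.All.Properties as Allᵛ
open import Function.Base using (_∘_)
open import Function.Bundles using (_↔_; module Inverse)
open import Function.Properties.Inverse using (↔-refl)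
open import Relation.Binary.Definitions using (DecidableEquality)
open import Relation.Binary.PropositionalEquality
open import Relation.Nullary.Decidable using (Dec; yes; no; does; _×-dec_; _→-dec_; ¬?; decidable-stable; dec-true)
open import Relation.Nullary.Negation using (¬_; contradiction)
open import Relation.Unary using (Pred; Decidable)

-- Counting by double sums

-- The powers of q cancel in 𝔼X because m r(r-1)/2 = r s: the r-dimensional subspaces form a family
-- of dimension r s, and isotropy imposes m conditions per pair of basis vectors. Part (i) has m =
-- 1, s = (r-1)/2, part (ii) has m = 2, s = r-1. What remains, P_s P_r / P_N, tends to C_q C_q /
-- C_q. In (i) the expectation is carried by rare forms. An isotropic H of dimension s + (s+1) is
-- paired with a complement of dimension s only, so s+1 of its dimensions are radical; the exponent
-- s(s+1)/2 = (r²-1)/8 is the codimension of the alternating forms of corank s+1. In (ii) a lower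
-- bound suffices, so the K with dim (H ∩ K) = d need not all be described. With c = r - d, the
-- number p = c(r-1) + c d counts both the parameters of the graphs and the scalar equations that
-- isotropy adds; dependence among the equations only helps. The case d = r is K = H, the 1 in
-- X(X-1). Identities between counts are kept in ℕ with denominators multiplied out, and upper
-- bounds come from injections; dimensions too are compared through q^m ≤ q^n.

𝟙 : ∀ {p} {P : Set p} → Dec P → ℕ
𝟙 P? = if does P? then 1 else 0

module _ {p} {P : Set p} where

  𝟙-yes : (P? : Dec P) → P → 𝟙 P? ≡ 1
  𝟙-yes (yes _) _ = refl
  𝟙-yes (no ¬x) x = contradiction x ¬x

  𝟙-no : (P? : Dec P) → ¬ P → 𝟙 P? ≡ 0
  𝟙-no (yes x) ¬x = contradiction x ¬x
  𝟙-no (no _)  _  = refl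

  module _ {r} {Q : Set r} where

    𝟙-mono : (P? : Dec P) (Q? : Dec Q) → (P → Q) → 𝟙 P? ≤ 𝟙 Q?
    𝟙-mono (yes _) (yes _) _ = ℕₚ.≤-refl
    𝟙-mono (yes x) (no ¬y) f = contradiction (f x) ¬y
    𝟙-mono (no _)  _       _ = z≤n

    𝟙-× : (P? : Dec P) (Q? : Dec Q) → 𝟙 (P? ×-dec Q?) ≡ 𝟙 P? * 𝟙 Q?
    𝟙-× (yes _) (yes _) = refl
    𝟙-× (yes _) (no _)  = refl
    𝟙-× (no _)  _       = refl

module _ {p r} {P : Set p} {Q : Set r} where

  𝟙-cong : (P? : Dec P) (Q? : Dec Q) → (P → Q) → (Q → P) → 𝟙 P? ≡ 𝟙 Q?
  𝟙-cong P? Q? f g = ℕₚ.≤-antisym (𝟙-mono P? Q? f) (𝟙-mono Q? P? g)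

module _ {a} {A : Set a} where

  ∑ˡ : List A → (A → ℕ) → ℕ
  ∑ˡ xs f = sum (List.map f xs)

  ∑ˡ-cong : ∀ xs {f g : A → ℕ} → (∀ x → f x ≡ g x) → ∑ˡ xs f ≡ ∑ˡ xs g
  ∑ˡ-cong xs f≗g = cong sum (List.map-cong f≗g xs)

  ∑ˡ-mono : ∀ xs {f g : A → ℕ} → (∀ x → f x ≤ g x) → ∑ˡ xs f ≤ ∑ˡ xs g
  ∑ˡ-mono []       f≤g = z≤n
  ∑ˡ-mono (x ∷ xs) f≤g = ℕₚ.+-mono-≤ (f≤g x) (∑ˡ-mono xs f≤g)

  ∑ˡ-zero : ∀ xs → ∑ˡ xs (λ _ → 0) ≡ 0
  ∑ˡ-zero []       = refl
  ∑ˡ-zero (_ ∷ xs) = ∑ˡ-zero xs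

  ∑ˡ-const : ∀ xs c → ∑ˡ xs (λ _ → c) ≡ length xs * c
  ∑ˡ-const []       c = refl
  ∑ˡ-const (_ ∷ xs) c = cong (c +_) (∑ˡ-const xs c)

  ∑ˡ-+ : ∀ xs (f g : A → ℕ) → ∑ˡ xs (λ x → f x + g x) ≡ ∑ˡ xs f + ∑ˡ xs g
  ∑ˡ-+ []       f g = refl
  ∑ˡ-+ (x ∷ xs) f g = begin
    f x + g x + ∑ˡ xs (λ x → f x + g x)   ≡⟨ cong (f x + g x +_) (∑ˡ-+ xs f g) ⟩
    f x + g x + (∑ˡ xs f + ∑ˡ xs g)       ≡⟨ +-interchange (f x) (g x) _ _ ⟩
    f x + ∑ˡ xs f + (g x + ∑ˡ xs g)       ∎
    where
    open ≡-Reasoning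
    open import Algebra.Properties.CommutativeSemigroup ℕₚ.+-commutativeSemigroup
      using () renaming (interchange to +-interchange)

  ∑ˡ-*ˡ : ∀ xs c (f : A → ℕ) → ∑ˡ xs (λ x → c * f x) ≡ c * ∑ˡ xs f
  ∑ˡ-*ˡ []       c f = sym (ℕₚ.*-zeroʳ c)
  ∑ˡ-*ˡ (x ∷ xs) c f =
    trans (cong (c * f x +_) (∑ˡ-*ˡ xs c f)) (sym (ℕₚ.*-distribˡ-+ c (f x) _))

  ∑ˡ-*ʳ : ∀ xs c (f : A → ℕ) → ∑ˡ xs (λ x → f x * c) ≡ ∑ˡ xs f * c
  ∑ˡ-*ʳ xs c f = trans (∑ˡ-cong xs λ x → ℕₚ.*-comm (f x) c)
    (trans (∑ˡ-*ˡ xs c f) (ℕₚ.*-comm c _))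

  ∑ˡ-++ : ∀ xs ys (f : A → ℕ) → ∑ˡ (xs List.++ ys) f ≡ ∑ˡ xs f + ∑ˡ ys f
  ∑ˡ-++ xs ys f = trans (cong sum (List.map-++ f xs ys)) (sum-++ (List.map f xs) _)

  ∑ˡ-filter : ∀ {p} {P : Pred A p} (P? : Decidable P) xs (f : A → ℕ) →
    ∑ˡ (filter P? xs) f ≡ ∑ˡ xs (λ x → 𝟙 (P? x) * f x)
  ∑ˡ-filter P? []       f = refl
  ∑ˡ-filter P? (x ∷ xs) f with P? x
  ... | yes _ = cong₂ _+_ (sym (ℕₚ.*-identityˡ (f x))) (∑ˡ-filter P? xs f)
  ... | no  _ = ∑ˡ-filter P? xs f

  length-filter : ∀ {p} {P : Pred A p} (P? : Decidable P) xs →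
    length (filter P? xs) ≡ ∑ˡ xs (λ x → 𝟙 (P? x))
  length-filter P? []       = refl
  length-filter P? (x ∷ xs) with P? x
  ... | yes _ = cong suc (length-filter P? xs)
  ... | no  _ = length-filter P? xs

∑ˡ-map : ∀ {a b} {A : Set a} {B : Set b} (g : A → B) xs (f : B → ℕ) →
  ∑ˡ (List.map g xs) f ≡ ∑ˡ xs (f ∘ g)
∑ˡ-map g xs f = cong sum (sym (List.map-∘ xs))

∑ˡ-swap : ∀ {a b} {A : Set a} {B : Set b} (xs : List A) (ys : List B) (f : A → B → ℕ) →
  ∑ˡ xs (λ x → ∑ˡ ys (f x)) ≡ ∑ˡ ys (λ y → ∑ˡ xs (λ x → f x y))
∑ˡ-swap []       ys f = sym (∑ˡ-zero ys)
∑ˡ-swap (x ∷ xs) ys f = trans (cong (∑ˡ ys (f x) +_) (∑ˡ-swap xs ys f))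
  (sym (∑ˡ-+ ys (f x) λ y → ∑ˡ xs (λ x → f x y)))

∑ˡ-cartesianProduct : ∀ {a b} {A : Set a} {B : Set b} (xs : List A) (ys : List B) (f : A × B → ℕ) →
  ∑ˡ (List.cartesianProduct xs ys) f ≡ ∑ˡ xs (λ x → ∑ˡ ys (λ y → f (x , y)))
∑ˡ-cartesianProduct []       ys f = refl
∑ˡ-cartesianProduct (x ∷ xs) ys f = trans
  (∑ˡ-++ (List.map (x ,_) ys) (List.cartesianProduct xs ys) f)
  (cong₂ _+_ (∑ˡ-map (x ,_) ys f) (∑ˡ-cartesianProduct xs ys f))

-- `once` expresses completeness and absence of repetition by a single identity, the one through
-- which a sum against a Kronecker delta collapses.
record Enumeration (A : Set) : Set where
  infix 4 _≟_
  field
    members : List A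
    _≟_     : DecidableEquality A
    once    : ∀ x → ∑ˡ members (λ y → 𝟙 (x ≟ y)) ≡ 1

  ∑ : (A → ℕ) → ℕ
  ∑ = ∑ˡ members

  # : ∀ {p} {P : Pred A p} → Decidable P → ℕ
  # P? = ∑ λ x → 𝟙 (P? x)

  pick : ∀ x (f : A → ℕ) → ∑ (λ y → 𝟙 (x ≟ y) * f y) ≡ f x
  pick x f = begin
    ∑ (λ y → 𝟙 (x ≟ y) * f y)   ≡⟨ ∑ˡ-cong members (λ y → only y (x ≟ y)) ⟩
    ∑ (λ y → 𝟙 (x ≟ y) * f x)   ≡⟨ ∑ˡ-*ʳ members (f x) (λ y → 𝟙 (x ≟ y)) ⟩
    ∑ (λ y → 𝟙 (x ≟ y)) * f x   ≡⟨ cong (_* f x) (once x) ⟩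
    1 * f x                     ≡⟨ ℕₚ.*-identityˡ (f x) ⟩
    f x                         ∎
    where
    open ≡-Reasoning
    only : ∀ y (d : Dec (x ≡ y)) → 𝟙 d * f y ≡ 𝟙 d * f x
    only y (yes refl) = refl
    only y (no _)     = refl

  #≤1 : ∀ {p} {P : Pred A p} (P? : Decidable P) →
    (∀ x y → P x → P y → x ≡ y) → # P? ≤ 1
  #≤1 P? unique = go members once≤1
    where
    once≤1 : ∀ x → ∑ˡ members (λ y → 𝟙 (x ≟ y)) ≤ 1
    once≤1 x = ℕₚ.≤-reflexive (once x)
    -- On suffixes of `members` only the bound by 1 survives, so that is what the induction carries.
    -- At the first `x` with `P x` all later hits are copies of `x`, and the bound already limits
    -- its occurrences.
    go : ∀ xs → (∀ x → ∑ˡ xs (λ y → 𝟙 (x ≟ y)) ≤ 1) → ∑ˡ xs (λ x → 𝟙 (P? x)) ≤ 1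
    go []       _ = z≤n
    go (x ∷ xs) h with P? x
    ... | no _ = go xs λ y → ℕₚ.≤-trans (ℕₚ.m≤n+m _ (𝟙 (y ≟ x))) (h y)
    ... | yes Px = ℕₚ.≤-trans
      (ℕₚ.+-mono-≤ (ℕₚ.≤-reflexive (sym (𝟙-yes (x ≟ x) refl)))
        (∑ˡ-mono xs λ y → 𝟙-mono (P? y) (x ≟ y) (unique x y Px)))
      (h x)

  #≡1 : ∀ {p} {P : Pred A p} (P? : Decidable P) →
    ∀ x → P x → (∀ y → P y → x ≡ y) → # P? ≡ 1
  #≡1 P? x Px unique = trans
    (∑ˡ-cong members λ y → 𝟙-cong (P? y) (x ≟ y) (unique y) (λ { refl → Px }))
    (once x)

  1≤# : ∀ {p} {P : Pred A p} (P? : Decidable P) → ∀ x → P x → 1 ≤ # P?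
  1≤# P? x Px = ℕₚ.≤-trans (ℕₚ.≤-reflexive (sym (once x)))
    (∑ˡ-mono members λ y → 𝟙-mono (x ≟ y) (P? y) (λ { refl → Px }))

  #≤𝟙 : ∀ {p r} {P : Pred A p} {Q : Set r} (P? : Decidable P) (Q? : Dec Q) →
    (∀ x → P x → Q) → (∀ x y → P x → P y → x ≡ y) → # P? ≤ 𝟙 Q?
  #≤𝟙 P? (yes _) P⇒Q unique = #≤1 P? unique
  #≤𝟙 P? (no ¬Q) P⇒Q unique = ℕₚ.≤-reflexive (trans
    (∑ˡ-cong members λ x → 𝟙-no (P? x) (¬Q ∘ P⇒Q x)) (∑ˡ-zero members))

  #-cong : ∀ {p r} {P : Pred A p} {Q : Pred A r} (P? : Decidable P) (Q? : Decidable Q) →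
    (∀ x → P x → Q x) → (∀ x → Q x → P x) → # P? ≡ # Q?
  #-cong P? Q? f g = ∑ˡ-cong members λ x → 𝟙-cong (P? x) (Q? x) (f x) (g x)

  #-mono : ∀ {p r} {P : Pred A p} {Q : Pred A r} (P? : Decidable P) (Q? : Decidable Q) →
    (∀ x → P x → Q x) → # P? ≤ # Q?
  #-mono P? Q? f = ∑ˡ-mono members λ x → 𝟙-mono (P? x) (Q? x) (f x)

open Enumeration using (members; ∑; #)

once-unique : ∀ {A : Set} (_≟_ : DecidableEquality A) {xs : List A} → Unique xs →
  ∀ {x} → x ∈ xs → ∑ˡ xs (λ y → 𝟙 (x ≟ y)) ≡ 1
once-unique {A} _≟_ (x∉xs ∷ _) {x} (here refl) = cong₂ _+_ (𝟙-yes (x ≟ x) refl) (absent x∉xs)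
  where
  absent : ∀ {xs} → All (x ≢_) xs → ∑ˡ xs (λ y → 𝟙 (x ≟ y)) ≡ 0
  absent []              = refl
  absent (_∷_ {y} x≢y h) = cong₂ _+_ (𝟙-no (x ≟ y) x≢y) (absent h)
once-unique _≟_ (_∷_ {y} y∉xs u) {x} (there x∈xs) = cong₂ _+_
  (𝟙-no (x ≟ y) (λ { refl → All.lookup y∉xs x∈xs refl }))
  (once-unique _≟_ u x∈xs)

enumerate : ∀ {A : Set} {n} → A ↔ Fin n → Enumeration A
enumerate {n = n} fin = record
  { members = elements fin
  ; _≟_     = finite⇒≟ fin
  ; once    = λ x → once-unique (finite⇒≟ fin)
                (Unique.map⁺ from-injective (Unique.allFin⁺ n)) (∈-elements fin x)
  }
  where
  open Inverse fin
  from-injective : ∀ {i j} → from i ≡ from j → i ≡ j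
  from-injective eq = trans (sym (strictlyInverseˡ _)) (trans (cong to eq) (strictlyInverseˡ _))

∑-const : ∀ {A : Set} {n} (fin : A ↔ Fin n) c → ∑ (enumerate fin) (λ _ → c) ≡ n * c
∑-const {n = n} fin c = trans (∑ˡ-const (elements fin) c)
  (cong (_* c) (trans (List.length-map _ (List.allFin n)) (List.length-tabulate {n = n} _)))

infixr 2 _×ᵉ_

_×ᵉ_ : ∀ {A B : Set} → Enumeration A → Enumeration B → Enumeration (A × B)
E ×ᵉ E′ = record
  { members = List.cartesianProduct (members E) (members E′)
  ; _≟_     = λ { (a , b) (a′ , b′) → ≟-× a b a′ b′ }
  ; once    = λ { (a , b) → begin
      ∑ˡ (List.cartesianProduct (members E) (members E′)) (λ z → 𝟙 (≟-× a b (proj₁ z) (proj₂ z)))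
        ≡⟨ ∑ˡ-cartesianProduct (members E) (members E′) _ ⟩
      ∑ E (λ a′ → ∑ E′ λ b′ → 𝟙 (≟-× a b a′ b′))
        ≡⟨ ∑ˡ-cong (members E) (λ a′ → ∑ˡ-cong (members E′) λ b′ → split a b a′ b′) ⟩
      ∑ E (λ a′ → ∑ E′ λ b′ → 𝟙 (a E.≟ a′) * 𝟙 (b E′.≟ b′))
        ≡⟨ ∑ˡ-cong (members E) (λ a′ → ∑ˡ-*ˡ (members E′) (𝟙 (a E.≟ a′)) _) ⟩
      ∑ E (λ a′ → 𝟙 (a E.≟ a′) * ∑ E′ (λ b′ → 𝟙 (b E′.≟ b′)))
        ≡⟨ E.pick a _ ⟩
      ∑ E′ (λ b′ → 𝟙 (b E′.≟ b′))
        ≡⟨ E′.once b ⟩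
      1 ∎ }
  }
  where
  module E = Enumeration E
  module E′ = Enumeration E′
  open ≡-Reasoning
  ≟-× : ∀ a b a′ b′ → Dec ((a , b) ≡ (a′ , b′))
  ≟-× a b a′ b′ = ≡-dec E._≟_ E′._≟_ (a , b) (a′ , b′)
  split : ∀ a b a′ b′ → 𝟙 (≟-× a b a′ b′) ≡ 𝟙 (a E.≟ a′) * 𝟙 (b E′.≟ b′)
  split a b a′ b′ = trans
    (𝟙-cong (≟-× a b a′ b′) ((a E.≟ a′) ×-dec (b E′.≟ b′))
      (λ { refl → refl , refl }) (λ { (refl , refl) → refl }))
    (𝟙-× (a E.≟ a′) (b E′.≟ b′))

∑-× : ∀ {A B : Set} (E : Enumeration A) (E′ : Enumeration B) (f : A × B → ℕ) →
  ∑ (E ×ᵉ E′) f ≡ ∑ E (λ a → ∑ E′ (λ b → f (a , b)))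
∑-× E E′ = ∑ˡ-cartesianProduct (members E) (members E′)

module _ {A B : Set} (E : Enumeration A) (E′ : Enumeration B)
  {p r} {P : Pred A p} {Q : Pred B r} (P? : Decidable P) (Q? : Decidable Q) where

  private
    module E = Enumeration E
    module E′ = Enumeration E′

  #-≤-relation : ∀ {ℓ} {R : A → B → Set ℓ} (R? : ∀ a b → Dec (R a b)) →
    (∀ a → P a → ∃[ b ] Q b × R a b) →
    (∀ a a′ b → P a → P a′ → R a b → R a′ b → a ≡ a′) →
    # E P? ≤ # E′ Q?
  #-≤-relation {R = R} R? total injective = begin
    # E P?                                    ≤⟨ ∑ˡ-mono (members E) image ⟩
    -- The two middle sums count the edges of the relation, first from the side of `a`, where there
    -- is at least one, then from the side of `b`, where there is at most one.
    ∑ E (λ a → ∑ E′ λ b → 𝟙 (PQR? a b))       ≡⟨ ∑ˡ-swap (members E) (members E′) _ ⟩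
    ∑ E′ (λ b → ∑ E λ a → 𝟙 (PQR? a b))       ≤⟨ ∑ˡ-mono (members E′) (λ b →
                                                   E.#≤𝟙 (λ a → PQR? a b) (Q? b) (λ _ → proj₁ ∘ proj₂)
                                                     λ { a a′ (Pa , _ , Rab) (Pa′ , _ , Ra′b) →
                                                         injective a a′ b Pa Pa′ Rab Ra′b }) ⟩
    # E′ Q?                                   ∎
    where
    open ℕₚ.≤-Reasoning
    PQR? : ∀ a b → Dec (P a × Q b × R a b)
    PQR? a b = P? a ×-dec Q? b ×-dec R? a b
    image : ∀ a → 𝟙 (P? a) ≤ ∑ E′ λ b → 𝟙 (PQR? a b)
    image a with P? a in eq
    ... | no _ = z≤n
    ... | yes Pa with total a Pa
    ...   | b , Qb , Rab = ℕₚ.≤-trans (E′.1≤# (PQR? a) b (Pa , Qb , Rab))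
      (ℕₚ.≤-reflexive (∑ˡ-cong (members E′) λ b → cong (λ d → 𝟙 (d ×-dec Q? b ×-dec R? a b)) eq))

  #-≤ : (f : A → B) → (∀ a → P a → Q (f a)) →
    (∀ a a′ → P a → P a′ → f a ≡ f a′ → a ≡ a′) → # E P? ≤ # E′ Q?
  #-≤ f P⇒Q injective = #-≤-relation {R = λ a b → f a ≡ b} (λ a b → f a E′.≟ b)
    (λ a Pa → f a , P⇒Q a Pa , refl)
    (λ a a′ b Pa Pa′ fa≡b fa′≡b → injective a a′ Pa Pa′ (trans fa≡b (sym fa′≡b)))

-- Linearly independent families over a finite field

module Frames {q : ℕ} .{{_ : NonTrivial q}} (F : FiniteField q) where
  open FiniteField F public renaming
    (_+_ to infixl 6 _+ᶠ_; _*_ to infixl 7 _*ᶠ_; -_ to infix 8 -ᶠ_)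
  open LinearAlgebra F public
  open CommutativeRing commutativeRing public
    using (+-assoc; +-comm; +-identityˡ; +-identityʳ; -‿inverseˡ; -‿inverseʳ;
           *-assoc; *-comm; *-identityˡ; *-identityʳ; zeroˡ; zeroʳ; distribˡ; distribʳ;
           ring; +-monoid; +-commutativeMonoid; semiring)
  open Algebra.Properties.Ring ring public
    using (-1*x≈-x)
  open Algebra.Properties.Monoid.Sum +-monoid public
    using (sum-cong-≗) renaming (sum to ∑ᶠ)
  open ≡-Reasoning

  _≟ᶠ_ : (x y : Carrier) → Dec (x ≡ y)
  _≟ᶠ_ = finite⇒≟ finite

  +ᵥ-assoc : ∀ {n} (u v w : Vector n) → u +ᵥ v +ᵥ w ≡ u +ᵥ (v +ᵥ w)
  +ᵥ-assoc = Vec.zipWith-assoc +-assoc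

  +ᵥ-comm : ∀ {n} (u v : Vector n) → u +ᵥ v ≡ v +ᵥ u
  +ᵥ-comm = Vec.zipWith-comm +-comm

  +ᵥ-identityˡ : ∀ {n} (v : Vector n) → 0ᵥ +ᵥ v ≡ v
  +ᵥ-identityˡ = Vec.zipWith-identityˡ +-identityˡ

  +ᵥ-identityʳ : ∀ {n} (v : Vector n) → v +ᵥ 0ᵥ ≡ v
  +ᵥ-identityʳ = Vec.zipWith-identityʳ +-identityʳ

  +ᵥ-interchange : ∀ {n} (u v w x : Vector n) → (u +ᵥ v) +ᵥ (w +ᵥ x) ≡ (u +ᵥ w) +ᵥ (v +ᵥ x)
  +ᵥ-interchange u v w x = begin
    u +ᵥ v +ᵥ (w +ᵥ x)     ≡⟨ +ᵥ-assoc u v _ ⟩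
    u +ᵥ (v +ᵥ (w +ᵥ x))   ≡⟨ cong (u +ᵥ_) (+ᵥ-assoc v w x) ⟨
    u +ᵥ (v +ᵥ w +ᵥ x)     ≡⟨ cong (λ y → u +ᵥ (y +ᵥ x)) (+ᵥ-comm v w) ⟩
    u +ᵥ (w +ᵥ v +ᵥ x)     ≡⟨ cong (u +ᵥ_) (+ᵥ-assoc w v x) ⟩
    u +ᵥ (w +ᵥ (v +ᵥ x))   ≡⟨ +ᵥ-assoc u w _ ⟨
    u +ᵥ w +ᵥ (v +ᵥ x)     ∎

  ·ᵥ-distribˡ : ∀ {n} a (u v : Vector n) → a ·ᵥ (u +ᵥ v) ≡ a ·ᵥ u +ᵥ a ·ᵥ v
  ·ᵥ-distribˡ a []      []      = refl
  ·ᵥ-distribˡ a (x ∷ u) (y ∷ v) = cong₂ _∷_ (distribˡ a x y) (·ᵥ-distribˡ a u v)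

  ·ᵥ-distribʳ : ∀ {n} a b (v : Vector n) → (a +ᶠ b) ·ᵥ v ≡ a ·ᵥ v +ᵥ b ·ᵥ v
  ·ᵥ-distribʳ a b []      = refl
  ·ᵥ-distribʳ a b (x ∷ v) = cong₂ _∷_ (distribʳ x a b) (·ᵥ-distribʳ a b v)

  ·ᵥ-assoc : ∀ {n} a b (v : Vector n) → (a *ᶠ b) ·ᵥ v ≡ a ·ᵥ b ·ᵥ v
  ·ᵥ-assoc a b []      = refl
  ·ᵥ-assoc a b (x ∷ v) = cong₂ _∷_ (*-assoc a b x) (·ᵥ-assoc a b v)

  ·ᵥ-identity : ∀ {n} (v : Vector n) → 1# ·ᵥ v ≡ v
  ·ᵥ-identity []      = refl
  ·ᵥ-identity (x ∷ v) = cong₂ _∷_ (*-identityˡ x) (·ᵥ-identity v)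

  ·ᵥ-zeroˡ : ∀ {n} (v : Vector n) → 0# ·ᵥ v ≡ 0ᵥ
  ·ᵥ-zeroˡ []      = refl
  ·ᵥ-zeroˡ (x ∷ v) = cong₂ _∷_ (zeroˡ x) (·ᵥ-zeroˡ v)

  ·ᵥ-zeroʳ : ∀ {n} a → a ·ᵥ 0ᵥ {n} ≡ 0ᵥ
  ·ᵥ-zeroʳ {zero}  a = refl
  ·ᵥ-zeroʳ {suc n} a = cong₂ _∷_ (zeroʳ a) (·ᵥ-zeroʳ a)

  +ᵥ-inverseʳ : ∀ {n} (v : Vector n) → v +ᵥ (-ᶠ 1#) ·ᵥ v ≡ 0ᵥ
  +ᵥ-inverseʳ v = begin
    v +ᵥ (-ᶠ 1#) ·ᵥ v           ≡⟨ cong (_+ᵥ (-ᶠ 1#) ·ᵥ v) (·ᵥ-identity v) ⟨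
    1# ·ᵥ v +ᵥ (-ᶠ 1#) ·ᵥ v     ≡⟨ ·ᵥ-distribʳ 1# (-ᶠ 1#) v ⟨
    (1# +ᶠ -ᶠ 1#) ·ᵥ v          ≡⟨ cong (_·ᵥ v) (-‿inverseʳ 1#) ⟩
    0# ·ᵥ v                     ≡⟨ ·ᵥ-zeroˡ v ⟩
    0ᵥ                          ∎

  +ᵥ-inverseˡ : ∀ {n} (v : Vector n) → (-ᶠ 1#) ·ᵥ v +ᵥ v ≡ 0ᵥ
  +ᵥ-inverseˡ v = trans (+ᵥ-comm _ v) (+ᵥ-inverseʳ v)

  u-v≡0⇒u≡v : ∀ {n} (u v : Vector n) → u +ᵥ (-ᶠ 1#) ·ᵥ v ≡ 0ᵥ → u ≡ v
  u-v≡0⇒u≡v u v eq = begin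
    u                            ≡⟨ +ᵥ-identityʳ u ⟨
    u +ᵥ 0ᵥ                      ≡⟨ cong (u +ᵥ_) (+ᵥ-inverseˡ v) ⟨
    u +ᵥ ((-ᶠ 1#) ·ᵥ v +ᵥ v)     ≡⟨ +ᵥ-assoc u _ v ⟨
    u +ᵥ (-ᶠ 1#) ·ᵥ v +ᵥ v       ≡⟨ cong (_+ᵥ v) eq ⟩
    0ᵥ +ᵥ v                      ≡⟨ +ᵥ-identityˡ v ⟩
    v                            ∎

  combination-+ : ∀ {r n} (c d : Vector r) (b : Vec (Vector n) r) →
    combination (c +ᵥ d) b ≡ combination c b +ᵥ combination d b
  combination-+ []      []      []      = sym (+ᵥ-identityˡ 0ᵥ)
  combination-+ (x ∷ c) (y ∷ d) (v ∷ b) = trans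
    (cong₂ _+ᵥ_ (·ᵥ-distribʳ x y v) (combination-+ c d b))
    (+ᵥ-interchange (x ·ᵥ v) (y ·ᵥ v) (combination c b) (combination d b))

  combination-· : ∀ {r n} a (c : Vector r) (b : Vec (Vector n) r) →
    combination (a ·ᵥ c) b ≡ a ·ᵥ combination c b
  combination-· a []      []      = sym (·ᵥ-zeroʳ a)
  combination-· a (x ∷ c) (v ∷ b) = trans
    (cong₂ _+ᵥ_ (·ᵥ-assoc a x v) (combination-· a c b))
    (sym (·ᵥ-distribˡ a _ _))

  combination-0 : ∀ {r n} (b : Vec (Vector n) r) → combination 0ᵥ b ≡ 0ᵥ
  combination-0 []      = refl
  combination-0 (v ∷ b) =
    trans (cong₂ _+ᵥ_ (·ᵥ-zeroˡ v) (combination-0 b)) (+ᵥ-identityˡ 0ᵥ)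

  combination-combination : ∀ {r s n} (c : Vector s) (M : Vec (Vector r) s) (b : Vec (Vector n) r) →
    combination c (Vec.map (λ m → combination m b) M) ≡ combination (combination c M) b
  combination-combination []      []      b = sym (combination-0 b)
  combination-combination (x ∷ c) (m ∷ M) b = trans
    (cong₂ _+ᵥ_ (sym (combination-· x m b)) (combination-combination c M b))
    (sym (combination-+ (x ·ᵥ m) (combination c M) b))

  combination-++ : ∀ {r s n} (c : Vector r) (d : Vector s) (b : Vec (Vector n) r) (b′ : Vec (Vector n) s) →
    combination (c Vec.++ d) (b Vec.++ b′) ≡ combination c b +ᵥ combination d b′
  combination-++ []      d []      b′ = sym (+ᵥ-identityˡ _)
  combination-++ (x ∷ c) d (v ∷ b) b′ = trans
    (cong (x ·ᵥ v +ᵥ_) (combination-++ c d b b′)) (sym (+ᵥ-assoc _ _ _))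

  infix 4 _∈span_ _∈span?_

  _∈span_ : ∀ {n r} → Vector n → Vec (Vector n) r → Set
  v ∈span b = ∃[ c ] combination c b ≡ v

  _∈span?_ : ∀ {n r} (v : Vector n) (b : Vec (Vector n) r) → Dec (v ∈span b)
  _∈span?_ {r = r} v b = ∃? (vectors r) λ c → combination c b ≟ v

  ∈span-0 : ∀ {n r} (b : Vec (Vector n) r) → 0ᵥ ∈span b
  ∈span-0 b = 0ᵥ , combination-0 b

  ∈span-+ : ∀ {n r} {b : Vec (Vector n) r} {u v} → u ∈span b → v ∈span b → (u +ᵥ v) ∈span b
  ∈span-+ {b = b} (c , refl) (d , refl) = c +ᵥ d , combination-+ c d b

  ∈span-· : ∀ {n r} {b : Vec (Vector n) r} a {v} → v ∈span b → (a ·ᵥ v) ∈span b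
  ∈span-· {b = b} a (c , refl) = a ·ᵥ c , combination-· a c b

  ∈span-head : ∀ {n r} (v : Vector n) (b : Vec (Vector n) r) → v ∈span (v ∷ b)
  ∈span-head v b = 1# ∷ 0ᵥ ,
    trans (cong₂ _+ᵥ_ (·ᵥ-identity v) (combination-0 b)) (+ᵥ-identityʳ v)

  ∈span-tail : ∀ {n r} {u v : Vector n} {b : Vec (Vector n) r} → v ∈span b → v ∈span (u ∷ b)
  ∈span-tail {u = u} (c , refl) = 0# ∷ c , trans (cong (_+ᵥ _) (·ᵥ-zeroˡ u)) (+ᵥ-identityˡ _)

  infix 4 _⊆span_

  _⊆span_ : ∀ {n r s} → Vec (Vector n) s → Vec (Vector n) r → Set
  b′ ⊆span b = Allᵛ (_∈span b) b′

  ⊆span-refl : ∀ {n r} (b : Vec (Vector n) r) → b ⊆span b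
  ⊆span-refl []      = []
  ⊆span-refl (v ∷ b) = ∈span-head v b ∷ Allᵛ.map ∈span-tail (⊆span-refl b)

  ∈span-combination : ∀ {n r s} {b : Vec (Vector n) r} (c : Vector s) {b′ : Vec (Vector n) s} →
    b′ ⊆span b → combination c b′ ∈span b
  ∈span-combination {b = b} [] [] = ∈span-0 b
  ∈span-combination (x ∷ c) (v∈ ∷ b′⊆) = ∈span-+ (∈span-· x v∈) (∈span-combination c b′⊆)

  ∈span-trans : ∀ {n r s} {b : Vec (Vector n) r} {b′ : Vec (Vector n) s} {v} →
    v ∈span b′ → b′ ⊆span b → v ∈span b
  ∈span-trans {b = b} (c , eq) b′⊆ = subst (_∈span b) eq (∈span-combination c b′⊆)

  ⊆span-trans : ∀ {n r s t} {b : Vec (Vector n) r} {b′ : Vec (Vector n) s} {b″ : Vec (Vector n) t} →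
    b″ ⊆span b′ → b′ ⊆span b → b″ ⊆span b
  ⊆span-trans b″⊆ b′⊆ = Allᵛ.map (λ v∈ → ∈span-trans v∈ b′⊆) b″⊆

  li? : ∀ {n r} (b : Vec (Vector n) r) → Dec (LinearlyIndependent b)
  li? {r = r} b = ∀? (vectors r) λ c → (combination c b ≟ 0ᵥ) →-dec (c ≟ 0ᵥ)

  li-injective : ∀ {n r} {b : Vec (Vector n) r} → LinearlyIndependent b →
    ∀ {c d} → combination c b ≡ combination d b → c ≡ d
  li-injective {b = b} li {c} {d} eq = u-v≡0⇒u≡v c d (li _ (begin
    combination (c +ᵥ (-ᶠ 1#) ·ᵥ d) b                   ≡⟨ combination-+ c _ b ⟩
    combination c b +ᵥ combination ((-ᶠ 1#) ·ᵥ d) b     ≡⟨ cong₂ _+ᵥ_ eq (combination-· (-ᶠ 1#) d b) ⟩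
    combination d b +ᵥ (-ᶠ 1#) ·ᵥ combination d b       ≡⟨ +ᵥ-inverseʳ _ ⟩
    0ᵥ                                                  ∎))

  li-[] : ∀ {n} → LinearlyIndependent {n} []
  li-[] [] _ = refl

  li-tail : ∀ {n r} {v} {b : Vec (Vector n) r} → LinearlyIndependent (v ∷ b) → LinearlyIndependent b
  li-tail {v = v} li c eq = Vec.∷-injectiveʳ (li (0# ∷ c)
    (trans (cong₂ _+ᵥ_ (·ᵥ-zeroˡ v) eq) (+ᵥ-identityˡ 0ᵥ)))

  li-head : ∀ {n r} {v} {b : Vec (Vector n) r} → LinearlyIndependent (v ∷ b) → ¬ v ∈span b
  li-head {v = v} {b} li (c , eq) = 1≢0 (Vec.∷-injectiveˡ (li-injective {b = v ∷ b} li {1# ∷ 0ᵥ} {0# ∷ c} (begin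
    1# ·ᵥ v +ᵥ combination 0ᵥ b   ≡⟨ proj₂ (∈span-head v b) ⟩
    v                             ≡⟨ eq ⟨
    combination c b               ≡⟨ +ᵥ-identityˡ _ ⟨
    0ᵥ +ᵥ combination c b         ≡⟨ cong (_+ᵥ _) (·ᵥ-zeroˡ v) ⟨
    0# ·ᵥ v +ᵥ combination c b    ∎)))

  ∈span-solve : ∀ {n r a} {v x : Vector n} {b : Vec (Vector n) r} → a ≢ 0# →
    x ∈span b → (a ·ᵥ v +ᵥ x) ∈span b → v ∈span b
  ∈span-solve {a = a} {v} {x} {b} a≢0 x∈ y∈ with invertible a≢0
  ... | a⁻¹ , a⁻¹a≡1 , _ = subst (_∈span b) (begin
    a⁻¹ ·ᵥ (a ·ᵥ v +ᵥ x +ᵥ (-ᶠ 1#) ·ᵥ x)     ≡⟨ cong (a⁻¹ ·ᵥ_) (+ᵥ-assoc _ x _) ⟩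
    a⁻¹ ·ᵥ (a ·ᵥ v +ᵥ (x +ᵥ (-ᶠ 1#) ·ᵥ x))   ≡⟨ cong (λ y → a⁻¹ ·ᵥ (a ·ᵥ v +ᵥ y)) (+ᵥ-inverseʳ x) ⟩
    a⁻¹ ·ᵥ (a ·ᵥ v +ᵥ 0ᵥ)                    ≡⟨ cong (a⁻¹ ·ᵥ_) (+ᵥ-identityʳ _) ⟩
    a⁻¹ ·ᵥ a ·ᵥ v                            ≡⟨ ·ᵥ-assoc a⁻¹ a v ⟨
    (a⁻¹ *ᶠ a) ·ᵥ v                          ≡⟨ cong (_·ᵥ v) a⁻¹a≡1 ⟩
    1# ·ᵥ v                                  ≡⟨ ·ᵥ-identity v ⟩
    v                                        ∎)
    (∈span-· a⁻¹ (∈span-+ y∈ (∈span-· (-ᶠ 1#) x∈)))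

  li-∷ : ∀ {n r} {v} {b : Vec (Vector n) r} → LinearlyIndependent b → ¬ v ∈span b →
    LinearlyIndependent (v ∷ b)
  li-∷ {v = v} {b} li v∉ (a ∷ c) eq with a ≟ᶠ 0#
  ... | no a≢0 = contradiction
    (∈span-solve a≢0 (c , refl) (subst (_∈span b) (sym eq) (∈span-0 b))) v∉
  ... | yes refl = cong (0# ∷_) (li c (begin
    combination c b               ≡⟨ +ᵥ-identityˡ _ ⟨
    0ᵥ +ᵥ combination c b         ≡⟨ cong (_+ᵥ _) (·ᵥ-zeroˡ v) ⟨
    0# ·ᵥ v +ᵥ combination c b    ≡⟨ eq ⟩
    0ᵥ                            ∎))

  li-swap : ∀ {n r} {u v} {b : Vec (Vector n) r} →
    LinearlyIndependent (u ∷ v ∷ b) → LinearlyIndependent (v ∷ u ∷ b)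
  li-swap {u = u} {v} {b} li (x ∷ y ∷ c) eq with li (y ∷ x ∷ c) (trans
    (trans (sym (+ᵥ-assoc (y ·ᵥ u) (x ·ᵥ v) (combination c b)))
      (trans (cong (_+ᵥ combination c b) (+ᵥ-comm (y ·ᵥ u) (x ·ᵥ v))) (+ᵥ-assoc _ _ _))) eq)
  ... | refl = refl

  li-⊆span : ∀ {n r s} {b : Vec (Vector n) r} {b′ : Vec (Vector n) s} {v} →
    LinearlyIndependent b′ → LinearlyIndependent (v ∷ b) → b′ ⊆span b → LinearlyIndependent (v ∷ b′)
  li-⊆span li′ li b′⊆ = li-∷ li′ λ v∈ → li-head li (∈span-trans v∈ b′⊆)

  vectorsᵉ : ∀ n → Enumeration (Vector n)
  vectorsᵉ n = enumerate (vectors n)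

  #-vectors : ∀ n → ∑ (vectorsᵉ n) (λ _ → 1) ≡ q ℕ.^ n
  #-vectors n = trans (∑-const (vectors n) 1) (ℕₚ.*-identityʳ _)

  ^-cancel-≤ : ∀ {m n} → q ℕ.^ m ℕ.≤ q ℕ.^ n → m ℕ.≤ n
  ^-cancel-≤ {m} {n} q^m≤q^n with m ℕₚ.≤? n
  ... | yes m≤n = m≤n
  ... | no m≰n = contradiction
    (ℕₚ.^-monoʳ-< q (ℕ.nonTrivial⇒n>1 q) (ℕₚ.≰⇒> m≰n)) (ℕₚ.≤⇒≯ q^m≤q^n)

  -- Over a finite field dimensions can be compared by counting: the relation gives q^m ≤ q^n. This
  -- takes the place of the exchange lemma. A relation is more convenient than a map because
  -- coordinates arise as existential witnesses.
  relation⇒≤ : ∀ {m n} {R : Vector m → Vector n → Set} (R? : ∀ c d → Dec (R c d)) →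
    (∀ c → ∃[ d ] R c d) → (∀ c c′ d → R c d → R c′ d → c ≡ c′) → m ℕ.≤ n
  relation⇒≤ {m} {n} R? total injective = ^-cancel-≤ (subst₂ ℕ._≤_ (#-vectors m) (#-vectors n)
    (#-≤-relation (vectorsᵉ m) (vectorsᵉ n) {P = λ _ → ⊤} {Q = λ _ → ⊤} (λ _ → yes tt) (λ _ → yes tt) R?
      (λ c _ → let d , Rcd = total c in d , tt , Rcd) (λ c c′ d _ _ → injective c c′ d)))

  li⇒length≤ : ∀ {n r s} {b : Vec (Vector n) r} {b′ : Vec (Vector n) s} →
    LinearlyIndependent b′ → b′ ⊆span b → s ℕ.≤ r
  li⇒length≤ {b = b} {b′} li b′⊆ = relation⇒≤ (λ c d → combination d b ≟ combination c b′)
    (λ c → ∈span-combination c b′⊆)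
    (λ c c′ d eq eq′ → li-injective li (trans (sym eq) eq′))

  li⇒length≤dim : ∀ {n r} {b : Vec (Vector n) r} → LinearlyIndependent b → r ℕ.≤ n
  li⇒length≤dim {b = b} li = relation⇒≤ (λ c v → combination c b ≟ v)
    (λ c → combination c b , refl) (λ c c′ d eq eq′ → li-injective li (trans eq (sym eq′)))

  full-in-span : ∀ {n r s} {b : Vec (Vector n) r} {b′ : Vec (Vector n) s} →
    LinearlyIndependent b′ → b′ ⊆span b → r ℕ.≤ s → ∀ {v} → v ∈span b → v ∈span b′
  full-in-span {b = b} {b′} li b′⊆ r≤s {v} v∈ = decidable-stable (v ∈span? b′) λ v∉ →
    ℕₚ.<⇒≱ (li⇒length≤ (li-∷ li v∉) (v∈ ∷ b′⊆)) r≤s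

  full : ∀ {n r} {b : Vec (Vector n) r} → LinearlyIndependent b → n ℕ.≤ r → ∀ v → v ∈span b
  full {b = b} li n≤r v = decidable-stable (v ∈span? b) λ v∉ →
    ℕₚ.<⇒≱ (li⇒length≤dim (li-∷ li v∉)) n≤r

  -- Exhaustive search decides the question; if every vector had coordinates with respect to `b`,
  -- then q^n ≤ q^r.
  ∃-∉span : ∀ {n r} (b : Vec (Vector n) r) → r ℕ.< n → ∃[ v ] ¬ v ∈span b
  ∃-∉span {n} b r<n with ∃? (vectors n) (λ v → ¬? (v ∈span? b))
  ... | yes ∃v = ∃v
  ... | no ∄v = contradiction
    (relation⇒≤ (λ v c → combination c b ≟ v)
      (λ v → decidable-stable (v ∈span? b) λ v∉ → ∄v (v , v∉))
      (λ v v′ c eq eq′ → trans (sym eq) eq′))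
    (ℕₚ.<⇒≱ r<n)


  extend : ∀ {n} j {r} {b : Vec (Vector n) r} → LinearlyIndependent b → j ℕ.+ r ℕ.≤ n →
    ∃[ w ] LinearlyIndependent (Vec._++_ {m = j} w b)
  extend zero    li _ = [] , li
  extend (suc j) {b = b} li j+r<n with extend j li (ℕₚ.<⇒≤ j+r<n)
  ... | w , li′ with ∃-∉span (w Vec.++ b) j+r<n
  ...   | v , v∉ = v ∷ w , li-∷ li′ v∉

  record IsLinear {n} (φ : Vector n → Carrier) : Set where
    field
      homo-+ : ∀ u v → φ (u +ᵥ v) ≡ φ u +ᶠ φ v
      homo-· : ∀ a v → φ (a ·ᵥ v) ≡ a *ᶠ φ v

    homo-0 : φ 0ᵥ ≡ 0#
    homo-0 = begin
      φ 0ᵥ            ≡⟨ cong φ (·ᵥ-zeroˡ 0ᵥ) ⟨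
      φ (0# ·ᵥ 0ᵥ)    ≡⟨ homo-· 0# 0ᵥ ⟩
      0# *ᶠ φ 0ᵥ      ≡⟨ zeroˡ _ ⟩
      0#              ∎

    vanish-+ : ∀ {u v} → φ u ≡ 0# → φ v ≡ 0# → φ (u +ᵥ v) ≡ 0#
    vanish-+ φu φv = trans (homo-+ _ _) (trans (cong₂ _+ᶠ_ φu φv) (+-identityˡ 0#))

    vanish-· : ∀ a {v} → φ v ≡ 0# → φ (a ·ᵥ v) ≡ 0#
    vanish-· a φv = trans (homo-· a _) (trans (cong (a *ᶠ_) φv) (zeroʳ a))

    vanish-span : ∀ {r} {b : Vec (Vector n) r} → Allᵛ (λ v → φ v ≡ 0#) b → ∀ {v} → v ∈span b → φ v ≡ 0#
    vanish-span {b = b} φb (c , refl) = go c b φb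
      where
      go : ∀ {r} (c : Vector r) b → Allᵛ (λ v → φ v ≡ 0#) b → φ (combination c b) ≡ 0#
      go []      []      []        = homo-0
      go (x ∷ c) (v ∷ b) (φv ∷ φb) = vanish-+ (vanish-· x φv) (go c b φb)

    vanish-⊆span : ∀ {r s} {b : Vec (Vector n) r} {b′ : Vec (Vector n) s} →
      Allᵛ (λ v → φ v ≡ 0#) b → b′ ⊆span b → Allᵛ (λ v → φ v ≡ 0#) b′
    vanish-⊆span φb = Allᵛ.map (vanish-span φb)

  shear : ∀ {n r} → (Vector n → Carrier) → Vector n → Vec (Vector n) r → Vec (Vector n) r
  shear a v = Vec.map (λ w → a w ·ᵥ v +ᵥ w)

  shear-⊆span : ∀ {n r} a v (b : Vec (Vector n) r) → shear a v b ⊆span (v ∷ b)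
  shear-⊆span a v b = Allᵛ.map⁺ (Allᵛ.map
    (λ {w} w∈ → ∈span-+ (∈span-· (a w) (∈span-head v b)) (∈span-tail w∈)) (⊆span-refl b))

  -- Modulo `v` nothing changes: a relation among the sheared vectors is the same relation among the
  -- old ones, with only the coefficient of `v` altered.
  li-shear : ∀ {n r} a v (b : Vec (Vector n) r) →
    LinearlyIndependent (v ∷ b) → LinearlyIndependent (v ∷ shear a v b)
  li-shear a v b li (x ∷ c) eq with li (x +ᶠ d ∷ c) (begin
      (x +ᶠ d) ·ᵥ v +ᵥ combination c b           ≡⟨ cong (_+ᵥ _) (·ᵥ-distribʳ x d v) ⟩
      x ·ᵥ v +ᵥ d ·ᵥ v +ᵥ combination c b        ≡⟨ +ᵥ-assoc _ _ _ ⟩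
      x ·ᵥ v +ᵥ (d ·ᵥ v +ᵥ combination c b)      ≡⟨ cong (x ·ᵥ v +ᵥ_) (proj₂ (sheared c b)) ⟨
      x ·ᵥ v +ᵥ combination c (shear a v b)      ≡⟨ eq ⟩
      0ᵥ                                         ∎)
    where
    sheared : ∀ {r} (c : Vector r) b →
      ∃[ d ] combination c (shear a v b) ≡ d ·ᵥ v +ᵥ combination c b
    sheared []      []      = 0# , sym (trans (+ᵥ-identityʳ _) (·ᵥ-zeroˡ v))
    sheared (y ∷ c) (w ∷ b) with sheared c b
    ... | d , eq = y *ᶠ a w +ᶠ d , (begin
      y ·ᵥ (a w ·ᵥ v +ᵥ w) +ᵥ combination c (shear a v b)
        ≡⟨ cong₂ _+ᵥ_ (·ᵥ-distribˡ y _ w) eq ⟩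
      y ·ᵥ a w ·ᵥ v +ᵥ y ·ᵥ w +ᵥ (d ·ᵥ v +ᵥ combination c b)
        ≡⟨ +ᵥ-interchange _ _ _ _ ⟩
      y ·ᵥ a w ·ᵥ v +ᵥ d ·ᵥ v +ᵥ (y ·ᵥ w +ᵥ combination c b)
        ≡⟨ cong (_+ᵥ _) (trans (·ᵥ-distribʳ (y *ᶠ a w) d v) (cong (_+ᵥ d ·ᵥ v) (·ᵥ-assoc y (a w) v))) ⟨
      (y *ᶠ a w +ᶠ d) ·ᵥ v +ᵥ (y ·ᵥ w +ᵥ combination c b) ∎)
    d : Carrier
    d = proj₁ (sheared c b)
  ... | eq′ with Vec.∷-injectiveʳ eq′
  ...   | refl = cong (_∷ 0ᵥ) (Vec.∷-injectiveˡ (li (x ∷ 0ᵥ) (begin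
    x ·ᵥ v +ᵥ combination 0ᵥ b              ≡⟨ cong (x ·ᵥ v +ᵥ_) (trans (combination-0 b) (sym (combination-0 (shear a v b)))) ⟩
    x ·ᵥ v +ᵥ combination 0ᵥ (shear a v b)  ≡⟨ eq ⟩
    0ᵥ                                      ∎)))

  ∃-coefficient : ∀ {x} → x ≢ 0# → ∀ y → ∃[ a ] a *ᶠ x +ᶠ y ≡ 0#
  ∃-coefficient {x} x≢0 y with invertible x≢0
  ... | x⁻¹ , x⁻¹x≡1 , _ = -ᶠ y *ᶠ x⁻¹ , (begin
    -ᶠ y *ᶠ x⁻¹ *ᶠ x +ᶠ y       ≡⟨ cong (_+ᶠ y) (*-assoc (-ᶠ y) x⁻¹ x) ⟩
    -ᶠ y *ᶠ (x⁻¹ *ᶠ x) +ᶠ y     ≡⟨ cong (λ z → -ᶠ y *ᶠ z +ᶠ y) x⁻¹x≡1 ⟩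
    -ᶠ y *ᶠ 1# +ᶠ y             ≡⟨ cong (_+ᶠ y) (*-identityʳ _) ⟩
    -ᶠ y +ᶠ y                   ≡⟨ -‿inverseˡ y ⟩
    0#                          ∎)

  -- Projection of `b` to the kernel of `φ` along `v`. As the result stays in the span of `v` and
  -- `b`, it keeps every linear condition that `v` and `b` already satisfy; the last component
  -- records this for orthogonality relations obtained earlier.
  ∃-shear : ∀ {n r} (φ : Vector n → Carrier) → IsLinear φ → ∀ {v} (b : Vec (Vector n) r) → φ v ≢ 0# →
    LinearlyIndependent (v ∷ b) →
    ∃[ b′ ] LinearlyIndependent {r = suc r} (v ∷ b′) × b′ ⊆span (v ∷ b) × Allᵛ (λ w → φ w ≡ 0#) b′ ×
      (∀ ψ → IsLinear ψ → ψ v ≡ 0# → Allᵛ (λ w → ψ w ≡ 0#) b → Allᵛ (λ w → ψ w ≡ 0#) b′)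
  ∃-shear φ lin {v} b φv≢0 li = shear a v b , li-shear a v b li , shear-⊆span a v b ,
    Allᵛ.map⁺ (Allᵛ.universal (λ w → trans (homo-+ _ w)
      (trans (cong (_+ᶠ φ w) (homo-· (a w) v)) (proj₂ (∃-coefficient φv≢0 (φ w))))) b) ,
    λ ψ ψ-lin ψv ψb → IsLinear.vanish-⊆span ψ-lin (ψv ∷ ψb) (shear-⊆span a v b)
    where
    open IsLinear lin
    a = λ w → proj₁ (∃-coefficient φv≢0 (φ w))

  -- A hyperplane costs at most one dimension: the first vector outside the kernel is sacrificed as
  -- a pivot, and the vectors after it are sheared along it into the kernel.
  drop-to-kernel : ∀ {n r} (φ : Vector n → Carrier) → IsLinear φ →
    (b : Vec (Vector n) (suc r)) → LinearlyIndependent b →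
    ∃[ b′ ] LinearlyIndependent {r = r} b′ × b′ ⊆span b × Allᵛ (λ v → φ v ≡ 0#) b′
  drop-to-kernel φ lin (v ∷ b) li with φ v ≟ᶠ 0#
  ... | no φv≢0 with ∃-shear φ lin b φv≢0 li
  ...   | b′ , li′ , b′⊆ , φb′ , _ = b′ , li-tail li′ , b′⊆ , φb′
  -- No pivot has appeared, so the whole family lies in the kernel; its last vector is dropped only
  -- to meet the prescribed length.
  drop-to-kernel {r = zero}  φ lin (v ∷ [])    li | yes φv≡0 = [] , li-[] , [] , []
  drop-to-kernel {r = suc r} φ lin (v ∷ b) li | yes φv≡0
    with drop-to-kernel φ lin b (li-tail li)
  ... | b′ , li′ , b′⊆ , φb′ =
    v ∷ b′ , li-⊆span li′ li b′⊆ , ∈span-head v b ∷ Allᵛ.map ∈span-tail b′⊆ , φv≡0 ∷ φb′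

  -- Induction on the codimension `j`. Each vector adjoined outside the span joins those that `φ`
  -- has to kill, which `li-swap` arranges; in codimension zero `φ` is the `u`-coordinate with
  -- respect to the basis `u ∷ b`.
  separating-functional : ∀ {n} j {r} {u} {b : Vec (Vector n) r} → j ℕ.+ suc r ≡ n →
    LinearlyIndependent (u ∷ b) →
    ∃[ φ ] IsLinear φ × φ u ≡ 1# × Allᵛ (λ v → φ v ≡ 0#) b
  separating-functional (suc j) {r} {u} {b} eq li
    with ∃-∉span (u ∷ b) (ℕₚ.≤-trans (s≤s (ℕₚ.m≤n+m (suc r) j)) (ℕₚ.≤-reflexive eq))
  ... | v , v∉ with separating-functional j (trans (ℕₚ.+-suc j (suc r)) eq) (li-swap (li-∷ li v∉))
  ...   | φ , lin , φu , _ ∷ φb = φ , lin , φu , φb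
  separating-functional zero {r = r} {u} {b} refl li = φ , linear , φu≡1 , φb≡0
    where
    coordinates : ∀ v → v ∈span (u ∷ b)
    coordinates = full li ℕₚ.≤-refl
    φ : Vector (suc r) → Carrier
    φ v = Vec.head (proj₁ (coordinates v))
    φ-unique : ∀ {v} x c → x ·ᵥ u +ᵥ combination c b ≡ v → φ v ≡ x
    φ-unique {v} x c eq =
      cong Vec.head (li-injective li {proj₁ (coordinates v)} {x ∷ c} (trans (proj₂ (coordinates v)) (sym eq)))
    linear : IsLinear φ
    linear .IsLinear.homo-+ v w with coordinates v | coordinates w
    ... | x ∷ c , refl | y ∷ d , refl = φ-unique (x +ᶠ y) (c +ᵥ d) (combination-+ (x ∷ c) (y ∷ d) (u ∷ b))
    linear .IsLinear.homo-· a v with coordinates v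
    ... | x ∷ c , refl = φ-unique (a *ᶠ x) (a ·ᵥ c) (combination-· a (x ∷ c) (u ∷ b))
    φu≡1 : φ u ≡ 1#
    φu≡1 = φ-unique 1# 0ᵥ (proj₂ (∈span-head u b))
    φb≡0 : Allᵛ (λ v → φ v ≡ 0#) b
    φb≡0 = Allᵛ.map (λ { (c , eq) → φ-unique 0# c (trans (proj₂ (∈span-tail {u = u} {b = b} (c , refl))) eq) })
      (⊆span-refl b)

-- Linear conditions on alternating forms

module Forms {q : ℕ} .{{_ : NonTrivial q}} (F : FiniteField q) where
  open Frames F public
  open Algebra.Properties.CommutativeMonoid.Sum +-commutativeMonoid using (∑-distrib-+)
  open Algebra.Properties.Semiring.Sum semiring using (*-distribˡ-sum; *-distribʳ-sum)
  open import Algebra.Properties.CommutativeSemigroup (CommutativeRing.*-commutativeSemigroup commutativeRing)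
    using () renaming (x∙yz≈y∙xz to x*yz≡y*xz)
  open IsLinear
  open ≡-Reasoning

  Matrix : ℕ → Set
  Matrix N = Vec (Vector N) N

  gram-linearʳ : ∀ {N} (A : Matrix N) u → IsLinear (gram A u)
  gram-linearʳ A u .homo-+ v w = begin
    gram A u (v +ᵥ w)
      ≡⟨ sum-cong-≗ (λ i → sum-cong-≗ λ j → split i j) ⟩
    ∑ᶠ (λ i → ∑ᶠ λ j → entry v i j +ᶠ entry w i j)
      ≡⟨ sum-cong-≗ (λ i → ∑-distrib-+ (entry v i) (entry w i)) ⟩
    ∑ᶠ (λ i → ∑ᶠ (entry v i) +ᶠ ∑ᶠ (entry w i))
      ≡⟨ ∑-distrib-+ (λ i → ∑ᶠ (entry v i)) (λ i → ∑ᶠ (entry w i)) ⟩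
    gram A u v +ᶠ gram A u w ∎
    where
    entry : Vector _ → Fin _ → Fin _ → Carrier
    entry v i j = lookup u i *ᶠ (lookup (lookup A i) j *ᶠ lookup v j)
    split : ∀ i j → entry (v +ᵥ w) i j ≡ entry v i j +ᶠ entry w i j
    split i j = trans
      (cong (λ x → lookup u i *ᶠ (lookup (lookup A i) j *ᶠ x)) (Vec.lookup-zipWith _+ᶠ_ j v w))
      (trans (cong (lookup u i *ᶠ_) (distribˡ _ _ _)) (distribˡ _ _ _))
  gram-linearʳ A u .homo-· a v = begin
    gram A u (a ·ᵥ v)
      ≡⟨ sum-cong-≗ (λ i → sum-cong-≗ λ j → pull i j) ⟩
    ∑ᶠ (λ i → ∑ᶠ λ j → a *ᶠ entry i j)
      ≡⟨ sum-cong-≗ (λ i → *-distribˡ-sum a (entry i)) ⟨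
    ∑ᶠ (λ i → a *ᶠ ∑ᶠ (entry i))
      ≡⟨ *-distribˡ-sum a (λ i → ∑ᶠ (entry i)) ⟨
    a *ᶠ gram A u v ∎
    where
    entry : Fin _ → Fin _ → Carrier
    entry i j = lookup u i *ᶠ (lookup (lookup A i) j *ᶠ lookup v j)
    pull : ∀ i j → lookup u i *ᶠ (lookup (lookup A i) j *ᶠ lookup (a ·ᵥ v) j) ≡ a *ᶠ entry i j
    pull i j = trans
      (cong (λ x → lookup u i *ᶠ (lookup (lookup A i) j *ᶠ x)) (Vec.lookup-map j (a *ᶠ_) v))
      (trans (cong (lookup u i *ᶠ_) (x*yz≡y*xz _ a _)) (x*yz≡y*xz _ a _))

  gram-linearˡ : ∀ {N} (A : Matrix N) v → IsLinear (λ u → gram A u v)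
  gram-linearˡ A v .homo-+ u w = begin
    gram A (u +ᵥ w) v
      ≡⟨ sum-cong-≗ (λ i → sum-cong-≗ λ j → split i j) ⟩
    ∑ᶠ (λ i → ∑ᶠ λ j → entry u i j +ᶠ entry w i j)
      ≡⟨ sum-cong-≗ (λ i → ∑-distrib-+ (entry u i) (entry w i)) ⟩
    ∑ᶠ (λ i → ∑ᶠ (entry u i) +ᶠ ∑ᶠ (entry w i))
      ≡⟨ ∑-distrib-+ (λ i → ∑ᶠ (entry u i)) (λ i → ∑ᶠ (entry w i)) ⟩
    gram A u v +ᶠ gram A w v ∎
    where
    entry : Vector _ → Fin _ → Fin _ → Carrier
    entry u i j = lookup u i *ᶠ (lookup (lookup A i) j *ᶠ lookup v j)
    split : ∀ i j → entry (u +ᵥ w) i j ≡ entry u i j +ᶠ entry w i j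
    split i j = trans
      (cong (_*ᶠ (lookup (lookup A i) j *ᶠ lookup v j)) (Vec.lookup-zipWith _+ᶠ_ i u w))
      (distribʳ _ _ _)
  gram-linearˡ A v .homo-· a u = begin
    gram A (a ·ᵥ u) v
      ≡⟨ sum-cong-≗ (λ i → sum-cong-≗ λ j → pull i j) ⟩
    ∑ᶠ (λ i → ∑ᶠ λ j → a *ᶠ entry i j)
      ≡⟨ sum-cong-≗ (λ i → *-distribˡ-sum a (entry i)) ⟨
    ∑ᶠ (λ i → a *ᶠ ∑ᶠ (entry i))
      ≡⟨ *-distribˡ-sum a (λ i → ∑ᶠ (entry i)) ⟨
    a *ᶠ gram A u v ∎
    where
    entry : Fin _ → Fin _ → Carrier
    entry i j = lookup u i *ᶠ (lookup (lookup A i) j *ᶠ lookup v j)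
    pull : ∀ i j → lookup (a ·ᵥ u) i *ᶠ (lookup (lookup A i) j *ᶠ lookup v j) ≡ a *ᶠ entry i j
    pull i j = trans
      (cong (_*ᶠ (lookup (lookup A i) j *ᶠ lookup v j)) (Vec.lookup-map i (a *ᶠ_) u))
      (*-assoc a _ _)

  shear-matrix : ∀ {N} → Carrier → Matrix N → Matrix N → Matrix N
  shear-matrix a A′ A = Vec.zipWith (λ x y → x +ᵥ a ·ᵥ y) A A′

  gram-shear : ∀ {N} a (A′ A : Matrix N) u v →
    gram (shear-matrix a A′ A) u v ≡ gram A u v +ᶠ a *ᶠ gram A′ u v
  gram-shear a A′ A u v = begin
    gram (shear-matrix a A′ A) u v
      ≡⟨ sum-cong-≗ (λ i → sum-cong-≗ λ j → split i j) ⟩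
    ∑ᶠ (λ i → ∑ᶠ λ j → entry A i j +ᶠ a *ᶠ entry A′ i j)
      ≡⟨ sum-cong-≗ (λ i → trans (∑-distrib-+ (entry A i) (λ j → a *ᶠ entry A′ i j))
           (cong (∑ᶠ (entry A i) +ᶠ_) (sym (*-distribˡ-sum a (entry A′ i))))) ⟩
    ∑ᶠ (λ i → ∑ᶠ (entry A i) +ᶠ a *ᶠ ∑ᶠ (entry A′ i))
      ≡⟨ ∑-distrib-+ (λ i → ∑ᶠ (entry A i)) (λ i → a *ᶠ ∑ᶠ (entry A′ i)) ⟩
    gram A u v +ᶠ ∑ᶠ (λ i → a *ᶠ ∑ᶠ (entry A′ i))
      ≡⟨ cong (gram A u v +ᶠ_) (*-distribˡ-sum a (λ i → ∑ᶠ (entry A′ i))) ⟨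
    gram A u v +ᶠ a *ᶠ gram A′ u v ∎
    where
    entry : Matrix _ → Fin _ → Fin _ → Carrier
    entry A i j = lookup u i *ᶠ (lookup (lookup A i) j *ᶠ lookup v j)
    entry-+ : ∀ x y z w → x *ᶠ ((y +ᶠ a *ᶠ z) *ᶠ w) ≡ x *ᶠ (y *ᶠ w) +ᶠ a *ᶠ (x *ᶠ (z *ᶠ w))
    entry-+ x y z w = begin
      x *ᶠ ((y +ᶠ a *ᶠ z) *ᶠ w)                 ≡⟨ cong (x *ᶠ_) (distribʳ w y _) ⟩
      x *ᶠ (y *ᶠ w +ᶠ a *ᶠ z *ᶠ w)              ≡⟨ distribˡ x _ _ ⟩
      x *ᶠ (y *ᶠ w) +ᶠ x *ᶠ (a *ᶠ z *ᶠ w)       ≡⟨ cong (λ t → x *ᶠ (y *ᶠ w) +ᶠ x *ᶠ t) (*-assoc a z w) ⟩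
      x *ᶠ (y *ᶠ w) +ᶠ x *ᶠ (a *ᶠ (z *ᶠ w))     ≡⟨ cong (x *ᶠ (y *ᶠ w) +ᶠ_) (x*yz≡y*xz x a _) ⟩
      x *ᶠ (y *ᶠ w) +ᶠ a *ᶠ (x *ᶠ (z *ᶠ w))     ∎
    split : ∀ i j → entry (shear-matrix a A′ A) i j ≡ entry A i j +ᶠ a *ᶠ entry A′ i j
    split i j = trans
      (cong (λ x → lookup u i *ᶠ (x *ᶠ lookup v j)) (begin
        lookup (lookup (shear-matrix a A′ A) i) j
          ≡⟨ cong (λ r → lookup r j) (Vec.lookup-zipWith _ i A A′) ⟩
        lookup (lookup A i +ᵥ a ·ᵥ lookup A′ i) j
          ≡⟨ Vec.lookup-zipWith _+ᶠ_ j (lookup A i) _ ⟩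
        lookup (lookup A i) j +ᶠ lookup (a ·ᵥ lookup A′ i) j
          ≡⟨ cong (lookup (lookup A i) j +ᶠ_) (Vec.lookup-map j (a *ᶠ_) (lookup A′ i)) ⟩
        lookup (lookup A i) j +ᶠ a *ᶠ lookup (lookup A′ i) j ∎))
      (entry-+ _ _ _ _)

  +ᵥ-cancelʳ : ∀ {n} (u v w : Vector n) → u +ᵥ w ≡ v +ᵥ w → u ≡ v
  +ᵥ-cancelʳ u v w eq = trans (sym (cancel u)) (trans (cong (_+ᵥ (-ᶠ 1#) ·ᵥ w) eq) (cancel v))
    where
    cancel : ∀ x → x +ᵥ w +ᵥ (-ᶠ 1#) ·ᵥ w ≡ x
    cancel x = trans (+ᵥ-assoc x w _) (trans (cong (x +ᵥ_) (+ᵥ-inverseʳ w)) (+ᵥ-identityʳ x))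

  -- Each of the m components receives its own multiple. Thus one scalar form repeated m times is
  -- enough to reach every value in F^m, while the constant coefficient -1 gives subtraction.
  translate : ∀ {N m} → Vector m → Bilinear N m → Bilinear N m → Bilinear N m
  translate []      []        []      = []
  translate (a ∷ c) (A′ ∷ B′) (A ∷ B) = shear-matrix a A′ A ∷ translate c B′ B

  translate-injective : ∀ {N m} (c : Vector m) (B′ : Bilinear N m) {B C} →
    translate c B′ B ≡ translate c B′ C → B ≡ C
  translate-injective []      []        {[]}    {[]}     _  = refl
  translate-injective (a ∷ c) (A′ ∷ B′) {A ∷ B} {A″ ∷ C} eq =
    cong₂ _∷_ (rows A′ A A″ (Vec.∷-injectiveˡ eq)) (translate-injective c B′ (Vec.∷-injectiveʳ eq))
    where
    rows : ∀ {k n} (X Y Z : Vec (Vector n) k) →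
      Vec.zipWith (λ x y → x +ᵥ a ·ᵥ y) Y X ≡ Vec.zipWith (λ x y → x +ᵥ a ·ᵥ y) Z X → Y ≡ Z
    rows []      []      []      _  = refl
    rows (x ∷ X) (y ∷ Y) (z ∷ Z) eq =
      cong₂ _∷_ (+ᵥ-cancelʳ y z (a ·ᵥ x) (Vec.∷-injectiveˡ eq)) (rows X Y Z (Vec.∷-injectiveʳ eq))

  evaluate-translate : ∀ {N m} (c : Vector m) (B′ B : Bilinear N m) u v →
    evaluate (translate c B′ B) u v ≡ evaluate B u v +ᵥ Vec.zipWith _*ᶠ_ c (evaluate B′ u v)
  evaluate-translate []      []        []      u v = refl
  evaluate-translate (a ∷ c) (A′ ∷ B′) (A ∷ B) u v =
    cong₂ _∷_ (gram-shear a A′ A u v) (evaluate-translate c B′ B u v)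

  zipWith-*-0ᵥ : ∀ {m} (c : Vector m) → Vec.zipWith _*ᶠ_ c 0ᵥ ≡ 0ᵥ
  zipWith-*-0ᵥ []      = refl
  zipWith-*-0ᵥ (a ∷ c) = cong₂ _∷_ (zeroʳ a) (zipWith-*-0ᵥ c)

  zipWith-replicate-* : ∀ {m} a (c : Vector m) → Vec.zipWith _*ᶠ_ (Vec.replicate m a) c ≡ a ·ᵥ c
  zipWith-replicate-* a []      = refl
  zipWith-replicate-* a (x ∷ c) = cong (a *ᶠ x ∷_) (zipWith-replicate-* a c)

  zipWith-*-1 : ∀ {m} (c : Vector m) → Vec.zipWith _*ᶠ_ c (Vec.replicate m 1#) ≡ c
  zipWith-*-1 []      = refl
  zipWith-*-1 (a ∷ c) = cong₂ _∷_ (*-identityʳ a) (zipWith-*-1 c)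

  evaluate-translate-0 : ∀ {N m} (c : Vector m) (B′ B : Bilinear N m) u v →
    evaluate B′ u v ≡ 0ᵥ → evaluate B u v ≡ 0ᵥ → evaluate (translate c B′ B) u v ≡ 0ᵥ
  evaluate-translate-0 c B′ B u v eq′ eq = begin
    evaluate (translate c B′ B) u v                          ≡⟨ evaluate-translate c B′ B u v ⟩
    evaluate B u v +ᵥ Vec.zipWith _*ᶠ_ c (evaluate B′ u v)   ≡⟨ cong₂ (λ x y → x +ᵥ Vec.zipWith _*ᶠ_ c y) eq eq′ ⟩
    0ᵥ +ᵥ Vec.zipWith _*ᶠ_ c 0ᵥ                              ≡⟨ cong (0ᵥ +ᵥ_) (zipWith-*-0ᵥ c) ⟩
    0ᵥ +ᵥ 0ᵥ                                                 ≡⟨ +ᵥ-identityˡ 0ᵥ ⟩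
    0ᵥ                                                       ∎

  bilinearᵉ : ∀ N m → Enumeration (Bilinear N m)
  bilinearᵉ N m = enumerate (bilinear-finite N m)

  module _ {N m : ℕ} {p} {S : Pred (Bilinear N m) p} (S? : Decidable S)
    (closed : ∀ c B′ B → S B′ → S B → S (translate c B′ B)) (u v : Vector N) where

    private
      E = bilinearᵉ N m
      S∩ker? : Decidable (λ B → S B × evaluate B u v ≡ 0ᵥ)
      S∩ker? B = S? B ×-dec (evaluate B u v ≟ 0ᵥ)

      fibre? : ∀ c → Decidable (λ B → S B × evaluate B u v ≡ c)
      fibre? c B = S? B ×-dec (evaluate B u v ≟ c)

    -- A nonempty fibre of evaluation at `(u , v)` is a translate of the kernel: subtracting one
    -- fixed member injects it there.
    fibre≤kernel : ∀ c → # E (fibre? c) ℕ.≤ # E S∩ker?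
    fibre≤kernel c with ∃? (bilinear-finite N m) (fibre? c)
    ... | no ∄B = Enumeration.#-mono E (fibre? c) S∩ker? λ B B∈ → contradiction (B , B∈) ∄B
    ... | yes (B₀ , SB₀ , eq₀) = #-≤ E E (fibre? c) S∩ker? (translate (Vec.replicate m (-ᶠ 1#)) B₀)
      (λ { B (SB , eq) → closed _ B₀ B SB₀ SB , (begin
        evaluate (translate (Vec.replicate m (-ᶠ 1#)) B₀ B) u v
          ≡⟨ evaluate-translate _ B₀ B u v ⟩
        evaluate B u v +ᵥ Vec.zipWith _*ᶠ_ (Vec.replicate m (-ᶠ 1#)) (evaluate B₀ u v)
          ≡⟨ cong₂ (λ x y → x +ᵥ Vec.zipWith _*ᶠ_ (Vec.replicate m (-ᶠ 1#)) y) eq eq₀ ⟩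
        c +ᵥ Vec.zipWith _*ᶠ_ (Vec.replicate m (-ᶠ 1#)) c
          ≡⟨ cong (c +ᵥ_) (zipWith-replicate-* (-ᶠ 1#) c) ⟩
        c +ᵥ (-ᶠ 1#) ·ᵥ c
          ≡⟨ +ᵥ-inverseʳ c ⟩
        0ᵥ ∎) })
      (λ _ _ _ _ → translate-injective _ B₀)

    -- The fibres over the q^m possible values partition `S`, and each is at most as large as the
    -- kernel.
    constraint-≤ : # E S? ℕ.≤ q ℕ.^ m ℕ.* # E S∩ker?
    constraint-≤ = ℕₚ.≤-trans (ℕₚ.≤-reflexive (begin
      # E S?
        ≡⟨ ∑ˡ-cong (members E) (λ B → Enumeration.pick (vectorsᵉ m) (evaluate B u v) (λ _ → 𝟙 (S? B))) ⟨
      ∑ E (λ B → ∑ (vectorsᵉ m) λ c → 𝟙 (evaluate B u v ≟ c) ℕ.* 𝟙 (S? B))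
        ≡⟨ ∑ˡ-cong (members E) (λ B → ∑ˡ-cong (members (vectorsᵉ m)) λ c →
             trans (𝟙-× (S? B) (evaluate B u v ≟ c)) (ℕₚ.*-comm (𝟙 (S? B)) _)) ⟨
      ∑ E (λ B → ∑ (vectorsᵉ m) λ c → 𝟙 (fibre? c B))
        ≡⟨ ∑ˡ-swap (members E) (members (vectorsᵉ m)) _ ⟩
      ∑ (vectorsᵉ m) (λ c → # E (fibre? c)) ∎))
      (ℕₚ.≤-trans (∑ˡ-mono (members (vectorsᵉ m)) fibre≤kernel)
        (ℕₚ.≤-reflexive (∑-const (vectors m) _)))

    -- A form of the kernel is shifted by `c` times `A`. The value of the result at `(u , v)` is
    -- `c`, so first `c` and then the form can be recovered.
    constraint-≥ : ∀ (A : Matrix N) → S (Vec.replicate m A) → gram A u v ≡ 1# →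
      q ℕ.^ m ℕ.* # E S∩ker? ℕ.≤ # E S?
    constraint-≥ A SA eq = ℕₚ.≤-trans
      (ℕₚ.≤-reflexive (trans (sym (∑-const (vectors m) _)) (sym (∑-× (vectorsᵉ m) E _))))
      (#-≤ (vectorsᵉ m ×ᵉ E) E (λ (c , B) → S∩ker? B) S?
        (λ (c , B) → translate c (Vec.replicate m A) B)
        (λ { (c , B) (SB , _) → closed c _ B SA SB })
        (λ { (c , B) (c′ , B′) (_ , eqB) (_ , eqB′) same → injective c c′ eqB eqB′ same }))
      where
      value : ∀ c {B} → evaluate B u v ≡ 0ᵥ → evaluate (translate c (Vec.replicate m A) B) u v ≡ c
      value c {B} eqB = begin
        evaluate (translate c (Vec.replicate m A) B) u v
          ≡⟨ evaluate-translate c _ B u v ⟩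
        evaluate B u v +ᵥ Vec.zipWith _*ᶠ_ c (evaluate (Vec.replicate m A) u v)
          ≡⟨ cong₂ (λ x y → x +ᵥ Vec.zipWith _*ᶠ_ c y) eqB
               (trans (Vec.map-replicate _ A m) (cong (Vec.replicate m) eq)) ⟩
        0ᵥ +ᵥ Vec.zipWith _*ᶠ_ c (Vec.replicate m 1#)
          ≡⟨ trans (+ᵥ-identityˡ _) (zipWith-*-1 c) ⟩
        c ∎
      injective : ∀ c c′ {B B′} → evaluate B u v ≡ 0ᵥ → evaluate B′ u v ≡ 0ᵥ →
        translate c (Vec.replicate m A) B ≡ translate c′ (Vec.replicate m A) B′ → (c , B) ≡ (c′ , B′)
      injective c c′ {B} {B′} eqB eqB′ same
        with trans (sym (value c eqB)) (trans (cong (λ X → evaluate X u v) same) (value c′ eqB′))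
      ... | refl = cong (c ,_) (translate-injective c _ same)

  VanishesOn : ∀ {N m} → List (Vector N × Vector N) → Bilinear N m → Set
  VanishesOn L B = All (λ (u , v) → evaluate B u v ≡ 0ᵥ) L

  AlternatingVanishing : ∀ {N m} → List (Vector N × Vector N) → Bilinear N m → Set
  AlternatingVanishing L B = VanishesOn L B × IsAlternating B

  vanishesOn? : ∀ {N m} L → Decidable (VanishesOn {N} {m} L)
  vanishesOn? L B = All.all? (λ (u , v) → evaluate B u v ≟ 0ᵥ) L

  alternatingVanishing? : ∀ {N m} L → Decidable (AlternatingVanishing {N} {m} L)
  alternatingVanishing? L B = vanishesOn? L B ×-dec isAlternating? B

  module _ {N m : ℕ} where

    closed : ∀ L c B′ B → AlternatingVanishing {N} {m} L B′ → AlternatingVanishing L B →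
      AlternatingVanishing L (translate c B′ B)
    closed L c B′ B (van′ , alt′) (van , alt) =
      All.zipWith (λ { {u , v} (eq′ , eq) → evaluate-translate-0 c B′ B u v eq′ eq }) (van′ , van) ,
      λ v → evaluate-translate-0 c B′ B v v (alt′ v) (alt v)

    #forms : List (Vector N × Vector N) → ℕ
    #forms L = # (bilinearᵉ N m) (alternatingVanishing? L)

    private
      merge : ∀ u v L →
        # (bilinearᵉ N m) (λ B → alternatingVanishing? L B ×-dec (evaluate B u v ≟ 0ᵥ)) ≡ #forms ((u , v) ∷ L)
      merge u v L = Enumeration.#-cong (bilinearᵉ N m)
        (λ B → alternatingVanishing? L B ×-dec (evaluate B u v ≟ 0ᵥ)) (alternatingVanishing? ((u , v) ∷ L))
        (λ { _ ((van , alt) , eq) → eq ∷ van , alt }) (λ { _ (eq ∷ van , alt) → (van , alt) , eq })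

    #forms-∷-≤ : ∀ u v L → #forms L ℕ.≤ q ℕ.^ m ℕ.* #forms ((u , v) ∷ L)
    #forms-∷-≤ u v L = subst (λ n → #forms L ℕ.≤ q ℕ.^ m ℕ.* n) (merge u v L)
      (constraint-≤ (alternatingVanishing? L) (closed L) u v)

    -- A condition that follows from earlier ones costs less than q^m, so for arbitrary `L′` only an
    -- inequality can be expected; its direction is the one that bounds the second moment from
    -- below.
    #forms-++-≤ : ∀ L′ L → #forms L ℕ.≤ (q ℕ.^ m) ℕ.^ length L′ ℕ.* #forms (L′ List.++ L)
    #forms-++-≤ []             L = ℕₚ.≤-reflexive (sym (ℕₚ.*-identityˡ _))
    #forms-++-≤ ((u , v) ∷ L′) L = ℕₚ.≤-trans (#forms-++-≤ L′ L)
      (ℕₚ.≤-trans (ℕₚ.*-monoʳ-≤ ((q ℕ.^ m) ℕ.^ length L′) (#forms-∷-≤ u v (L′ List.++ L)))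
        (ℕₚ.≤-reflexive (rearrange ((q ℕ.^ m) ℕ.^ length L′) (q ℕ.^ m) (#forms ((u , v) ∷ L′ List.++ L)))))
      where
      rearrange : ∀ a x y → a ℕ.* (x ℕ.* y) ≡ x ℕ.* a ℕ.* y
      rearrange a x y = trans (sym (ℕₚ.*-assoc a x y)) (cong (ℕ._* y) (ℕₚ.*-comm a x))

    -- Independence in triangular form: the form dual to a pair has to vanish only on the pairs
    -- behind it in the list, which are the ones imposed before it.
    Independent : List (Vector N × Vector N) → Set
    Independent []            = ⊤
    Independent ((u , v) ∷ L) =
      (∃[ A ] AlternatingVanishing {N} {1} L (A ∷ []) × gram A u v ≡ 1#) × Independent L

    private
      replicate-0 : ∀ A u v → evaluate {N} {1} (A ∷ []) u v ≡ 0ᵥ → evaluate (Vec.replicate m A) u v ≡ 0ᵥ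
      replicate-0 A u v eq = trans (Vec.map-replicate _ _ m) (cong (Vec.replicate m) (Vec.∷-injectiveˡ eq))

    #forms-independent : ∀ L → Independent L → (q ℕ.^ m) ℕ.^ length L ℕ.* #forms L ≡ #forms []
    #forms-independent []            _ = ℕₚ.*-identityˡ _
    #forms-independent ((u , v) ∷ L) ((A , (van , alt) , eq) , ind) = begin
      q ℕ.^ m ℕ.* (q ℕ.^ m) ℕ.^ length L ℕ.* #forms ((u , v) ∷ L)
        ≡⟨ cong (ℕ._* #forms ((u , v) ∷ L)) (ℕₚ.*-comm (q ℕ.^ m) _) ⟩
      (q ℕ.^ m) ℕ.^ length L ℕ.* q ℕ.^ m ℕ.* #forms ((u , v) ∷ L)
        ≡⟨ ℕₚ.*-assoc ((q ℕ.^ m) ℕ.^ length L) (q ℕ.^ m) _ ⟩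
      (q ℕ.^ m) ℕ.^ length L ℕ.* (q ℕ.^ m ℕ.* #forms ((u , v) ∷ L))
        ≡⟨ cong ((q ℕ.^ m) ℕ.^ length L ℕ.*_) (ℕₚ.≤-antisym
             (subst (λ n → q ℕ.^ m ℕ.* n ℕ.≤ #forms L) (merge u v L)
               (constraint-≥ (alternatingVanishing? L) (closed L) u v A
                 (All.map (λ {(x , y)} → replicate-0 A x y) van , λ w → replicate-0 A w w (alt w)) eq))
             (#forms-∷-≤ u v L)) ⟩
      (q ℕ.^ m) ℕ.^ length L ℕ.* #forms L
        ≡⟨ #forms-independent L ind ⟩
      #forms [] ∎

  dot : ∀ {N} → Vector N → Vector N → Carrier
  dot f v = ∑ᶠ λ i → lookup v i *ᶠ lookup f i

  linear⇒dot : ∀ {N} (φ : Vector N → Carrier) → IsLinear φ → ∃[ f ] (∀ v → φ v ≡ dot f v)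
  linear⇒dot {zero}  φ lin = [] , λ { [] → homo-0 lin }
  linear⇒dot {suc N} φ lin with linear⇒dot (λ v → φ (0# ∷ v)) (record
    { homo-+ = λ u v → trans (cong (λ x → φ (x ∷ u +ᵥ v)) (sym (+-identityˡ 0#))) (homo-+ lin (0# ∷ u) (0# ∷ v))
    ; homo-· = λ a v → trans (cong (λ x → φ (x ∷ a ·ᵥ v)) (sym (zeroʳ a))) (homo-· lin a (0# ∷ v)) })
  ... | f , φ≗ = φ (1# ∷ 0ᵥ) ∷ f , λ { (x ∷ v) → begin
    φ (x ∷ v)
      ≡⟨ cong φ (cong₂ _∷_ (trans (+-identityʳ _) (*-identityʳ x))
           (trans (cong (_+ᵥ v) (·ᵥ-zeroʳ x)) (+ᵥ-identityˡ v))) ⟨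
    φ (x ·ᵥ (1# ∷ 0ᵥ) +ᵥ (0# ∷ v))
      ≡⟨ homo-+ lin _ _ ⟩
    φ (x ·ᵥ (1# ∷ 0ᵥ)) +ᶠ φ (0# ∷ v)
      ≡⟨ cong₂ _+ᶠ_ (homo-· lin x _) (φ≗ v) ⟩
    x *ᶠ φ (1# ∷ 0ᵥ) +ᶠ dot f v ∎ }

  outer : ∀ {N} → Vector N → Vector N → Matrix N
  outer f g = Vec.map (_·ᵥ g) f

  gram-outer : ∀ {N} (f g u v : Vector N) → gram (outer f g) u v ≡ dot f u *ᶠ dot g v
  gram-outer f g u v = begin
    gram (outer f g) u v
      ≡⟨ sum-cong-≗ (λ i → sum-cong-≗ λ j → regroup i j) ⟩
    ∑ᶠ (λ i → ∑ᶠ λ j → lookup u i *ᶠ lookup f i *ᶠ (lookup v j *ᶠ lookup g j))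
      ≡⟨ sum-cong-≗ (λ i → *-distribˡ-sum (lookup u i *ᶠ lookup f i) (λ j → lookup v j *ᶠ lookup g j)) ⟨
    ∑ᶠ (λ i → lookup u i *ᶠ lookup f i *ᶠ dot g v)
      ≡⟨ *-distribʳ-sum (dot g v) (λ i → lookup u i *ᶠ lookup f i) ⟨
    dot f u *ᶠ dot g v ∎
    where
    regroup : ∀ i j → lookup u i *ᶠ (lookup (lookup (outer f g) i) j *ᶠ lookup v j) ≡
      lookup u i *ᶠ lookup f i *ᶠ (lookup v j *ᶠ lookup g j)
    regroup i j = begin
      lookup u i *ᶠ (lookup (lookup (outer f g) i) j *ᶠ lookup v j)
        ≡⟨ cong (λ x → lookup u i *ᶠ (x *ᶠ lookup v j))
             (trans (cong (λ r → lookup r j) (Vec.lookup-map i (_·ᵥ g) f)) (Vec.lookup-map j _ g)) ⟩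
      lookup u i *ᶠ (lookup f i *ᶠ lookup g j *ᶠ lookup v j)
        ≡⟨ cong (lookup u i *ᶠ_) (*-assoc _ _ _) ⟩
      lookup u i *ᶠ (lookup f i *ᶠ (lookup g j *ᶠ lookup v j))
        ≡⟨ *-assoc _ _ _ ⟨
      lookup u i *ᶠ lookup f i *ᶠ (lookup g j *ᶠ lookup v j)
        ≡⟨ cong (lookup u i *ᶠ lookup f i *ᶠ_) (*-comm _ _) ⟩
      lookup u i *ᶠ lookup f i *ᶠ (lookup v j *ᶠ lookup g j) ∎

  ∃-wedge : ∀ {N} {φ ψ : Vector N → Carrier} → IsLinear φ → IsLinear ψ →
    ∃[ A ] (∀ u v → gram A u v ≡ φ u *ᶠ ψ v +ᶠ (-ᶠ 1#) *ᶠ (ψ u *ᶠ φ v))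
  ∃-wedge {φ = φ} {ψ} φ-lin ψ-lin with linear⇒dot φ φ-lin | linear⇒dot ψ ψ-lin
  ... | f , φ≗ | g , ψ≗ = shear-matrix (-ᶠ 1#) (outer g f) (outer f g) , λ u v → begin
    gram (shear-matrix (-ᶠ 1#) (outer g f) (outer f g)) u v
      ≡⟨ gram-shear (-ᶠ 1#) (outer g f) (outer f g) u v ⟩
    gram (outer f g) u v +ᶠ (-ᶠ 1#) *ᶠ gram (outer g f) u v
      ≡⟨ cong₂ (λ x y → x +ᶠ (-ᶠ 1#) *ᶠ y) (gram-outer f g u v) (gram-outer g f u v) ⟩
    dot f u *ᶠ dot g v +ᶠ (-ᶠ 1#) *ᶠ (dot g u *ᶠ dot f v)
      ≡⟨ cong₂ (λ x y → x +ᶠ (-ᶠ 1#) *ᶠ y)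
           (cong₂ _*ᶠ_ (φ≗ u) (ψ≗ v)) (cong₂ _*ᶠ_ (ψ≗ u) (φ≗ v)) ⟨
    φ u *ᶠ ψ v +ᶠ (-ᶠ 1#) *ᶠ (ψ u *ᶠ φ v) ∎

  -- the pairs (bᵢ , bⱼ) with i < j and i < k
  pairs : ∀ (k : ℕ) {N r} → Vec (Vector N) r → List (Vector N × Vector N)
  pairs zero    b       = []
  pairs (suc k) []      = []
  pairs (suc k) (v ∷ b) = List.map (v ,_) (Vec.toList b) List.++ pairs k b

  -- For k ≤ r this is r(r-1)/2 - (r-k)(r-k-1)/2, the number of pairs that meet the first k of r
  -- vectors. With k = r it counts the conditions for isotropy, with k < r those for a radical or
  -- for the moving part of a graph.
  #pairs : ℕ → ℕ → ℕ
  #pairs zero    r       = 0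
  #pairs (suc k) zero    = 0
  #pairs (suc k) (suc r) = r ℕ.+ #pairs k r

  length-pairs : ∀ (k : ℕ) {N r} (b : Vec (Vector N) r) → length (pairs k b) ≡ #pairs k r
  length-pairs zero    b       = refl
  length-pairs (suc k) []      = refl
  length-pairs (suc k) (v ∷ b) = trans (List.length-++ (List.map (v ,_) (Vec.toList b)))
    (cong₂ ℕ._+_ (trans (List.length-map (v ,_) (Vec.toList b)) (Vec.length-toList b)) (length-pairs k b))

  All-pairs : ∀ {p N r} {P : Pred (Vector N) p} k {b : Vec (Vector N) r} →
    Allᵛ P b → All (λ (u , v) → P u × P v) (pairs k b)
  All-pairs zero    Pb        = []
  All-pairs (suc k) []        = []
  All-pairs (suc k) (Pv ∷ Pb) = All.++⁺ (All.map⁺ (All.map (Pv ,_) (Allᵛ.toList⁺ Pb))) (All-pairs k Pb)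

  separate : ∀ {N r u} {b : Vec (Vector N) r} → LinearlyIndependent (u ∷ b) →
    ∃[ φ ] IsLinear φ × φ u ≡ 1# × Allᵛ (λ v → φ v ≡ 0#) b
  separate {N} {r} li = separating-functional (N ℕ.∸ suc r) (ℕₚ.m∸n+n≡m (li⇒length≤dim li)) li

  -- Let `φ` be 1 at `v` and 0 on `b`, and `ψ` be 1 at `x` and 0 on the vectors after `x`. Then φ ∧
  -- ψ is 1 at `(v , x)`. It vanishes at a later pair `(v , y)`, since both functionals kill `y`,
  -- and on the pairs within `b`, since `φ` does. The uncontrolled value of `ψ` at `v` is always
  -- multiplied by a zero of `φ`.
  pairs-independent : ∀ {N m} k {r} {b : Vec (Vector N) r} → LinearlyIndependent b →
    Independent {N} {m} (pairs k b)
  pairs-independent zero    {b = b}     li = tt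
  pairs-independent (suc k) {b = []}    li = tt
  pairs-independent {N} {m} (suc k) {b = v ∷ b} li with separate li
  ... | φ , φ-lin , φv , φb = go b (li-tail li) φb
    where
    go : ∀ {s} (w : Vec (Vector N) s) → LinearlyIndependent w → Allᵛ (λ x → φ x ≡ 0#) w →
      Independent {N} {m} (List.map (v ,_) (Vec.toList w) List.++ pairs k b)
    go []      _   _         = pairs-independent {N} {m} k (li-tail li)
    go (x ∷ w) li′ (φx ∷ φw) with separate li′
    ... | ψ , ψ-lin , ψx , ψw with ∃-wedge φ-lin ψ-lin
    ...   | A , gramA = (A , (All.++⁺ on-v on-b , alternating) , value) , go w (li-tail li′) φw
      where
      singleton : ∀ {x} → x ≡ 0# → _≡_ {A = Vector 1} (x ∷ []) 0ᵥ
      singleton = cong (_∷ [])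
      0*-0* : ∀ {a b} x y → a ≡ 0# → b ≡ 0# → a *ᶠ x +ᶠ (-ᶠ 1#) *ᶠ (y *ᶠ b) ≡ 0#
      0*-0* x y refl refl = trans (cong₂ _+ᶠ_ (zeroˡ x) (trans (cong ((-ᶠ 1#) *ᶠ_) (zeroʳ y)) (zeroʳ _)))
        (+-identityˡ 0#)
      on-b : VanishesOn {N} {1} (pairs k b) (A ∷ [])
      on-b = All.map (λ { {u , w} (φu , φw) → singleton (trans (gramA u w) (0*-0* _ _ φu φw)) }) (All-pairs k φb)
      on-v : VanishesOn {N} {1} (List.map (v ,_) (Vec.toList w)) (A ∷ [])
      on-v = All.map⁺ (Allᵛ.toList⁺ (Allᵛ.map
        (λ { {y} (φy , ψy) → singleton (trans (gramA v y)
          (trans (cong₂ (λ s t → φ v *ᶠ s +ᶠ (-ᶠ 1#) *ᶠ (ψ v *ᶠ t)) ψy φy)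
            (trans (cong₂ _+ᶠ_ (zeroʳ (φ v)) refl) (trans (+-identityˡ _)
              (trans (cong ((-ᶠ 1#) *ᶠ_) (zeroʳ (ψ v))) (zeroʳ _)))))) })
        (Allᵛ.zip (φw , ψw))))
      alternating : IsAlternating (A ∷ [])
      alternating y = singleton (trans (gramA y y) (trans
        (cong (φ y *ᶠ ψ y +ᶠ_) (trans (-1*x≈-x _) (cong -ᶠ_ (*-comm (ψ y) (φ y))))) (-‿inverseʳ _)))
      value : gram A v x ≡ 1#
      value = begin
        gram A v x                                   ≡⟨ gramA v x ⟩
        φ v *ᶠ ψ x +ᶠ (-ᶠ 1#) *ᶠ (ψ v *ᶠ φ x)        ≡⟨ cong₂ _+ᶠ_ (cong₂ _*ᶠ_ φv ψx) (cong (λ t → (-ᶠ 1#) *ᶠ (ψ v *ᶠ t)) φx) ⟩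
        1# *ᶠ 1# +ᶠ (-ᶠ 1#) *ᶠ (ψ v *ᶠ 0#)           ≡⟨ cong₂ _+ᶠ_ (*-identityˡ 1#) (trans (cong ((-ᶠ 1#) *ᶠ_) (zeroʳ _)) (zeroʳ _)) ⟩
        1# +ᶠ 0#                                     ≡⟨ +-identityʳ 1# ⟩
        1#                                           ∎

  #forms-pairs : ∀ {N m} k {r} {b : Vec (Vector N) r} → LinearlyIndependent b →
    (q ℕ.^ m) ℕ.^ #pairs k r ℕ.* #forms {N} {m} (pairs k b) ≡ #forms {N} {m} []
  #forms-pairs {N} {m} k {r} {b} li = trans
    (cong (λ l → (q ℕ.^ m) ℕ.^ l ℕ.* #forms {N} {m} (pairs k b)) (sym (length-pairs k b)))
    (#forms-independent {N} {m} (pairs k b) (pairs-independent {N} {m} k li))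

-- Frames, subspaces and the first moment

module Counting {q : ℕ} .{{_ : NonTrivial q}} (F : FiniteField q) where
  open Forms F public
  open IsLinear
  open ≡-Reasoning

  framesᵉ : ∀ N r → Enumeration (Vec (Vector N) r)
  framesᵉ N r = enumerate (vec-finite (vectors N) r)

  #frames : ℕ → ℕ → ℕ
  #frames N r = # (framesᵉ N r) li?

  #span : ∀ {N r} {b : Vec (Vector N) r} → LinearlyIndependent b → # (vectorsᵉ N) (_∈span? b) ≡ q ℕ.^ r
  #span {N} {r} {b} li = trans
    (ℕₚ.≤-antisym
      (#-≤-relation (vectorsᵉ N) (vectorsᵉ r) (_∈span? b) (λ _ → yes tt) (λ v c → combination c b ≟ v)
        (λ { v (c , eq) → c , tt , eq }) (λ v v′ c _ _ eq eq′ → trans (sym eq) eq′))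
      (#-≤ (vectorsᵉ r) (vectorsᵉ N) (λ _ → yes tt) (_∈span? b) (λ c → combination c b)
        (λ c _ → c , refl) (λ c c′ _ _ → li-injective li)))
    (#-vectors r)

  #frames-zero : ∀ N → #frames N 0 ≡ 1
  #frames-zero N = Enumeration.#≡1 (framesᵉ N 0) li? [] li-[] λ { [] _ → refl }

  -- The next vector is any of the q^N vectors except the q^r in the span. The subtracted term is
  -- moved to the left in order to stay within ℕ.
  #frames-suc : ∀ N r → #frames N (suc r) ℕ.+ #frames N r ℕ.* q ℕ.^ r ≡ #frames N r ℕ.* q ℕ.^ N
  #frames-suc N r = begin
    #frames N (suc r) ℕ.+ #frames N r ℕ.* q ℕ.^ r
      ≡⟨ cong₂ ℕ._+_ (trans extend-frame (trans (∑-× E V _) (∑ˡ-cong (members E) λ b →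
           trans (∑ˡ-cong (members V) λ v → 𝟙-× (li? b) (¬? (v ∈span? b))) (∑ˡ-*ˡ (members V) (𝟙 (li? b)) _))))
           (sym (trans (∑ˡ-cong (members E) λ b → in-span b (li? b)) (∑ˡ-*ʳ (members E) (q ℕ.^ r) _))) ⟩
    ∑ E (λ b → 𝟙 (li? b) ℕ.* # V (λ v → ¬? (v ∈span? b))) ℕ.+ ∑ E (λ b → 𝟙 (li? b) ℕ.* # V (_∈span? b))
      ≡⟨ ∑ˡ-+ (members E) _ _ ⟨
    ∑ E (λ b → 𝟙 (li? b) ℕ.* # V (λ v → ¬? (v ∈span? b)) ℕ.+ 𝟙 (li? b) ℕ.* # V (_∈span? b))
      ≡⟨ ∑ˡ-cong (members E) (λ b → trans (sym (ℕₚ.*-distribˡ-+ (𝟙 (li? b)) _ _)) (cong (𝟙 (li? b) ℕ.*_) (complement b))) ⟩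
    ∑ E (λ b → 𝟙 (li? b) ℕ.* q ℕ.^ N)
      ≡⟨ ∑ˡ-*ʳ (members E) (q ℕ.^ N) _ ⟩
    #frames N r ℕ.* q ℕ.^ N ∎
    where
    E = framesᵉ N r
    V = vectorsᵉ N
    in-span : ∀ b (d : Dec (LinearlyIndependent b)) → 𝟙 d ℕ.* # V (_∈span? b) ≡ 𝟙 d ℕ.* q ℕ.^ r
    in-span b (yes li) = cong (1 ℕ.*_) (#span li)
    in-span b (no _)   = refl
    complement : ∀ b → # V (λ v → ¬? (v ∈span? b)) ℕ.+ # V (_∈span? b) ≡ q ℕ.^ N
    complement b = trans (sym (∑ˡ-+ (members V) _ _)) (trans (∑ˡ-cong (members V) λ v → one (v ∈span? b)) (#-vectors N))
      where
      one : ∀ {P : Set} (d : Dec P) → 𝟙 (¬? d) ℕ.+ 𝟙 d ≡ 1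
      one (yes _) = refl
      one (no _)  = refl
    extends? : Decidable (λ ((b , v) : Vec (Vector N) r × Vector N) → LinearlyIndependent b × ¬ v ∈span b)
    extends? (b , v) = li? b ×-dec ¬? (v ∈span? b)
    extend-frame : #frames N (suc r) ≡ # (E ×ᵉ V) extends?
    extend-frame = ℕₚ.≤-antisym
      (#-≤ (framesᵉ N (suc r)) (E ×ᵉ V) li? extends? (λ b → Vec.tail b , Vec.head b)
        (λ { (v ∷ b) li → li-tail li , li-head li }) (λ { (v ∷ b) (v′ ∷ b′) _ _ refl → refl }))
      (#-≤ (E ×ᵉ V) (framesᵉ N (suc r)) extends? li? (λ (b , v) → v ∷ b)
        (λ { (b , v) (li , v∉) → li-∷ li v∉ }) (λ { (b , v) (b′ , v′) _ _ refl → refl }))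

  module _ {N r : ℕ} {b₀ : Vec (Vector N) r} (li₀ : LinearlyIndependent b₀) where

    private
      change : Vec (Vector r) r → Vec (Vector N) r
      change = Vec.map (λ c → combination c b₀)

      coordinates : ∀ {s} {b : Vec (Vector N) s} → b ⊆span b₀ → ∃[ M ] Vec.map (λ c → combination c b₀) M ≡ b
      coordinates []               = [] , refl
      coordinates ((c , eq) ∷ b⊆) = let M , eqs = coordinates b⊆ in c ∷ M , cong₂ _∷_ eq eqs

      change-⊆span : ∀ {s} (M : Vec (Vector r) s) → Vec.map (λ c → combination c b₀) M ⊆span b₀
      change-⊆span []      = []
      change-⊆span (c ∷ M) = (c , refl) ∷ change-⊆span M

      change-injective : ∀ {s} (M M′ : Vec (Vector r) s) →
        Vec.map (λ c → combination c b₀) M ≡ Vec.map (λ c → combination c b₀) M′ → M ≡ M′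
      change-injective []      []        _  = refl
      change-injective (c ∷ M) (c′ ∷ M′) eq =
        cong₂ _∷_ (li-injective li₀ (Vec.∷-injectiveˡ eq)) (change-injective M M′ (Vec.∷-injectiveʳ eq))

    frameIn? : Decidable (λ b → LinearlyIndependent {r = r} b × b ⊆span b₀)
    frameIn? b = li? b ×-dec Allᵛ.all? (_∈span? b₀) b

    -- Coordinates with respect to `b₀` identify these frames with the invertible r × r matrices, so
    -- the count depends on `r` alone.
    #frames-in-span : # (framesᵉ N r) frameIn? ≡ #frames r r
    #frames-in-span = ℕₚ.≤-antisym
      (#-≤-relation (framesᵉ N r) (framesᵉ r r) frameIn? li?
        (λ b M → Enumeration._≟_ (framesᵉ N r) (change M) b)
        (λ { b (li , b⊆) → let M , eq = coordinates b⊆ in M , li-coordinates M (subst LinearlyIndependent (sym eq) li) , eq })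
        (λ b b′ M _ _ eq eq′ → trans (sym eq) eq′))
      (#-≤ (framesᵉ r r) (framesᵉ N r) li? frameIn? change
        (λ M li → (λ c eq → li c (li₀ _ (trans (sym (combination-combination c M b₀)) eq))) , change-⊆span M)
        (λ M M′ _ _ → change-injective M M′))
      where
      li-coordinates : ∀ M → LinearlyIndependent (change M) → LinearlyIndependent M
      li-coordinates M li c eq = li c (trans (combination-combination c M b₀)
        (trans (cong (λ d → combination d b₀) eq) (combination-0 b₀)))

  -- Equality of subset codes is extensional (`VSubset-ext`), so two bases of one subspace have
  -- propositionally equal images here. This is what lets a subspace be summed out against its
  -- bases.
  spanSet : ∀ {N r} → Vec (Vector N) r → VSubset N
  spanSet {N} b = Vec.tabulate (λ i → does (Inverse.from (vectors N) i ∈span? b))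

  module _ {N r : ℕ} (b : Vec (Vector N) r) where
    open Inverse (vectors N)

    private
      lookup-spanSet : ∀ v → lookup (spanSet b) (to v) ≡ does (v ∈span? b)
      lookup-spanSet v = trans (Vec.lookup∘tabulate _ (to v))
        (cong (λ v → does (v ∈span? b)) (strictlyInverseʳ v))

    ∈-spanSet⁺ : ∀ v → v ∈span b → v ∈ᵥ spanSet b
    ∈-spanSet⁺ v v∈ = Vec.lookup⇒[]= (to v) (spanSet b)
      (trans (lookup-spanSet v) (dec-true (v ∈span? b) v∈))

    ∈-spanSet⁻ : ∀ v → v ∈ᵥ spanSet b → v ∈span b
    ∈-spanSet⁻ v v∈ = witness (v ∈span? b) (trans (sym (lookup-spanSet v)) (Vec.[]=⇒lookup v∈))
      where
      witness : ∀ {P : Set} (d : Dec P) → does d ≡ true → P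
      witness (yes x) _ = x

    spanSet-isSubspace : IsSubspace N (spanSet b)
    spanSet-isSubspace =
        ∈-spanSet⁺ 0ᵥ (∈span-0 b)
      , (λ u v u∈ v∈ → ∈-spanSet⁺ (u +ᵥ v) (∈span-+ {b = b} {u} {v} (∈-spanSet⁻ u u∈) (∈-spanSet⁻ v v∈)))
      , (λ a v v∈ → ∈-spanSet⁺ (a ·ᵥ v) (∈span-· {b = b} a {v} (∈-spanSet⁻ v v∈)))

    spanSet-hasDimension : LinearlyIndependent b → HasDimension N (spanSet b) r
    spanSet-hasDimension li = b , li , Allᵛ.lookup⁺ (Allᵛ.map (∈-spanSet⁺ _) (⊆span-refl b)) , ∈-spanSet⁻

  VSubset-ext : ∀ {N} {H K : VSubset N} → (∀ v → v ∈ᵥ H → v ∈ᵥ K) → (∀ v → v ∈ᵥ K → v ∈ᵥ H) → H ≡ K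
  VSubset-ext {N} H⊆K K⊆H = Subset.⊆-antisym (along H⊆K) (along K⊆H)
    where
    open Inverse (vectors N)
    along : ∀ {H K : VSubset N} → (∀ v → v ∈ᵥ H → v ∈ᵥ K) → H Subset.⊆ K
    along {H} {K} H⊆K {i} i∈H = subst (Subset._∈ K) (strictlyInverseˡ i)
      (H⊆K (from i) (subst (Subset._∈ H) (sym (strictlyInverseˡ i)) i∈H))

  spanSet-basis : ∀ {N r} {H : VSubset N} {b : Vec (Vector N) r} →
    IsSubspace N H → IsBasisOf H b → spanSet b ≡ H
  spanSet-basis {N} {H = H} {b} (0∈ , +∈ , ·∈) (_ , b∈ , span) = VSubset-ext
    (λ v v∈ → let c , eq = ∈-spanSet⁻ b v v∈ in subst (_∈ᵥ H) eq (combination∈ c b (Allᵛ.lookup⁻ b∈)))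
    (λ v v∈ → ∈-spanSet⁺ b v (span v v∈))
    where
    combination∈ : ∀ {r} (c : Vector r) (b : Vec (Vector N) r) → Allᵛ (_∈ᵥ H) b → combination c b ∈ᵥ H
    combination∈ []      []      []         = 0∈
    combination∈ (x ∷ c) (v ∷ b) (v∈ ∷ b∈) = +∈ (x ·ᵥ v) (combination c b) (·∈ x v v∈) (combination∈ c b b∈)

  -- Expansion of A(u + v , u + v) = 0. The argument is uniform in the characteristic, including 2.
  gram-symmetric-0 : ∀ {N} (A : Matrix N) → (∀ w → gram A w w ≡ 0#) → ∀ u v →
    gram A u v ≡ 0# → gram A v u ≡ 0#
  gram-symmetric-0 A alt u v eq = begin
    gram A v u                                                   ≡⟨ +-identityˡ _ ⟨
    0# +ᶠ gram A v u                                             ≡⟨ cong (_+ᶠ gram A v u) (alt u) ⟨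
    gram A u u +ᶠ gram A v u                                     ≡⟨ homo-+ (gram-linearˡ A u) u v ⟨
    gram A (u +ᵥ v) u                                            ≡⟨ +-identityʳ _ ⟨
    gram A (u +ᵥ v) u +ᶠ 0#                                      ≡⟨ cong (gram A (u +ᵥ v) u +ᶠ_) (trans (homo-+ (gram-linearˡ A v) u v)
                                                                      (trans (cong₂ _+ᶠ_ eq (alt v)) (+-identityˡ 0#))) ⟨
    gram A (u +ᵥ v) u +ᶠ gram A (u +ᵥ v) v                       ≡⟨ homo-+ (gram-linearʳ A (u +ᵥ v)) u v ⟨
    gram A (u +ᵥ v) (u +ᵥ v)                                     ≡⟨ alt (u +ᵥ v) ⟩
    0#                                                           ∎

  evaluate-symmetric-0 : ∀ {N m} (B : Bilinear N m) → IsAlternating B → ∀ u v →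
    evaluate B u v ≡ 0ᵥ → evaluate B v u ≡ 0ᵥ
  evaluate-symmetric-0 []      alt u v eq = refl
  evaluate-symmetric-0 (A ∷ B) alt u v eq = cong₂ _∷_
    (gram-symmetric-0 A (λ w → Vec.∷-injectiveˡ (alt w)) u v (Vec.∷-injectiveˡ eq))
    (evaluate-symmetric-0 B (λ w → Vec.∷-injectiveʳ (alt w)) u v (Vec.∷-injectiveʳ eq))

  evaluate-vanish-spanʳ : ∀ {N m r} (B : Bilinear N m) u (b : Vec (Vector N) r) →
    Allᵛ (λ w → evaluate B u w ≡ 0ᵥ) b → ∀ v → v ∈span b → evaluate B u v ≡ 0ᵥ
  evaluate-vanish-spanʳ []      u b eqs v v∈ = refl
  evaluate-vanish-spanʳ (A ∷ B) u b eqs v v∈ = cong₂ _∷_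
    (vanish-span (gram-linearʳ A u) (Allᵛ.map Vec.∷-injectiveˡ eqs) v∈)
    (evaluate-vanish-spanʳ B u b (Allᵛ.map Vec.∷-injectiveʳ eqs) v v∈)

  IsotropicFrame : ∀ {N m r} → Bilinear N m → Vec (Vector N) r → Set
  IsotropicFrame B b = Allᵛ (λ u → Allᵛ (λ v → evaluate B u v ≡ 0ᵥ) b) b

  module _ {N m : ℕ} (B : Bilinear N m) (alt : IsAlternating B) where

    isotropic-span : ∀ {r} {b : Vec (Vector N) r} → IsotropicFrame B b →
      ∀ u v → u ∈span b → v ∈span b → evaluate B u v ≡ 0ᵥ
    isotropic-span {b = b} iso u v u∈ v∈ = evaluate-symmetric-0 B alt v u
      (evaluate-vanish-spanʳ B v b
        (Allᵛ.map (λ {w} eqs → evaluate-symmetric-0 B alt w v (evaluate-vanish-spanʳ B w b eqs v v∈)) iso) u u∈)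

    isotropic-∷ : ∀ {r v} {b : Vec (Vector N) r} → Allᵛ (λ w → evaluate B v w ≡ 0ᵥ) b →
      IsotropicFrame B b → IsotropicFrame B (v ∷ b)
    isotropic-∷ {v = v} {b} eqs iso =
      (alt v ∷ eqs) ∷ Allᵛ.map (λ {w} (eq , row) → evaluate-symmetric-0 B alt v w eq ∷ row) (Allᵛ.zip (eqs , iso))

    -- The conditions within `b′` are supplied by its own isotropy, so only the pairs that start in
    -- `b` remain to be imposed.
    isotropic-++ : ∀ {r s} (b : Vec (Vector N) r) {b′ : Vec (Vector N) s} →
      VanishesOn (pairs r (b Vec.++ b′)) B → IsotropicFrame B b′ → IsotropicFrame B (b Vec.++ b′)
    isotropic-++ []      _   iso = iso
    isotropic-++ {suc r} (v ∷ b) {b′} van iso with All.++⁻ (List.map (v ,_) (Vec.toList (b Vec.++ b′))) van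
    ... | van-v , van-b = isotropic-∷ (Allᵛ.toList⁻ (All.map⁻ van-v)) (isotropic-++ b van-b iso)

    pairs⇒isotropic : ∀ {r} (b : Vec (Vector N) r) → VanishesOn (pairs r b) B → IsotropicFrame B b
    pairs⇒isotropic []      _   = []
    pairs⇒isotropic {suc r} (v ∷ b) van with All.++⁻ (List.map (v ,_) (Vec.toList b)) van
    ... | van-v , van-b = isotropic-∷ (Allᵛ.toList⁻ (All.map⁻ van-v)) (pairs⇒isotropic b van-b)

  span-isotropic⇒pairs : ∀ {N m r} (B : Bilinear N m) {b : Vec (Vector N) r} k →
    (∀ u v → u ∈span b → v ∈span b → evaluate B u v ≡ 0ᵥ) → VanishesOn (pairs k b) B
  span-isotropic⇒pairs B {b} k iso =
    All.map (λ { {u , v} (u∈ , v∈) → iso u v u∈ v∈ }) (All-pairs k (⊆span-refl b))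

  subsetsᵉ : ∀ N → Enumeration (VSubset N)
  subsetsᵉ N = enumerate (subset-finite (q ℕ.^ N))

  X≡# : ∀ {N m} r (B : Bilinear N m) → X r B ≡ # (subsetsᵉ N) (isIsotropicSubspace? r B)
  X≡# {N} r B = length-filter (isIsotropicSubspace? r B) (members (subsetsᵉ N))

  isotropicFrame? : ∀ {N m r} (B : Bilinear N m) →
    Decidable (λ (b : Vec (Vector N) r) → LinearlyIndependent b × VanishesOn (pairs r b) B)
  isotropicFrame? {r = r} B b = li? b ×-dec vanishesOn? (pairs r b) B

  module _ {N m : ℕ} (B : Bilinear N m) (alt : IsAlternating B) where

    spanSet-isotropic : ∀ {r} {b : Vec (Vector N) r} → LinearlyIndependent b → IsotropicFrame B b →
      IsIsotropicSubspace r B (spanSet b)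
    spanSet-isotropic {b = b} li iso = spanSet-isSubspace b , spanSet-hasDimension b li ,
      λ u v u∈ v∈ → isotropic-span B alt iso u v (∈-spanSet⁻ b u u∈) (∈-spanSet⁻ b v v∈)

    isotropic-basis : ∀ {r} {H : VSubset N} → IsIsotropicSubspace r B H →
      ∃[ b ] LinearlyIndependent {r = r} b × VanishesOn (pairs r b) B × spanSet b ≡ H
    isotropic-basis {r} (sub , (b , basis) , iso) with spanSet-basis sub basis
    ... | refl = b , proj₁ basis ,
      span-isotropic⇒pairs B r (λ u v u∈ v∈ → iso u v (∈-spanSet⁺ b u u∈) (∈-spanSet⁺ b v v∈)) , refl

    #bases : ∀ {r} {H : VSubset N} → IsIsotropicSubspace r B H →
      # (framesᵉ N r) (λ b → li? b ×-dec Enumeration._≟_ (subsetsᵉ N) (spanSet b) H) ≡ #frames r r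
    #bases {r} isoH with isotropic-basis isoH
    ... | b₀ , li₀ , _ , refl = trans
      (Enumeration.#-cong (framesᵉ N r) (λ b → li? b ×-dec Enumeration._≟_ (subsetsᵉ N) (spanSet b) (spanSet b₀)) (frameIn? li₀)
        (λ { b (li , eq) → li , Allᵛ.map (λ {v} v∈ → ∈-spanSet⁻ b₀ v (subst (v ∈ᵥ_) eq (∈-spanSet⁺ b v v∈))) (⊆span-refl b) })
        (λ { b (li , b⊆) → li , VSubset-ext
          (λ v v∈ → ∈-spanSet⁺ b₀ v (∈span-trans {b = b₀} {b} {v} (∈-spanSet⁻ b v v∈) b⊆))
          (λ v v∈ → ∈-spanSet⁺ b v (full-in-span {b = b₀} {b} li b⊆ ℕₚ.≤-refl {v} (∈-spanSet⁻ b₀ v v∈))) }))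
      (#frames-in-span li₀)

    -- Double count of the pairs consisting of an isotropic subspace and one of its bases: every
    -- subspace has the same number of bases by `#bases`, and a basis determines its subspace
    -- through `spanSet`.
    X*#GL≡#isotropicFrames : ∀ r → X r B ℕ.* #frames r r ≡ # (framesᵉ N r) (isotropicFrame? B)
    X*#GL≡#isotropicFrames r = begin
      X r B ℕ.* #frames r r
        ≡⟨ cong (ℕ._* #frames r r) (X≡# r B) ⟩
      # S iso? ℕ.* #frames r r
        ≡⟨ ∑ˡ-*ʳ (members S) (#frames r r) (λ H → 𝟙 (iso? H)) ⟨
      ∑ S (λ H → 𝟙 (iso? H) ℕ.* #frames r r)
        ≡⟨ ∑ˡ-cong (members S) (λ H → bases H (iso? H)) ⟨
      ∑ S (λ H → 𝟙 (iso? H) ℕ.* # E (λ b → basis? b H))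
        ≡⟨ ∑ˡ-cong (members S) (λ H → ∑ˡ-*ˡ (members E) (𝟙 (iso? H)) (λ b → 𝟙 (basis? b H))) ⟨
      ∑ S (λ H → ∑ E λ b → 𝟙 (iso? H) ℕ.* 𝟙 (basis? b H))
        ≡⟨ ∑ˡ-swap (members S) (members E) _ ⟩
      ∑ E (λ b → ∑ S λ H → 𝟙 (iso? H) ℕ.* 𝟙 (basis? b H))
        -- For fixed `b` the only subspace that contributes is `spanSet b`.
        ≡⟨ ∑ˡ-cong (members E) (λ b → trans (∑ˡ-cong (members S) (reorder b))
             (Enumeration.pick S (spanSet b) (λ H → 𝟙 (li? b) ℕ.* 𝟙 (iso? H)))) ⟩
      ∑ E (λ b → 𝟙 (li? b) ℕ.* 𝟙 (iso? (spanSet b)))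
        ≡⟨ ∑ˡ-cong (members E) (λ b → trans (sym (𝟙-× (li? b) (iso? (spanSet b))))
             (𝟙-cong (li? b ×-dec iso? (spanSet b)) (isotropicFrame? B b)
               (λ { (li , _ , _ , ti) → li , span-isotropic⇒pairs B r
                     λ u v u∈ v∈ → ti u v (∈-spanSet⁺ b u u∈) (∈-spanSet⁺ b v v∈) })
               (λ { (li , van) → li , spanSet-isotropic li (pairs⇒isotropic B alt b van) }))) ⟩
      # E (isotropicFrame? B) ∎
      where
      S = subsetsᵉ N
      E = framesᵉ N r
      iso? = isIsotropicSubspace? r B
      basis? : ∀ b H → Dec (LinearlyIndependent {r = r} b × spanSet b ≡ H)
      basis? b H = li? b ×-dec Enumeration._≟_ S (spanSet b) H
      bases : ∀ H (d : Dec (IsIsotropicSubspace r B H)) → 𝟙 d ℕ.* # E (λ b → basis? b H) ≡ 𝟙 d ℕ.* #frames r r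
      bases H (yes isoH) = cong (1 ℕ.*_) (#bases isoH)
      bases H (no _)     = refl
      reorder : ∀ b H → 𝟙 (iso? H) ℕ.* 𝟙 (basis? b H) ≡
        𝟙 (Enumeration._≟_ S (spanSet b) H) ℕ.* (𝟙 (li? b) ℕ.* 𝟙 (iso? H))
      reorder b H = trans (cong (𝟙 (iso? H) ℕ.*_) (𝟙-× (li? b) (Enumeration._≟_ S (spanSet b) H)))
        (x*yz≡z*yx (𝟙 (iso? H)) (𝟙 (li? b)) _)
        where open import Algebra.Properties.CommutativeSemigroup ℕₚ.*-commutativeSemigroup
                using () renaming (x∙yz≈z∙yx to x*yz≡z*yx)

  #hom : ℕ → ℕ → ℕ
  #hom N m = length (hom-Λ² N m)

  ∑-hom : ∀ {N m} (f : Bilinear N m → ℕ) →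
    ∑ˡ (hom-Λ² N m) f ≡ ∑ (bilinearᵉ N m) (λ B → 𝟙 (isAlternating? B) ℕ.* f B)
  ∑-hom {N} {m} f = ∑ˡ-filter isAlternating? (members (bilinearᵉ N m)) f

  #hom≡#forms : ∀ N m → #hom N m ≡ #forms {N} {m} []
  #hom≡#forms N m = trans (length-filter isAlternating? (members (bilinearᵉ N m)))
    (Enumeration.#-cong (bilinearᵉ N m) isAlternating? (alternatingVanishing? []) (λ B alt → [] , alt) (λ B → proj₂))

  -- After exchanging the sums over forms and frames, each independent frame is isotropic for
  -- exactly the fraction q^(-m r(r-1)/2) of all alternating forms, because its pairs are
  -- independent conditions. All denominators are multiplied out.
  first-moment : ∀ N m r →
    ∑ˡ (hom-Λ² N m) (X r) ℕ.* #frames r r ℕ.* (q ℕ.^ m) ℕ.^ #pairs r r ≡ #frames N r ℕ.* #hom N m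
  first-moment N m r = begin
    ∑ˡ (hom-Λ² N m) (X r) ℕ.* #frames r r ℕ.* Q
      ≡⟨ cong (λ n → n ℕ.* #frames r r ℕ.* Q) (∑-hom {N} {m} (X r)) ⟩
    ∑ 𝓑 (λ B → 𝟙 (isAlternating? B) ℕ.* X r B) ℕ.* #frames r r ℕ.* Q
      ≡⟨ cong (ℕ._* Q) (∑ˡ-*ʳ (members 𝓑) (#frames r r) _) ⟨
    ∑ 𝓑 (λ B → 𝟙 (isAlternating? B) ℕ.* X r B ℕ.* #frames r r) ℕ.* Q
      ≡⟨ cong (ℕ._* Q) (∑ˡ-cong (members 𝓑) λ B → trans (frames B (isAlternating? B))
           (sym (∑ˡ-*ˡ (members E) (𝟙 (isAlternating? B)) λ b → 𝟙 (isotropicFrame? B b)))) ⟩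
    ∑ 𝓑 (λ B → ∑ E λ b → 𝟙 (isAlternating? B) ℕ.* 𝟙 (isotropicFrame? B b)) ℕ.* Q
      ≡⟨ cong (ℕ._* Q) (∑ˡ-swap (members 𝓑) (members E) _) ⟩
    ∑ E (λ b → ∑ 𝓑 λ B → 𝟙 (isAlternating? B) ℕ.* 𝟙 (isotropicFrame? B b)) ℕ.* Q
      ≡⟨ cong (ℕ._* Q) (∑ˡ-cong (members E) λ b → trans (∑ˡ-cong (members 𝓑) (regroup b))
           (∑ˡ-*ˡ (members 𝓑) (𝟙 (li? b)) λ B → 𝟙 (alternatingVanishing? (pairs r b) B))) ⟩
    ∑ E (λ b → 𝟙 (li? b) ℕ.* #forms {N} {m} (pairs r b)) ℕ.* Q
      ≡⟨ ∑ˡ-*ʳ (members E) Q _ ⟨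
    ∑ E (λ b → 𝟙 (li? b) ℕ.* #forms {N} {m} (pairs r b) ℕ.* Q)
      ≡⟨ ∑ˡ-cong (members E) (λ b → constraints b (li? b)) ⟩
    ∑ E (λ b → 𝟙 (li? b) ℕ.* #hom N m)
      ≡⟨ ∑ˡ-*ʳ (members E) (#hom N m) _ ⟩
    #frames N r ℕ.* #hom N m ∎
    where
    𝓑 = bilinearᵉ N m
    E = framesᵉ N r
    Q = (q ℕ.^ m) ℕ.^ #pairs r r
    frames : ∀ B (d : Dec (IsAlternating B)) → 𝟙 d ℕ.* X r B ℕ.* #frames r r ≡ 𝟙 d ℕ.* # E (isotropicFrame? B)
    frames B (yes alt) = trans (cong (ℕ._* #frames r r) (ℕₚ.*-identityˡ (X r B)))
      (trans (X*#GL≡#isotropicFrames B alt r) (sym (ℕₚ.*-identityˡ _)))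
    frames B (no _) = refl
    regroup : ∀ b B → 𝟙 (isAlternating? B) ℕ.* 𝟙 (isotropicFrame? B b) ≡
      𝟙 (li? b) ℕ.* 𝟙 (alternatingVanishing? (pairs r b) B)
    regroup b B = begin
      𝟙 (isAlternating? B) ℕ.* 𝟙 (isotropicFrame? B b)
        ≡⟨ 𝟙-× (isAlternating? B) (isotropicFrame? B b) ⟨
      𝟙 (isAlternating? B ×-dec isotropicFrame? B b)
        ≡⟨ 𝟙-cong (isAlternating? B ×-dec isotropicFrame? B b) (li? b ×-dec alternatingVanishing? (pairs r b) B)
             (λ { (alt , li , van) → li , van , alt }) (λ { (li , van , alt) → alt , li , van }) ⟩
      𝟙 (li? b ×-dec alternatingVanishing? (pairs r b) B)
        ≡⟨ 𝟙-× (li? b) (alternatingVanishing? (pairs r b) B) ⟩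
      𝟙 (li? b) ℕ.* 𝟙 (alternatingVanishing? (pairs r b) B) ∎
    constraints : ∀ b (d : Dec (LinearlyIndependent b)) →
      𝟙 d ℕ.* #forms {N} {m} (pairs r b) ℕ.* Q ≡ 𝟙 d ℕ.* #hom N m
    constraints b (yes li) = trans (cong (ℕ._* Q) (ℕₚ.*-identityˡ (#forms {N} {m} (pairs r b))))
      (trans (ℕₚ.*-comm (#forms {N} {m} (pairs r b)) Q)
      (trans (#forms-pairs {N} {m} r li) (trans (sym (#hom≡#forms N m)) (sym (ℕₚ.*-identityˡ _)))))
    constraints b (no _) = refl

-- Isotropic subspaces and radicals

module Isotropy {q : ℕ} .{{_ : NonTrivial q}} (F : FiniteField q) where
  open Counting F public
  open IsLinear
  open ≡-Reasoning

  kernel-or-witness : ∀ {N r} (φ : Vector N → Carrier) (b : Vec (Vector N) r) →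
    Allᵛ (λ v → φ v ≡ 0#) b ⊎ ∃[ w ] w ∈span b × φ w ≢ 0#
  kernel-or-witness φ []      = inj₁ []
  kernel-or-witness φ (v ∷ b) with φ v ≟ᶠ 0#
  ... | no φv≢0 = inj₂ (v , ∈span-head v b , φv≢0)
  ... | yes φv≡0 with kernel-or-witness φ b
  ...   | inj₁ φb≡0 = inj₁ (φv≡0 ∷ φb≡0)
  ...   | inj₂ (w , w∈ , φw≢0) = inj₂ (w , ∈span-tail {u = v} {w} {b} w∈ , φw≢0)

  li-∷-nonzero : ∀ {N r v} {b : Vec (Vector N) r} → LinearlyIndependent (v ∷ b) → v ≢ 0ᵥ
  li-∷-nonzero {b = b} li refl = li-head {b = b} li (∈span-0 b)

  nonzero-coordinate : ∀ {N} (v : Vector N) → v ≢ 0ᵥ → ∃[ φ ] IsLinear φ × φ v ≢ 0#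
  nonzero-coordinate []      v≢0 = contradiction refl v≢0
  nonzero-coordinate (x ∷ v) v≢0 with x ≟ᶠ 0#
  ... | no x≢0 = Vec.head , record { homo-+ = λ { (_ ∷ _) (_ ∷ _) → refl } ; homo-· = λ { a (_ ∷ _) → refl } } , x≢0
  ... | yes refl with nonzero-coordinate v (λ { refl → v≢0 refl })
  ...   | φ , lin , φv≢0 = φ ∘ Vec.tail , record
    { homo-+ = λ { (_ ∷ u) (_ ∷ w) → homo-+ lin u w } ; homo-· = λ { a (_ ∷ u) → homo-· lin a u } } , φv≢0

  -- A hyperbolic pair u , w splits off from the frame; what remains has two vectors fewer.
  ∃-radical : ∀ {N} (A : Matrix N) → (∀ v → gram A v v ≡ 0#) →
    ∀ n (b : Vec (Vector N) (suc (n ℕ.* 2))) → LinearlyIndependent b →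
    ∃[ v ] v ≢ 0ᵥ × v ∈span b × Allᵛ (λ w → gram A v w ≡ 0#) b
  ∃-radical A alt zero    (u ∷ []) li = u , li-∷-nonzero {b = []} li , ∈span-head u [] , alt u ∷ []
  ∃-radical A alt (suc n) (u ∷ b) li with kernel-or-witness (gram A u) b
  ... | inj₁ Aub≡0 = u , li-∷-nonzero {b = b} li , ∈span-head u b , alt u ∷ Aub≡0
  -- First `b` loses one dimension to become orthogonal to `u`. The result is then moved along `u`,
  -- on which A(· , w) is nonzero, to become orthogonal to `w` as well; this preserves orthogonality
  -- to `u` because A(u , u) = 0.
  ... | inj₂ (w , w∈ , Auw≢0) with drop-to-kernel (gram A u) (gram-linearʳ A u) b (li-tail li)
  ...   | b′ , li′ , b′⊆ , Aub′≡0
      with ∃-shear (λ x → gram A x w) (gram-linearˡ A w) b′ Auw≢0 (li-⊆span li′ li b′⊆)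
  ...   | b″ , li″ , b″⊆ , Ab″w≡0 , preserves with ∃-radical A alt n b″ (li-tail li″)
  ...     | v , v≢0 , v∈ , Avb″≡0 = v , v≢0 , ∈span-trans {b = u ∷ b} {b″} {v} v∈ b″⊆′ ,
              vanish-⊆span (gram-linearʳ A v) {b = w ∷ u ∷ b″} (Avw≡0 ∷ Avu≡0 ∷ Avb″≡0)
                (Allᵛ.map (full-in-span {b = u ∷ b} li-w (w∈′ ∷ ∈span-head u b ∷ b″⊆′) ℕₚ.≤-refl) (⊆span-refl (u ∷ b)))
    where
    w∈′ : w ∈span (u ∷ b)
    w∈′ = ∈span-tail {u = u} {w} {b} w∈
    b″⊆′ : b″ ⊆span (u ∷ b)
    b″⊆′ = ⊆span-trans b″⊆ (∈span-head u b ∷ Allᵛ.map (λ {x} → ∈span-tail {u = u} {x} {b}) b′⊆)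
    Aub″≡0 : Allᵛ (λ x → gram A u x ≡ 0#) b″
    Aub″≡0 = preserves (gram A u) (gram-linearʳ A u) (alt u) Aub′≡0
    Avu≡0 : gram A v u ≡ 0#
    Avu≡0 = gram-symmetric-0 A alt u v (vanish-span (gram-linearʳ A u) Aub″≡0 v∈)
    Avw≡0 : gram A v w ≡ 0#
    Avw≡0 = vanish-span (gram-linearˡ A w) Ab″w≡0 v∈
    -- A(u , ·) vanishes on `u` and `b″` but not at `w`. Hence `w ∷ u ∷ b″` is independent, has the
    -- length of `u ∷ b` and therefore the same span, so orthogonality of `v` may be tested on it.
    li-w : LinearlyIndependent (w ∷ u ∷ b″)
    li-w = li-∷ li″ λ w∈ → Auw≢0 (vanish-span (gram-linearʳ A u) (alt u ∷ Aub″≡0) w∈)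

  -- B₁ has a radical vector v on an odd-dimensional space, so only the single
  -- condition B₂(v,·) = 0 remains when passing to the orthogonal complement of v.
  ∃-isotropic : ∀ {N} (B : Bilinear N 2) → IsAlternating B →
    ∀ n (b : Vec (Vector N) (suc (n ℕ.* 2))) → LinearlyIndependent b →
    ∃[ h ] LinearlyIndependent {r = suc n} h × h ⊆span b × IsotropicFrame B h
  ∃-isotropic B alt zero    (v ∷ []) li = v ∷ [] , li , ⊆span-refl _ , (alt v ∷ []) ∷ []
  ∃-isotropic B@(A₁ ∷ A₂ ∷ []) alt (suc n) b li
    with ∃-radical A₁ (λ v → Vec.∷-injectiveˡ (alt v)) (suc n) b li
  -- Two dimensions are lost in each round. One goes to the kernel of a functional that is nonzero
  -- at `v`, which keeps `v` outside the span of the later `h`; the other goes to the condition A₂(v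
  -- , ·) = 0.
  ... | v , v≢0 , v∈ , A₁vb≡0 with nonzero-coordinate v v≢0
  ...   | φ , φ-lin , φv≢0 with drop-to-kernel φ φ-lin b li
  ...   | b′ , li′ , b′⊆ , φb′≡0 with drop-to-kernel (gram A₂ v) (gram-linearʳ A₂ v) b′ li′
  ...   | b″ , li″ , b″⊆ , A₂vb″≡0 with ∃-isotropic B alt n b″ li″
  ...   | h , li-h , h⊆ , iso =
          v ∷ h , li-∷ li-h (λ v∈h → φv≢0 (vanish-span φ-lin (vanish-⊆span φ-lin φb′≡0 (⊆span-trans h⊆ b″⊆)) v∈h)) ,
          v∈ ∷ h⊆b , isotropic-∷ B alt
            (Allᵛ.map (λ (eq₁ , eq₂) → cong₂ _∷_ eq₁ (cong (_∷ []) eq₂))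
              (Allᵛ.zip (vanish-⊆span (gram-linearʳ A₁ v) A₁vb≡0 h⊆b , vanish-⊆span (gram-linearʳ A₂ v) A₂vb″≡0 h⊆))) iso
    where
    h⊆b : h ⊆span b
    h⊆b = ⊆span-trans h⊆ (⊆span-trans b″⊆ b′⊆)

  ∃-isotropicSubspace : ∀ {N} n → N ≡ suc (n ℕ.* 2) → (B : Bilinear N 2) → IsAlternating B →
    ∃[ H ] IsIsotropicSubspace (suc n) B H
  ∃-isotropicSubspace {N} n N≡ B alt
    with extend N {b = []} li-[] (ℕₚ.≤-reflexive (ℕₚ.+-identityʳ N))
  ... | w , li with ∃-isotropic B alt n (subst (Vec (Vector N)) N+0≡ (w Vec.++ []))
        (subst-li N+0≡ (w Vec.++ []) li)
    where
    N+0≡ : N ℕ.+ 0 ≡ suc (n ℕ.* 2)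
    N+0≡ = trans (ℕₚ.+-identityʳ N) N≡
    subst-li : ∀ {j k} (eq : j ≡ k) (b : Vec (Vector N) j) → LinearlyIndependent b →
      LinearlyIndependent (subst (Vec (Vector N)) eq b)
    subst-li refl b li = li
  ...   | h , li-h , _ , iso = spanSet h , spanSet-isotropic B alt li-h iso

  ∃⇒1≤X : ∀ {N m} r (B : Bilinear N m) → ∃[ H ] IsIsotropicSubspace r B H → 1 ℕ.≤ X r B
  ∃⇒1≤X {N} r B (H , isoH) = ℕₚ.≤-trans
    (Enumeration.1≤# (subsetsᵉ N) (isIsotropicSubspace? r B) H isoH) (ℕₚ.≤-reflexive (sym (X≡# r B)))

  1≤X⇒∃ : ∀ {N m} r (B : Bilinear N m) → 1 ℕ.≤ X r B → ∃[ H ] IsIsotropicSubspace r B H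
  1≤X⇒∃ {N} r B 1≤X with ∃? (subset-finite (q ℕ.^ N)) (isIsotropicSubspace? r B)
  ... | yes ∃H = ∃H
  ... | no ∄H = contradiction (ℕₚ.≤-trans 1≤X (ℕₚ.≤-reflexive (trans (X≡# r B)
    (trans (∑ˡ-cong (members (subsetsᵉ N)) λ H → 𝟙-no (isIsotropicSubspace? r B H) λ isoH → ∄H (H , isoH))
      (∑ˡ-zero (members (subsetsᵉ N))))))) λ ()

  drop-many : ∀ {N} (A : Matrix N) {s} (w : Vec (Vector N) s) {k} (b : Vec (Vector N) (s ℕ.+ k)) →
    LinearlyIndependent b →
    ∃[ b′ ] LinearlyIndependent {r = k} b′ × b′ ⊆span b × Allᵛ (λ x → Allᵛ (λ v → gram A x v ≡ 0#) b′) w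
  drop-many A []      b li = b , li , ⊆span-refl b , []
  drop-many A (x ∷ w) b li with drop-to-kernel (gram A x) (gram-linearʳ A x) b li
  ... | b′ , li′ , b′⊆ , Axb′ with drop-many A w b′ li′
  ...   | b″ , li″ , b″⊆ , Awb″ =
    b″ , li″ , ⊆span-trans b″⊆ b′⊆ , vanish-⊆span (gram-linearʳ A x) Axb′ b″⊆ ∷ Awb″

  RadicalFrame : ∀ {N m r} → Bilinear N m → Vec (Vector N) r → Set
  RadicalFrame {N} B b = Allᵛ (λ v → ∀ w → evaluate B v w ≡ 0ᵥ) b

  radicalFrame? : ∀ {N m r} (B : Bilinear N m) → Decidable (RadicalFrame {r = r} B)
  radicalFrame? {N} B = Allᵛ.all? λ v → ∀? (vectors N) λ w → evaluate B v w ≟ 0ᵥ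

  -- On an isotropic frame of s + k vectors in dimension s + (s + k), a vector is
  -- in the radical as soon as it is orthogonal to the s vectors of a complement.
  isotropic⇒radical : ∀ {s k N} → s ℕ.+ (s ℕ.+ k) ≡ N → (B : Bilinear N 1) → IsAlternating B →
    (h : Vec (Vector N) (s ℕ.+ k)) → LinearlyIndependent h → VanishesOn (pairs (s ℕ.+ k) h) B →
    ∃[ b ] LinearlyIndependent {r = k} b × RadicalFrame B b
  isotropic⇒radical {s} {k} {N} N≡ B@(A ∷ []) alt h li van with extend s li (ℕₚ.≤-reflexive N≡)
  ... | w , li-wh with drop-many A w h li
  ...   | b , li-b , b⊆ , Awb = b , li-b , Allᵛ.map (λ {v} (v∈ , Awv) x → cong (_∷ []) (orthogonal v v∈ Awv x)) (Allᵛ.zip (b⊆ , transpose w Awb))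
    where
    transpose : ∀ {s} {b : Vec (Vector N) k} (w : Vec (Vector N) s) → Allᵛ (λ x → Allᵛ (λ v → gram A x v ≡ 0#) b) w →
      Allᵛ (λ v → Allᵛ (λ x → gram A x v ≡ 0#) w) b
    transpose {b = b} []      []         = Allᵛ.universal (λ _ → []) b
    transpose         (x ∷ w) (eqs ∷ Aw) = Allᵛ.map (λ (eq , eqs) → eq ∷ eqs) (Allᵛ.zip (eqs , transpose w Aw))
    isotropic = isotropic-span B alt (pairs⇒isotropic B alt h van)
    orthogonal : ∀ v → v ∈span h → Allᵛ (λ x → gram A x v ≡ 0#) w → ∀ x → gram A v x ≡ 0#
    orthogonal v v∈ Awv x = gram-symmetric-0 A (λ y → Vec.∷-injectiveˡ (alt y)) x v
      (vanish-span (gram-linearˡ A v) {b = w Vec.++ h}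
        (Allᵛ.++⁺ Awv (Allᵛ.map (λ {y} y∈ → Vec.∷-injectiveˡ (isotropic y v y∈ v∈)) (⊆span-refl h)))
        (full li-wh (ℕₚ.≤-reflexive (sym N≡)) x))

  0ᵥ-++ : ∀ r s → 0ᵥ {r ℕ.+ s} ≡ 0ᵥ {r} Vec.++ 0ᵥ {s}
  0ᵥ-++ zero    s = refl
  0ᵥ-++ (suc r) s = cong (0# ∷_) (0ᵥ-++ r s)

  ++≡0ᵥ : ∀ {r s} (c : Vector r) (d : Vector s) → c Vec.++ d ≡ 0ᵥ → c ≡ 0ᵥ × d ≡ 0ᵥ
  ++≡0ᵥ {r} {s} c d eq = Vec.++-injective c 0ᵥ (trans eq (0ᵥ-++ r s))

  li-++-comm : ∀ {N r s} (b : Vec (Vector N) r) (b′ : Vec (Vector N) s) →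
    LinearlyIndependent (b Vec.++ b′) → LinearlyIndependent (b′ Vec.++ b)
  li-++-comm {r = r} {s} b b′ li c eq with Vec.splitAt s c
  ... | c₂ , c₁ , refl with ++≡0ᵥ c₁ c₂ (li (c₁ Vec.++ c₂) (begin
      combination (c₁ Vec.++ c₂) (b Vec.++ b′)      ≡⟨ combination-++ c₁ c₂ b b′ ⟩
      combination c₁ b +ᵥ combination c₂ b′         ≡⟨ +ᵥ-comm _ _ ⟩
      combination c₂ b′ +ᵥ combination c₁ b         ≡⟨ combination-++ c₂ c₁ b′ b ⟨
      combination (c₂ Vec.++ c₁) (b′ Vec.++ b)      ≡⟨ eq ⟩
      0ᵥ                                            ∎))
  ...   | refl , refl = sym (0ᵥ-++ s r)

  radical⇒pairs : ∀ {N m k s} (B : Bilinear N m) (b : Vec (Vector N) k) (w : Vec (Vector N) s) →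
    RadicalFrame B b → VanishesOn (pairs k (b Vec.++ w)) B
  radical⇒pairs B []      w []         = []
  radical⇒pairs B (v ∷ b) w (eqs ∷ rad) = All.++⁺
    (All.map⁺ (Allᵛ.toList⁺ (Allᵛ.universal eqs (b Vec.++ w)))) (radical⇒pairs B b w rad)

  -- With `b` completed to a basis, lying in the radical forces vanishing on all basis pairs that
  -- meet `b`, and these conditions are independent. `extend` puts the new vectors in front whereas
  -- `pairs` singles out the first ones, hence the exchange by `li-++-comm`.
  #radicalFrame-≤ : ∀ {N m k} {b : Vec (Vector N) k} → LinearlyIndependent b →
    (q ℕ.^ m) ℕ.^ #pairs k N ℕ.* # (bilinearᵉ N m) (λ B → isAlternating? B ×-dec radicalFrame? B b) ℕ.≤ #hom N m
  #radicalFrame-≤ {N} {m} {k} {b} li with extend (N ℕ.∸ k) li (ℕₚ.≤-reflexive (ℕₚ.m∸n+n≡m (li⇒length≤dim li)))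
  ... | w , li-wb = ℕₚ.≤-trans
    (ℕₚ.*-monoʳ-≤ ((q ℕ.^ m) ℕ.^ #pairs k N) (Enumeration.#-mono (bilinearᵉ N m)
      (λ B → isAlternating? B ×-dec radicalFrame? B b) (alternatingVanishing? (pairs k (b Vec.++ w)))
      (λ { B (alt , rad) → radical⇒pairs B b w rad , alt })))
    (ℕₚ.≤-reflexive (trans
      (cong (λ n → (q ℕ.^ m) ℕ.^ #pairs k n ℕ.* #forms {N} {m} (pairs k (b Vec.++ w))) (sym (ℕₚ.m+[n∸m]≡n (li⇒length≤dim li))))
      (trans (#forms-pairs {N} {m} k (li-++-comm w b li-wb)) (sym (#hom≡#forms N m)))))

  -- When X is positive the radical contains a k-dimensional subspace, and every basis of that
  -- subspace is a radical frame.
  #GL*𝟙≤#radicalFrames : ∀ {s k N} → s ℕ.+ (s ℕ.+ k) ≡ N → (B : Bilinear N 1) → IsAlternating B →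
    (d : Dec (1 ℕ.≤ X (s ℕ.+ k) B)) →
    #frames k k ℕ.* 𝟙 d ℕ.≤ # (framesᵉ N k) (λ b → li? b ×-dec radicalFrame? B b)
  #GL*𝟙≤#radicalFrames {s} {k} {N} N≡ B alt (no _) = ℕₚ.≤-trans (ℕₚ.≤-reflexive (ℕₚ.*-zeroʳ (#frames k k))) z≤n
  #GL*𝟙≤#radicalFrames {s} {k} {N} N≡ B alt (yes 1≤X) with 1≤X⇒∃ (s ℕ.+ k) B 1≤X
  ... | H , isoH with isotropic-basis B alt isoH
  ...   | h , li , van , _ with isotropic⇒radical {s} N≡ B alt h li van
  ...     | b₀ , li₀ , rad₀ = ℕₚ.≤-trans
    (ℕₚ.≤-reflexive (trans (ℕₚ.*-identityʳ (#frames k k)) (sym (#frames-in-span li₀))))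
    (Enumeration.#-mono (framesᵉ N k) (frameIn? li₀) (λ b → li? b ×-dec radicalFrame? B b)
      (λ { b (li , b⊆) → li , Allᵛ.map (λ {v} v∈ w → evaluate-symmetric-0 B alt w v
        (evaluate-vanish-spanʳ B w b₀ (Allᵛ.map (λ {u} rad → evaluate-symmetric-0 B alt u w (rad w)) rad₀) v v∈)) b⊆ }))

  -- A union bound: the indicator of X > 0 is bounded by the number of radical frames divided by the
  -- order of GL_k, and after the exchange of sums each frame is charged with the forms whose
  -- radical contains it.
  #positive-≤ : ∀ {s k N} → s ℕ.+ (s ℕ.+ k) ≡ N →
    #frames k k ℕ.* List.length (List.filter (λ B → 0 ℕₚ.<? X (s ℕ.+ k) B) (hom-Λ² N 1)) ℕ.* (q ℕ.^ 1) ℕ.^ #pairs k N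
      ℕ.≤ #frames N k ℕ.* #hom N 1
  #positive-≤ {s} {k} {N} N≡ = ℕₚ.≤-trans (ℕₚ.*-monoˡ-≤ Q (ℕₚ.≤-trans (ℕₚ.≤-reflexive (begin
      #frames k k ℕ.* List.length (List.filter pos? (hom-Λ² N 1))
        ≡⟨ cong (#frames k k ℕ.*_) (trans (length-filter pos? (hom-Λ² N 1)) (∑-hom {N} {1} (λ B → 𝟙 (pos? B)))) ⟩
      #frames k k ℕ.* ∑ 𝓑 (λ B → 𝟙 (isAlternating? B) ℕ.* 𝟙 (pos? B))
        ≡⟨ ∑ˡ-*ˡ (members 𝓑) (#frames k k) _ ⟨
      ∑ 𝓑 (λ B → #frames k k ℕ.* (𝟙 (isAlternating? B) ℕ.* 𝟙 (pos? B))) ∎))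
      (ℕₚ.≤-trans (∑ˡ-mono (members 𝓑) (λ B → bound B (isAlternating? B))) (ℕₚ.≤-reflexive (begin
        ∑ 𝓑 (λ B → 𝟙 (isAlternating? B) ℕ.* # E (λ b → rad? b B))
          ≡⟨ ∑ˡ-cong (members 𝓑) (λ B → ∑ˡ-*ˡ (members E) (𝟙 (isAlternating? B)) (λ b → 𝟙 (rad? b B))) ⟨
        ∑ 𝓑 (λ B → ∑ E λ b → 𝟙 (isAlternating? B) ℕ.* 𝟙 (rad? b B))
          ≡⟨ ∑ˡ-swap (members 𝓑) (members E) _ ⟩
        ∑ E (λ b → ∑ 𝓑 λ B → 𝟙 (isAlternating? B) ℕ.* 𝟙 (rad? b B))
          ≡⟨ ∑ˡ-cong (members E) (λ b → trans (∑ˡ-cong (members 𝓑) (regroup b))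
               (∑ˡ-*ˡ (members 𝓑) (𝟙 (li? b)) (λ B → 𝟙 (altRad? b B)))) ⟩
        ∑ E (λ b → 𝟙 (li? b) ℕ.* # 𝓑 (altRad? b)) ∎)))))
    (ℕₚ.≤-trans (ℕₚ.≤-reflexive (sym (∑ˡ-*ʳ (members E) Q _)))
      (ℕₚ.≤-trans (∑ˡ-mono (members E) (λ b → constraints b (li? b)))
        (ℕₚ.≤-reflexive (∑ˡ-*ʳ (members E) (#hom N 1) _))))
    where
    𝓑 = bilinearᵉ N 1
    E = framesᵉ N k
    Q = (q ℕ.^ 1) ℕ.^ #pairs k N
    pos? : Decidable (λ B → 0 ℕ.< X (s ℕ.+ k) B)
    pos? B = 0 ℕₚ.<? X (s ℕ.+ k) B
    rad? : ∀ (b : Vec (Vector N) k) B → Dec (LinearlyIndependent b × RadicalFrame B b)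
    rad? b B = li? b ×-dec radicalFrame? B b
    altRad? : ∀ (b : Vec (Vector N) k) (B : Bilinear N 1) → Dec (IsAlternating B × RadicalFrame B b)
    altRad? b B = isAlternating? B ×-dec radicalFrame? B b
    bound : ∀ B (d : Dec (IsAlternating B)) →
      #frames k k ℕ.* (𝟙 d ℕ.* 𝟙 (pos? B)) ℕ.≤ 𝟙 d ℕ.* # E (λ b → rad? b B)
    bound B (yes alt) = subst₂ ℕ._≤_ (cong (#frames k k ℕ.*_) (sym (ℕₚ.*-identityˡ (𝟙 (pos? B))))) (sym (ℕₚ.*-identityˡ (# E (λ b → rad? b B))))
      (#GL*𝟙≤#radicalFrames {s} N≡ B alt (pos? B))
    bound B (no _) = ℕₚ.≤-reflexive (ℕₚ.*-zeroʳ (#frames k k))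
    regroup : ∀ b B → 𝟙 (isAlternating? B) ℕ.* 𝟙 (rad? b B) ≡ 𝟙 (li? b) ℕ.* 𝟙 (altRad? b B)
    regroup b B = begin
      𝟙 (isAlternating? B) ℕ.* 𝟙 (rad? b B)    ≡⟨ 𝟙-× (isAlternating? B) (rad? b B) ⟨
      𝟙 (isAlternating? B ×-dec rad? b B)      ≡⟨ 𝟙-cong (isAlternating? B ×-dec rad? b B) (li? b ×-dec altRad? b B)
                                                    (λ { (alt , li , rad) → li , alt , rad }) (λ { (li , alt , rad) → alt , li , rad }) ⟩
      𝟙 (li? b ×-dec altRad? b B)              ≡⟨ 𝟙-× (li? b) (altRad? b B) ⟩
      𝟙 (li? b) ℕ.* 𝟙 (altRad? b B)            ∎
    constraints : ∀ b (d : Dec (LinearlyIndependent b)) → 𝟙 d ℕ.* # 𝓑 (altRad? b) ℕ.* Q ℕ.≤ 𝟙 d ℕ.* #hom N 1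
    constraints b (yes li) = subst₂ ℕ._≤_
      (trans (ℕₚ.*-comm Q (# 𝓑 (altRad? b))) (cong (ℕ._* Q) (sym (ℕₚ.*-identityˡ (# 𝓑 (altRad? b))))))
      (sym (ℕₚ.*-identityˡ (#hom N 1))) (#radicalFrame-≤ {N} {1} {k} {b} li)
    constraints b (no _) = z≤n

-- The second moment of a pencil

module Graphs {q : ℕ} .{{_ : NonTrivial q}} (F : FiniteField q) where
  open Isotropy F public
  open ≡-Reasoning

  -- A basis of the graph of the linear map from the span of `b` to the span of `g` whose matrix is
  -- `L`.
  graph : ∀ {N k l} → Vec (Vector N) k → Vec (Vector N) l → Vec (Vector l) k → Vec (Vector N) k
  graph b g L = Vec.zipWith (λ x c → x +ᵥ combination c g) b L

  combination-graph : ∀ {N k l} (c : Vector k) (b : Vec (Vector N) k) (g : Vec (Vector N) l) L →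
    combination c (graph b g L) ≡ combination c b +ᵥ combination (combination c L) g
  combination-graph []      []      g []      = sym (trans (+ᵥ-identityˡ _) (combination-0 g))
  combination-graph (x ∷ c) (v ∷ b) g (l ∷ L) = begin
    x ·ᵥ (v +ᵥ combination l g) +ᵥ combination c (graph b g L)
      ≡⟨ cong₂ _+ᵥ_ (trans (·ᵥ-distribˡ x v _) (cong (x ·ᵥ v +ᵥ_) (sym (combination-· x l g))))
           (combination-graph c b g L) ⟩
    x ·ᵥ v +ᵥ combination (x ·ᵥ l) g +ᵥ (combination c b +ᵥ combination (combination c L) g)
      ≡⟨ +ᵥ-interchange _ _ _ _ ⟩
    x ·ᵥ v +ᵥ combination c b +ᵥ (combination (x ·ᵥ l) g +ᵥ combination (combination c L) g)
      ≡⟨ cong (x ·ᵥ v +ᵥ combination c b +ᵥ_) (combination-+ (x ·ᵥ l) (combination c L) g) ⟨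
    x ·ᵥ v +ᵥ combination c b +ᵥ combination (x ·ᵥ l +ᵥ combination c L) g ∎

  graph-++ : ∀ {N k k′ l} (b : Vec (Vector N) k) (b′ : Vec (Vector N) k′) (g : Vec (Vector N) l) L L′ →
    graph (b Vec.++ b′) g (L Vec.++ L′) ≡ graph b g L Vec.++ graph b′ g L′
  graph-++ []      b′ g []      L′ = refl
  graph-++ (v ∷ b) b′ g (l ∷ L) L′ = cong (v +ᵥ combination l g ∷_) (graph-++ b b′ g L L′)

  graph-⊆span : ∀ {N k l} (b : Vec (Vector N) k) (g : Vec (Vector N) l) L → graph b g L ⊆span (g Vec.++ b)
  graph-⊆span b g L = go b L (Allᵛ.++ʳ⁻ g (⊆span-refl (g Vec.++ b)))
    where
    go : ∀ {k} (b′ : Vec (Vector _) k) L → b′ ⊆span (g Vec.++ b) → graph b′ g L ⊆span (g Vec.++ b)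
    go []       []      []        = []
    go (v ∷ b′) (l ∷ L) (v∈ ∷ b∈) =
      ∈span-+ {b = g Vec.++ b} {v} v∈ (∈span-combination l (Allᵛ.++ˡ⁻ g (⊆span-refl (g Vec.++ b)))) ∷ go b′ L b∈

  combination-ext : ∀ {k l} (L L′ : Vec (Vector l) k) → (∀ c → combination c L ≡ combination c L′) → L ≡ L′
  combination-ext []      []        _  = refl
  combination-ext (l ∷ L) (l′ ∷ L′) eq = cong₂ _∷_
    (trans (sym (first l L)) (trans (eq (1# ∷ 0ᵥ)) (first l′ L′)))
    (combination-ext L L′ λ c → trans (sym (rest l L c)) (trans (eq (0# ∷ c)) (rest l′ L′ c)))
    where
    first : ∀ {k l} (v : Vector l) (L : Vec (Vector l) k) → combination (1# ∷ 0ᵥ) (v ∷ L) ≡ v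
    first v L = proj₂ (∈span-head v L)
    rest : ∀ {k l} (v : Vector l) (L : Vec (Vector l) k) c → combination (0# ∷ c) (v ∷ L) ≡ combination c L
    rest v L c = trans (cong (_+ᵥ combination c L) (·ᵥ-zeroˡ v)) (+ᵥ-identityˡ _)

  module _ {N k l : ℕ} {b : Vec (Vector N) k} {g : Vec (Vector N) l} (li : LinearlyIndependent (b Vec.++ g)) where

    li-++-injective : ∀ c d c′ d′ → combination c b +ᵥ combination d g ≡ combination c′ b +ᵥ combination d′ g →
      c ≡ c′ × d ≡ d′
    li-++-injective c d c′ d′ eq = Vec.++-injective c c′ (li-injective li
      (trans (combination-++ c d b g) (trans eq (sym (combination-++ c′ d′ b g)))))

    li-graph : ∀ L → LinearlyIndependent (graph b g L)
    li-graph L c eq = proj₁ (li-++-injective c (combination c L) 0ᵥ 0ᵥ (begin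
      combination c b +ᵥ combination (combination c L) g   ≡⟨ combination-graph c b g L ⟨
      combination c (graph b g L)                          ≡⟨ eq ⟩
      0ᵥ                                                   ≡⟨ +ᵥ-identityˡ 0ᵥ ⟨
      0ᵥ +ᵥ 0ᵥ                                             ≡⟨ cong₂ _+ᵥ_ (combination-0 b) (combination-0 g) ⟨
      combination 0ᵥ b +ᵥ combination 0ᵥ g                 ∎))

    -- Independence of `b ++ g` makes the `b`-part of a vector in the graph determine its
    -- coefficients, and the `g`-part is then the value of the map. So the graph determines the map.
    spanSet-graph-injective : ∀ L L′ → spanSet (graph b g L) ≡ spanSet (graph b g L′) → L ≡ L′
    spanSet-graph-injective L L′ same = combination-ext L L′ λ c → row c (∈-spanSet⁻ (graph b g L′) (combination c (graph b g L))
      (subst (combination c (graph b g L) ∈ᵥ_) same (∈-spanSet⁺ (graph b g L) (combination c (graph b g L)) (c , refl))))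
      where
      row : ∀ c → combination c (graph b g L) ∈span graph b g L′ → combination c L ≡ combination c L′
      row c (c′ , eq) with li-++-injective c′ (combination c′ L′) c (combination c L)
        (trans (sym (combination-graph c′ b g L′)) (trans eq (combination-graph c b g L)))
      ... | refl , eq′ = sym eq′

  -- The balance on which the second moment rests. The right side counts the entries of an s × (s +
  -- e) and of an (e + 1) × s matrix; the left side counts two equations for each pair that meets
  -- the first s of s + e + 1 vectors.
  #pairs-graphs : ∀ e s → 2 ℕ.* #pairs s (s ℕ.+ suc e) ≡ (s ℕ.+ e) ℕ.* s ℕ.+ s ℕ.* suc e
  #pairs-graphs e zero    = sym (trans (ℕₚ.+-identityʳ _) (ℕₚ.*-zeroʳ e))
  #pairs-graphs e (suc s) = trans (ℕₚ.*-distribˡ-+ 2 (s ℕ.+ suc e) _)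
    (trans (cong (2 ℕ.* (s ℕ.+ suc e) ℕ.+_) (#pairs-graphs e s)) (identity e s))
    where
    identity : ∀ e s → 2 ℕ.* (s ℕ.+ suc e) ℕ.+ ((s ℕ.+ e) ℕ.* s ℕ.+ s ℕ.* suc e) ≡
      (suc s ℕ.+ e) ℕ.* suc s ℕ.+ suc s ℕ.* suc e
    identity = solve-∀

  -- The dimension e + 1 of the intersection is recorded by its cardinality, so no basis of it has
  -- to be chosen. The shift by one lets `e` range over `Fin r` and leaves trivial intersections
  -- out.
  typed? : ∀ N r e (H : VSubset N) (B : Bilinear N 2) (K : VSubset N) →
    Dec (IsIsotropicSubspace r B K × # (vectorsᵉ N) (λ v → (v ∈ᵥ? H) ×-dec (v ∈ᵥ? K)) ≡ q ℕ.^ suc e)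
  typed? N r e H B K = isIsotropicSubspace? r B K ×-dec
    (# (vectorsᵉ N) (λ v → (v ∈ᵥ? H) ×-dec (v ∈ᵥ? K)) ℕₚ.≟ q ℕ.^ suc e)

  -- For h = z ++ x, completed by y ++ t to a basis, the subspaces spanned by the
  -- graphs over y ++ x with values in the span of z ++ t, where x takes values in
  -- the span of z, meet the span of h exactly in the span of the graph over x.
  module Type (e s : ℕ) {N : ℕ} (N≡ : (s ℕ.+ e) ℕ.+ (s ℕ.+ suc e) ≡ N)
    (z : Vec (Vector N) s) (x : Vec (Vector N) (suc e)) (y : Vec (Vector N) s) (t : Vec (Vector N) e)
    (li-ytzx : LinearlyIndependent ((y Vec.++ t) Vec.++ (z Vec.++ x))) where

    h : Vec (Vector N) (s ℕ.+ suc e)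
    h = z Vec.++ x

    b : Vec (Vector N) (s ℕ.+ suc e)
    b = y Vec.++ x

    g : Vec (Vector N) (s ℕ.+ e)
    g = z Vec.++ t

    li-bg : LinearlyIndependent (b Vec.++ g)
    li-bg c eq with Vec.splitAt (s ℕ.+ suc e) c
    ... | cyx , czt , refl with Vec.splitAt s cyx | Vec.splitAt s czt
    ...   | cy , cx , refl | cz , ct , refl
      with ++≡0ᵥ (cy Vec.++ ct) (cz Vec.++ cx) (li-ytzx _ (begin
        combination ((cy Vec.++ ct) Vec.++ (cz Vec.++ cx)) ((y Vec.++ t) Vec.++ (z Vec.++ x))
          ≡⟨ trans (combination-++ (cy Vec.++ ct) (cz Vec.++ cx) _ _) (cong₂ _+ᵥ_ (combination-++ cy ct y t) (combination-++ cz cx z x)) ⟩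
        combination cy y +ᵥ combination ct t +ᵥ (combination cz z +ᵥ combination cx x)
          ≡⟨ cong (combination cy y +ᵥ combination ct t +ᵥ_) (+ᵥ-comm _ _) ⟩
        combination cy y +ᵥ combination ct t +ᵥ (combination cx x +ᵥ combination cz z)
          ≡⟨ +ᵥ-interchange _ _ _ _ ⟩
        combination cy y +ᵥ combination cx x +ᵥ (combination ct t +ᵥ combination cz z)
          ≡⟨ cong (combination cy y +ᵥ combination cx x +ᵥ_) (+ᵥ-comm _ _) ⟩
        combination cy y +ᵥ combination cx x +ᵥ (combination cz z +ᵥ combination ct t)
          ≡⟨ trans (combination-++ (cy Vec.++ cx) (cz Vec.++ ct) _ _) (cong₂ _+ᵥ_ (combination-++ cy cx y x) (combination-++ cz ct z t)) ⟨
        combination ((cy Vec.++ cx) Vec.++ (cz Vec.++ ct)) (b Vec.++ g)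
          ≡⟨ eq ⟩
        0ᵥ ∎))
    ...     | yt≡0 , zx≡0 with ++≡0ᵥ cy ct yt≡0 | ++≡0ᵥ cz cx zx≡0
    ...       | refl , refl | refl , refl = trans (cong₂ Vec._++_ (sym (0ᵥ-++ s (suc e))) (sym (0ᵥ-++ s e)))
                (sym (0ᵥ-++ (s ℕ.+ suc e) (s ℕ.+ e)))

    Parameter : Set
    Parameter = Vec (Vector (s ℕ.+ e)) s × Vec (Vector s) (suc e)

    parameterᵉ : Enumeration Parameter
    parameterᵉ = framesᵉ (s ℕ.+ e) s ×ᵉ framesᵉ s (suc e)

    pad : ∀ {k} → Vec (Vector s) k → Vec (Vector (s ℕ.+ e)) k
    pad = Vec.map (Vec._++ 0ᵥ)

    pad-injective : ∀ {k} (U U′ : Vec (Vector s) k) → pad U ≡ pad U′ → U ≡ U′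
    pad-injective []      []        _  = refl
    pad-injective (u ∷ U) (u′ ∷ U′) eq = cong₂ _∷_
      (proj₁ (Vec.++-injective u u′ (Vec.∷-injectiveˡ eq))) (pad-injective U U′ (Vec.∷-injectiveʳ eq))

    values : Parameter → Vec (Vector (s ℕ.+ e)) (s ℕ.+ suc e)
    values (M , U) = M Vec.++ pad U

    values-injective : ∀ L L′ → values L ≡ values L′ → L ≡ L′
    values-injective (M , U) (M′ , U′) eq = cong₂ _,_
      (proj₁ (Vec.++-injective M M′ eq)) (pad-injective U U′ (proj₂ (Vec.++-injective M M′ eq)))

    over-x : Parameter → Vec (Vector N) (suc e)
    over-x (_ , U) = graph x z U

    frame : Parameter → Vec (Vector N) (s ℕ.+ suc e)
    frame L@(M , U) = graph y g M Vec.++ over-x L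

    graph-pad : ∀ {k} (b′ : Vec (Vector N) k) U → graph b′ g (pad U) ≡ graph b′ z U
    graph-pad []       []      = refl
    graph-pad (v ∷ b′) (u ∷ U) = cong₂ _∷_
      (cong (v +ᵥ_) (trans (combination-++ u 0ᵥ z t) (trans (cong (combination u z +ᵥ_) (combination-0 t)) (+ᵥ-identityʳ _))))
      (graph-pad b′ U)

    frame≡graph : ∀ L → frame L ≡ graph b g (values L)
    frame≡graph (M , U) = trans (cong (graph y g M Vec.++_) (sym (graph-pad x U))) (sym (graph-++ y x g M (pad U)))

    li-frame : ∀ L → LinearlyIndependent (frame L)
    li-frame L = subst LinearlyIndependent (sym (frame≡graph L)) (li-graph li-bg (values L))

    spanSet-frame-injective : ∀ L L′ → spanSet (frame L) ≡ spanSet (frame L′) → L ≡ L′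
    spanSet-frame-injective L L′ same = values-injective L L′ (spanSet-graph-injective li-bg (values L) (values L′)
      (subst₂ (λ k k′ → spanSet k ≡ spanSet k′) (frame≡graph L) (frame≡graph L′) same))

    over-x⊆h : ∀ L → over-x L ⊆span h
    over-x⊆h (_ , U) = graph-⊆span x z U

    -- In the basis `b ++ g` a vector of the span of `h` has no `y`-component, whereas in the frame
    -- the `y`-component is exactly the coefficient vector of the block over `y`. So that block does
    -- not contribute.
    h∩frame⊆over-x : ∀ L v → v ∈span h → v ∈span frame L → v ∈span over-x L
    h∩frame⊆over-x L@(M , U) v (ch , eq-h) (c , eq) with Vec.splitAt s ch | Vec.splitAt s c
    ... | cz , cx , refl | cy , cx′ , refl
      with li-++-injective li-bg (cy Vec.++ cx′) (combination (cy Vec.++ cx′) (values L)) (0ᵥ Vec.++ cx) (cz Vec.++ 0ᵥ) (begin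
        combination (cy Vec.++ cx′) b +ᵥ combination (combination (cy Vec.++ cx′) (values L)) g
          ≡⟨ combination-graph (cy Vec.++ cx′) b g (values L) ⟨
        combination (cy Vec.++ cx′) (graph b g (values L))
          ≡⟨ cong (combination (cy Vec.++ cx′)) (frame≡graph L) ⟨
        combination (cy Vec.++ cx′) (frame L)
          ≡⟨ trans eq (sym eq-h) ⟩
        combination (cz Vec.++ cx) h
          ≡⟨ trans (combination-++ cz cx z x) (+ᵥ-comm _ _) ⟩
        combination cx x +ᵥ combination cz z
          ≡⟨ cong₂ _+ᵥ_
               (trans (combination-++ 0ᵥ cx y x) (trans (cong (_+ᵥ combination cx x) (combination-0 y)) (+ᵥ-identityˡ _)))
               (trans (combination-++ cz 0ᵥ z t) (trans (cong (combination cz z +ᵥ_) (combination-0 t)) (+ᵥ-identityʳ _))) ⟨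
        combination (0ᵥ Vec.++ cx) b +ᵥ combination (cz Vec.++ 0ᵥ) g ∎)
    ... | eq′ , _ with Vec.++-injective cy 0ᵥ eq′
    ...   | refl , refl = cx , trans (sym (trans (combination-++ 0ᵥ cx (graph y g M) (over-x L))
              (trans (cong (_+ᵥ combination cx (over-x L)) (combination-0 (graph y g M))) (+ᵥ-identityˡ _)))) eq

    #h∩frame : ∀ L → # (vectorsᵉ N) (λ v → (v ∈ᵥ? spanSet h) ×-dec (v ∈ᵥ? spanSet (frame L))) ≡ q ℕ.^ suc e
    #h∩frame L = trans (Enumeration.#-cong (vectorsᵉ N)
      (λ v → (v ∈ᵥ? spanSet h) ×-dec (v ∈ᵥ? spanSet (frame L))) (_∈span? over-x L)
      (λ v (v∈h , v∈k) → h∩frame⊆over-x L v (∈-spanSet⁻ h v v∈h) (∈-spanSet⁻ (frame L) v v∈k))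
      (λ v v∈ → ∈-spanSet⁺ h v (∈span-trans {b = h} {over-x L} {v} v∈ (over-x⊆h L)) ,
                ∈-spanSet⁺ (frame L) v (∈span-trans {b = frame L} {over-x L} {v} v∈
                  (Allᵛ.++ʳ⁻ (graph y g (proj₁ L)) (⊆span-refl (frame L))))))
      (#span (li-++⁻ (graph y g (proj₁ L)) (over-x L) (li-frame L)))
      where
      li-++⁻ : ∀ {j k} (u : Vec (Vector N) j) (v : Vec (Vector N) k) → LinearlyIndependent (u Vec.++ v) → LinearlyIndependent v
      li-++⁻ []      v li = li
      li-++⁻ (_ ∷ u) v li = li-++⁻ u v (li-tail li)

    r = s ℕ.+ suc e

    constraints : Parameter → List (Vector N × Vector N)
    constraints L = pairs s (frame L) List.++ pairs r h

    -- The vectors over `x` lie in the isotropic span of `h`, so the pairs that meet the first `s`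
    -- vectors are all that is left to impose. Distinct parameters yield distinct subspaces.
    #graphs-≤ : ∀ (B : Bilinear N 2) (d : Dec (AlternatingVanishing (pairs r h) B)) →
      # parameterᵉ (λ L → alternatingVanishing? (constraints L) B) ℕ.≤ 𝟙 d ℕ.* # (subsetsᵉ N) (typed? N r e (spanSet h) B)
    #graphs-≤ B (no ∉) = ℕₚ.≤-reflexive (trans (∑ˡ-cong (members parameterᵉ) λ L →
      𝟙-no (alternatingVanishing? (constraints L) B) λ (van , alt) → ∉ (All.++⁻ʳ (pairs s (frame L)) van , alt))
      (∑ˡ-zero (members parameterᵉ)))
    #graphs-≤ B (yes (van-h , alt)) = ℕₚ.≤-trans
      (#-≤ parameterᵉ (subsetsᵉ N) (λ L → alternatingVanishing? (constraints L) B) (typed? N r e (spanSet h) B) (λ L → spanSet (frame L))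
        (λ L (van , _) → spanSet-isotropic B alt (li-frame L)
               (isotropic-++ B alt (graph y g (proj₁ L)) (All.++⁻ˡ (pairs s (frame L)) van) (over-x-isotropic L)) , #h∩frame L)
        (λ L L′ _ _ → spanSet-frame-injective L L′))
      (ℕₚ.≤-reflexive (sym (ℕₚ.*-identityˡ (# (subsetsᵉ N) (typed? N r e (spanSet h) B)))))
      where
      over-x-isotropic : ∀ L → IsotropicFrame B (over-x L)
      over-x-isotropic L = Allᵛ.map (λ {u} u∈ → Allᵛ.map (λ {v} v∈ →
        isotropic-span B alt (pairs⇒isotropic B alt h van-h) u v u∈ v∈) (over-x⊆h L)) (over-x⊆h L)

    P : ℕ
    P = (q ℕ.^ 2) ℕ.^ #pairs s r

    #parameters : ∀ c → ∑ parameterᵉ (λ _ → c) ≡ P ℕ.* c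
    #parameters c = begin
      ∑ parameterᵉ (λ _ → c)
        ≡⟨ ∑-× (framesᵉ (s ℕ.+ e) s) (framesᵉ s (suc e)) (λ _ → c) ⟩
      ∑ (framesᵉ (s ℕ.+ e) s) (λ _ → ∑ (framesᵉ s (suc e)) λ _ → c)
        ≡⟨ ∑-const (vec-finite (vectors (s ℕ.+ e)) s) _ ⟩
      (q ℕ.^ (s ℕ.+ e)) ℕ.^ s ℕ.* ∑ (framesᵉ s (suc e)) (λ _ → c)
        ≡⟨ cong ((q ℕ.^ (s ℕ.+ e)) ℕ.^ s ℕ.*_) (∑-const (vec-finite (vectors s) (suc e)) c) ⟩
      (q ℕ.^ (s ℕ.+ e)) ℕ.^ s ℕ.* ((q ℕ.^ s) ℕ.^ suc e ℕ.* c)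
        ≡⟨ ℕₚ.*-assoc ((q ℕ.^ (s ℕ.+ e)) ℕ.^ s) _ c ⟨
      (q ℕ.^ (s ℕ.+ e)) ℕ.^ s ℕ.* (q ℕ.^ s) ℕ.^ suc e ℕ.* c
        ≡⟨ cong (ℕ._* c) (begin
          (q ℕ.^ (s ℕ.+ e)) ℕ.^ s ℕ.* (q ℕ.^ s) ℕ.^ suc e
            ≡⟨ cong₂ ℕ._*_ (ℕₚ.^-*-assoc q (s ℕ.+ e) s) (ℕₚ.^-*-assoc q s (suc e)) ⟩
          q ℕ.^ ((s ℕ.+ e) ℕ.* s) ℕ.* q ℕ.^ (s ℕ.* suc e)
            ≡⟨ ℕₚ.^-distribˡ-+-* q ((s ℕ.+ e) ℕ.* s) (s ℕ.* suc e) ⟨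
          q ℕ.^ ((s ℕ.+ e) ℕ.* s ℕ.+ s ℕ.* suc e)
            ≡⟨ cong (q ℕ.^_) (#pairs-graphs e s) ⟨
          q ℕ.^ (2 ℕ.* #pairs s r)
            ≡⟨ ℕₚ.^-*-assoc q 2 (#pairs s r) ⟨
          P ∎) ⟩
      P ℕ.* c ∎

    -- there are as many graphs as the factor lost by imposing isotropy on one of them
    #forms-≤ : #forms {N} {2} (pairs r h) ℕ.≤
      ∑ (bilinearᵉ N 2) (λ B → 𝟙 (alternatingVanishing? (pairs r h) B) ℕ.* # (subsetsᵉ N) (typed? N r e (spanSet h) B))
    #forms-≤ = ℕₚ.≤-trans
      (ℕₚ.*-cancelˡ-≤ P {{P≢0}} (ℕₚ.≤-trans (ℕₚ.≤-reflexive (sym (#parameters (#forms {N} {2} (pairs r h)))))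
        (ℕₚ.≤-trans (∑ˡ-mono (members parameterᵉ) λ L → subst
            (λ n → #forms {N} {2} (pairs r h) ℕ.≤ (q ℕ.^ 2) ℕ.^ n ℕ.* #forms {N} {2} (constraints L))
            (length-pairs s (frame L)) (#forms-++-≤ {N} {2} (pairs s (frame L)) (pairs r h)))
          (ℕₚ.≤-reflexive (∑ˡ-*ˡ (members parameterᵉ) P _)))))
      (ℕₚ.≤-trans (ℕₚ.≤-reflexive (∑ˡ-swap (members parameterᵉ) (members (bilinearᵉ N 2)) _))
        (∑ˡ-mono (members (bilinearᵉ N 2)) λ B → #graphs-≤ B (alternatingVanishing? (pairs r h) B)))
      where
      instance
        q≢0 = ℕ.nonTrivial⇒nonZero q
        q²≢0 = ℕₚ.m^n≢0 q 2
      P≢0 : NonZero P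
      P≢0 = ℕₚ.m^n≢0 (q ℕ.^ 2) (#pairs s r)

-- Summation over the dimension of the intersection

module SecondMoment {q : ℕ} .{{_ : NonTrivial q}} (F : FiniteField q) where
  open Graphs F public

  splitAt-elim : ∀ {A : Set} m {n} (P : Vec A (m ℕ.+ n) → Set) → (∀ u v → P (u Vec.++ v)) → ∀ w → P w
  splitAt-elim m P f w = let u , v , eq = Vec.splitAt m w in subst P (sym eq) (f u v)

  altIso? : ∀ N r (H : VSubset N) (B : Bilinear N 2) → Dec (IsAlternating B × IsIsotropicSubspace r B H)
  altIso? N r H B = isAlternating? B ×-dec isIsotropicSubspace? r B H

  -- In other terms: on average over the alternating forms for which `H` is isotropic, at least one
  -- isotropic `K` meets `H` in dimension e + 1.
  TypeBound : ∀ N r e → VSubset N → Set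
  TypeBound N r e H = # (bilinearᵉ N 2) (altIso? N r H) ℕ.≤
    ∑ (bilinearᵉ N 2) (λ B → 𝟙 (altIso? N r H B) ℕ.* # (subsetsᵉ N) (typed? N r e H B))

  module _ {N : ℕ} where

    alternatingVanishing⇒altIso : ∀ {r} (h : Vec (Vector N) r) → LinearlyIndependent h → (B : Bilinear N 2) →
      AlternatingVanishing (pairs r h) B → IsAlternating B × IsIsotropicSubspace r B (spanSet h)
    alternatingVanishing⇒altIso h li B (van , alt) = alt , spanSet-isotropic B alt li (pairs⇒isotropic B alt h van)

    altIso⇒alternatingVanishing : ∀ {r} (h : Vec (Vector N) r) (B : Bilinear N 2) →
      IsAlternating B × IsIsotropicSubspace r B (spanSet h) → AlternatingVanishing (pairs r h) B
    altIso⇒alternatingVanishing {r} h B (alt , _ , _ , ti) = span-isotropic⇒pairs B r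
      (λ u v u∈ v∈ → ti u v (∈-spanSet⁺ h u u∈) (∈-spanSet⁺ h v v∈)) , alt

    typeBound-basis : ∀ {r} e (h : Vec (Vector N) r) → LinearlyIndependent h →
      #forms {N} {2} (pairs r h) ℕ.≤ ∑ (bilinearᵉ N 2) (λ B →
        𝟙 (alternatingVanishing? (pairs r h) B) ℕ.* # (subsetsᵉ N) (typed? N r e (spanSet h) B)) →
      TypeBound N r e (spanSet h)
    typeBound-basis {r} e h li = subst₂ ℕ._≤_
      (Enumeration.#-cong (bilinearᵉ N 2) (alternatingVanishing? (pairs r h)) (altIso? N r (spanSet h))
        (alternatingVanishing⇒altIso h li) (altIso⇒alternatingVanishing h))
      (∑ˡ-cong (members (bilinearᵉ N 2)) λ B → cong (ℕ._* # (subsetsᵉ N) (typed? N r e (spanSet h) B))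
        (𝟙-cong (alternatingVanishing? (pairs r h) B) (altIso? N r (spanSet h) B)
          (alternatingVanishing⇒altIso h li B) (altIso⇒alternatingVanishing h B)))

    typeBound-split : ∀ e s → suc N ≡ (s ℕ.+ suc e) ℕ.+ (s ℕ.+ suc e) →
      ∀ (h : Vec (Vector N) (s ℕ.+ suc e)) → LinearlyIndependent h → TypeBound N (s ℕ.+ suc e) e (spanSet h)
    typeBound-split e s N+1≡2r = splitAt-elim s (λ h → LinearlyIndependent h → TypeBound N (s ℕ.+ suc e) e (spanSet h))
      λ z x li → completed z x li (extend (s ℕ.+ e) li (ℕₚ.≤-reflexive N≡))
      where
      N≡ : s ℕ.+ e ℕ.+ (s ℕ.+ suc e) ≡ N
      N≡ = ℕₚ.suc-injective (trans (cong (ℕ._+ (s ℕ.+ suc e)) (sym (ℕₚ.+-suc s e))) (sym N+1≡2r))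
      completed : ∀ z x → LinearlyIndependent (z Vec.++ x) →
        ∃[ w ] LinearlyIndependent (Vec._++_ {m = s ℕ.+ e} w (z Vec.++ x)) → TypeBound N (s ℕ.+ suc e) e (spanSet (z Vec.++ x))
      completed z x li (w , li-w) = splitAt-elim s
        (λ w → LinearlyIndependent (w Vec.++ (z Vec.++ x)) → TypeBound N (s ℕ.+ suc e) e (spanSet (z Vec.++ x)))
        (λ y t li-ytzx → typeBound-basis e (z Vec.++ x) li (Type.#forms-≤ e s N≡ z x y t li-ytzx))
        w li-w

    typeBound-span : ∀ {r} e s → s ℕ.+ suc e ≡ r → suc N ≡ r ℕ.+ r →
      ∀ (h : Vec (Vector N) r) → LinearlyIndependent h → TypeBound N r e (spanSet h)
    typeBound-span e s refl = typeBound-split e s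

  module _ {N r : ℕ} (N+1≡2r : suc N ≡ r ℕ.+ r) where

    private
      S = subsetsᵉ N
      𝓑 = bilinearᵉ N 2
      I = enumerate (↔-refl {A = Fin r})

    -- The types are disjoint, since the cardinality q^(e+1) of the intersection determines `e`.
    Σ-typed-≤X : ∀ H B → ∑ I (λ i → # S (typed? N r (toℕ i) H B)) ℕ.≤ X r B
    Σ-typed-≤X H B = ℕₚ.≤-trans (ℕₚ.≤-reflexive (∑ˡ-swap (members I) (members S) _))
      (ℕₚ.≤-trans (∑ˡ-mono (members S) λ K → Enumeration.#≤𝟙 I (λ i → typed? N r (toℕ i) H B K) (isIsotropicSubspace? r B K)
          (λ _ → proj₁) λ i j (_ , eq) (_ , eq′) → Fin.toℕ-injective (ℕₚ.suc-injective (^-injective (trans (sym eq) eq′))))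
        (ℕₚ.≤-reflexive (sym (X≡# r B))))
      where
      ^-injective : ∀ {m n} → q ℕ.^ m ≡ q ℕ.^ n → m ≡ n
      ^-injective eq = ℕₚ.≤-antisym (^-cancel-≤ (ℕₚ.≤-reflexive eq)) (^-cancel-≤ (ℕₚ.≤-reflexive (sym eq)))

    -- If no form makes `H` isotropic, the left side is zero; otherwise such a form supplies a basis
    -- of `H`. The parameter `s` of the graphs is then the codimension of the intersection in `H`.
    typeBound : ∀ H (i : Fin r) → TypeBound N r (toℕ i) H
    typeBound H i = by-cases (∃? (bilinear-finite N 2) (altIso? N r H))
      where
      by-cases : Dec (∃[ B ] IsAlternating B × IsIsotropicSubspace r B H) → TypeBound N r (toℕ i) H
      by-cases (no ∄B) = ℕₚ.≤-trans (ℕₚ.≤-reflexive (trans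
        (∑ˡ-cong (members 𝓑) λ B → 𝟙-no (altIso? N r H B) λ B∈ → ∄B (B , B∈)) (∑ˡ-zero (members 𝓑)))) z≤n
      by-cases (yes (B₀ , alt₀ , isoH₀)) = let h , li , _ , eq = isotropic-basis B₀ alt₀ isoH₀ in
        subst (TypeBound N r (toℕ i)) eq
          (typeBound-span (toℕ i) (r ℕ.∸ suc (toℕ i)) (ℕₚ.m∸n+n≡m (Fin.toℕ<n i)) N+1≡2r h li)

    -- Each of the r intersection dimensions 1, ..., r contributes at least the total of X.
    -- Dimension r is K = H, the diagonal that X(X - 1) will remove.
    second-moment : r ℕ.* ∑ˡ (hom-Λ² N 2) (X r) ℕ.≤ ∑ˡ (hom-Λ² N 2) (λ B → X r B ℕ.* X r B)
    second-moment = begin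
      r ℕ.* ∑ˡ (hom-Λ² N 2) (X r)
        ≡⟨ ∑-const (↔-refl {A = Fin r}) _ ⟨
      ∑ I (λ _ → ∑ˡ (hom-Λ² N 2) (X r))
        ≡⟨ ∑ˡ-cong (members I) (λ _ → as-double-sum (λ _ _ → 1)
             (λ B → trans (∑ˡ-cong (members S) λ H → ℕₚ.*-identityʳ _) (sym (X≡# r B)))) ⟩
      ∑ I (λ _ → ∑ S λ H → ∑ 𝓑 λ B → 𝟙 (altIso? N r H B) ℕ.* 1)
        ≡⟨ ∑ˡ-cong (members I) (λ _ → ∑ˡ-cong (members S) λ H → ∑ˡ-cong (members 𝓑) λ B → ℕₚ.*-identityʳ _) ⟩
      ∑ I (λ _ → ∑ S λ H → # 𝓑 (altIso? N r H))
        ≤⟨ ∑ˡ-mono (members I) (λ i → ∑ˡ-mono (members S) λ H → typeBound H i) ⟩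
      ∑ I (λ i → ∑ S λ H → ∑ 𝓑 λ B → 𝟙 (altIso? N r H B) ℕ.* # S (typed? N r (toℕ i) H B))
        ≡⟨ ∑ˡ-swap (members I) (members S) _ ⟩
      ∑ S (λ H → ∑ I λ i → ∑ 𝓑 λ B → 𝟙 (altIso? N r H B) ℕ.* # S (typed? N r (toℕ i) H B))
        ≡⟨ ∑ˡ-cong (members S) (λ H → trans (∑ˡ-swap (members I) (members 𝓑) _)
             (∑ˡ-cong (members 𝓑) λ B → ∑ˡ-*ˡ (members I) (𝟙 (altIso? N r H B)) _)) ⟩
      ∑ S (λ H → ∑ 𝓑 λ B → 𝟙 (altIso? N r H B) ℕ.* ∑ I (λ i → # S (typed? N r (toℕ i) H B)))
        ≤⟨ ∑ˡ-mono (members S) (λ H → ∑ˡ-mono (members 𝓑) λ B → ℕₚ.*-monoʳ-≤ (𝟙 (altIso? N r H B)) (Σ-typed-≤X H B)) ⟩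
      ∑ S (λ H → ∑ 𝓑 λ B → 𝟙 (altIso? N r H B) ℕ.* X r B)
        ≡⟨ as-double-sum (λ H B → X r B) (λ B → trans (∑ˡ-*ʳ (members S) (X r B) _) (cong (ℕ._* X r B) (sym (X≡# r B)))) ⟨
      ∑ˡ (hom-Λ² N 2) (λ B → X r B ℕ.* X r B) ∎
      where
      open ℕₚ.≤-Reasoning
      as-double-sum : ∀ {f : Bilinear N 2 → ℕ} (f′ : VSubset N → Bilinear N 2 → ℕ) →
        (∀ B → ∑ S (λ H → 𝟙 (isIsotropicSubspace? r B H) ℕ.* f′ H B) ≡ f B) →
        ∑ˡ (hom-Λ² N 2) f ≡ ∑ S (λ H → ∑ 𝓑 λ B → 𝟙 (altIso? N r H B) ℕ.* f′ H B)
      as-double-sum {f} f′ eq = trans (∑-hom {N} {2} f) (trans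
        (∑ˡ-cong (members 𝓑) λ B → trans (cong (𝟙 (isAlternating? B) ℕ.*_) (sym (eq B)))
          (trans (sym (∑ˡ-*ˡ (members S) (𝟙 (isAlternating? B)) _))
            (∑ˡ-cong (members S) λ H → trans (sym (ℕₚ.*-assoc (𝟙 (isAlternating? B)) _ _))
              (cong (ℕ._* f′ H B) (sym (𝟙-× (isAlternating? B) (isIsotropicSubspace? r B H)))))))
        (∑ˡ-swap (members 𝓑) (members S) _))

-- Rational estimates

module RationalLimits (q : ℕ) .{{_ : NonTrivial q}} where
  open EulerProduct q using
    (P; t; P-pos; P≥0; t≥0; P-step; P-mono; P-suc≤4; archimedean; n*t≤1; toℚᵘ-fromℕ; P-cauchy)
  open ℚₚ.≤-Reasoning
  open +-*-Solver

  private instance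
    q≢0 = ℕ.nonTrivial⇒nonZero q

  fromℕ-+ : ∀ m n → fromℕ (m ℕ.+ n) ≡ fromℕ m ℚ.+ fromℕ n
  fromℕ-+ m n = ℚₚ.toℚᵘ-injective
    (ℚᵘₚ.≃-trans (toℚᵘ-fromℕ (m ℕ.+ n))
    (ℚᵘₚ.≃-trans (ℚᵘ.*≡* (cong (ℤ._* ℤ.1ℤ) (cong₂ ℤ._+_ (sym (ℤ.*-identityʳ (ℤ.+ m))) (sym (ℤ.*-identityʳ (ℤ.+ n))))))
    (ℚᵘₚ.≃-sym (ℚᵘₚ.≃-trans (ℚₚ.toℚᵘ-homo-+ (fromℕ m) (fromℕ n))
      (ℚᵘₚ.+-cong (toℚᵘ-fromℕ m) (toℚᵘ-fromℕ n))))))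

  fromℕ-* : ∀ m n → fromℕ (m ℕ.* n) ≡ fromℕ m ℚ.* fromℕ n
  fromℕ-* m n = ℚₚ.toℚᵘ-injective
    (ℚᵘₚ.≃-trans (toℚᵘ-fromℕ (m ℕ.* n))
    (ℚᵘₚ.≃-trans (ℚᵘ.*≡* (cong (ℤ._* ℤ.1ℤ) (ℤ.pos-* m n)))
    (ℚᵘₚ.≃-sym (ℚᵘₚ.≃-trans (ℚₚ.toℚᵘ-homo-* (fromℕ m) (fromℕ n))
      (ℚᵘₚ.*-cong (toℚᵘ-fromℕ m) (toℚᵘ-fromℕ n))))))

  fromℕ-mono-≤ : ∀ {m n} → m ℕ.≤ n → fromℕ m ℚ.≤ fromℕ n
  fromℕ-mono-≤ {m} {n} m≤n = ℚₚ.toℚᵘ-cancel-≤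
    (ℚᵘₚ.≤-respˡ-≃ (ℚᵘₚ.≃-sym (toℚᵘ-fromℕ m)) (ℚᵘₚ.≤-respʳ-≃ (ℚᵘₚ.≃-sym (toℚᵘ-fromℕ n))
      (ℚᵘ.*≤* (ℤ.*-monoʳ-≤-nonNeg ℤ.1ℤ (ℤ.+≤+ m≤n)))))

  fromℕ-pos : ∀ n .{{_ : NonZero n}} → ℚ.Positive (fromℕ n)
  fromℕ-pos n = ℚₚ.normalize-pos n 1

  /-*-cancel : ∀ a b .{{_ : NonZero b}} → ((ℤ.+ a) ℚ./ b) ℚ.* fromℕ b ≡ fromℕ a
  /-*-cancel a (suc b) = ℚₚ.toℚᵘ-injective
    (ℚᵘₚ.≃-trans (ℚₚ.toℚᵘ-homo-* ((ℤ.+ a) ℚ./ suc b) (fromℕ (suc b)))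
    (ℚᵘₚ.≃-trans (ℚᵘₚ.*-cong (ℚₚ.toℚᵘ-fromℚᵘ (ℚᵘ.mkℚᵘ (ℤ.+ a) b)) (toℚᵘ-fromℕ (suc b)))
    (ℚᵘₚ.≃-trans (ℚᵘ.*≡* identity)
    (ℚᵘₚ.≃-sym (toℚᵘ-fromℕ a)))))
    where
    identity : (ℤ.+ a ℤ.* ℤ.+ suc b) ℤ.* ℤ.+ 1 ≡ ℤ.+ a ℤ.* (ℤ.+ (suc b ℕ.* 1))
    identity = trans (ℤ.*-identityʳ _) (cong (λ n → ℤ.+ a ℤ.* ℤ.+ n) (sym (ℕₚ.*-identityʳ (suc b))))

  Q : ℕ → ℚ
  Q n = fromℕ (q ℕ.^ n)

  Q-pos : ∀ n → ℚ.Positive (Q n)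
  Q-pos n = fromℕ-pos (q ℕ.^ n) {{ℕₚ.m^n≢0 q n}}

  Q-+ : ∀ m n → Q (m ℕ.+ n) ≡ Q m ℚ.* Q n
  Q-+ m n = trans (cong fromℕ (ℕₚ.^-distribˡ-+-* q m n)) (fromℕ-* (q ℕ.^ m) (q ℕ.^ n))

  t*Q≡1 : ∀ n → t n ℚ.* Q n ≡ 1ℚ
  t*Q≡1 zero    = refl
  t*Q≡1 (suc n) = begin-equality
    t (suc n) ℚ.* Q (suc n)                          ≡⟨ cong (t (suc n) ℚ.*_) (fromℕ-* q (q ℕ.^ n)) ⟩
    p ℚ.* t n ℚ.* (fromℕ q ℚ.* Q n)                  ≡⟨ solve 4 (λ a b c d → a :* b :* (c :* d) := (a :* c) :* (b :* d)) refl p (t n) (fromℕ q) (Q n) ⟩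
    p ℚ.* fromℕ q ℚ.* (t n ℚ.* Q n)                  ≡⟨ cong₂ ℚ._*_ (/-*-cancel 1 q) (t*Q≡1 n) ⟩
    1ℚ ℚ.* 1ℚ                                        ≡⟨⟩
    1ℚ                                               ∎
    where p = (ℤ.+ 1) ℚ./ q

  *-cancelʳ-≡ : ∀ r .{{_ : ℚ.Positive r}} {x y} → x ℚ.* r ≡ y ℚ.* r → x ≡ y
  *-cancelʳ-≡ r eq = ℚₚ.≤-antisym (ℚₚ.*-cancelʳ-≤-pos r (ℚₚ.≤-reflexive eq)) (ℚₚ.*-cancelʳ-≤-pos r (ℚₚ.≤-reflexive (sym eq)))

  -- With j = N - r, the number of frames is q^(N r) times the product of 1 - q⁻ⁱ over j < i ≤ N,
  -- and this product is P_j / P_N. Passing from r to r + 1 vectors contributes q^N - q^r = q^N (1 -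
  -- q^(r-N)).
  frames-formula : ∀ {N} (f : ℕ → ℕ) → f 0 ≡ 1 →
    (∀ r → f (suc r) ℕ.+ f r ℕ.* q ℕ.^ r ≡ f r ℕ.* q ℕ.^ N) →
    ∀ r j → j ℕ.+ r ≡ N → fromℕ (f r) ℚ.* P N ≡ Q (N ℕ.* r) ℚ.* P j
  frames-formula {N} f f0 f-suc zero j refl = cong₂ ℚ._*_
    (trans (cong fromℕ f0) (cong Q (sym (ℕₚ.*-zeroʳ N)))) (cong P (ℕₚ.+-identityʳ j))
  frames-formula {N} f f0 f-suc (suc r) j refl = begin-equality
    fromℕ (f (suc r)) ℚ.* P N
      ≡⟨ solve 3 (λ x y z → x :* z := (x :+ y :- y) :* z) refl (fromℕ (f (suc r))) (fromℕ (f r) ℚ.* Q r) (P N) ⟩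
    (fromℕ (f (suc r)) ℚ.+ fromℕ (f r) ℚ.* Q r ℚ.- fromℕ (f r) ℚ.* Q r) ℚ.* P N
      ≡⟨ cong (λ x → (x ℚ.- fromℕ (f r) ℚ.* Q r) ℚ.* P N) step ⟩
    (fromℕ (f r) ℚ.* Q N ℚ.- fromℕ (f r) ℚ.* Q r) ℚ.* P N
      ≡⟨ cong (λ x → (fromℕ (f r) ℚ.* Q N ℚ.- fromℕ (f r) ℚ.* x) ℚ.* P N) Qr ⟩
    (fromℕ (f r) ℚ.* Q N ℚ.- fromℕ (f r) ℚ.* (t (suc j) ℚ.* Q N)) ℚ.* P N
      ≡⟨ solve 4 (λ a b c d → (a :* b :- a :* (c :* b)) :* d := (a :* d) :* b :* (con 1ℚ :- c)) refl
           (fromℕ (f r)) (Q N) (t (suc j)) (P N) ⟩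
    fromℕ (f r) ℚ.* P N ℚ.* Q N ℚ.* (1ℚ ℚ.- t (suc j))
      ≡⟨ cong (λ x → x ℚ.* Q N ℚ.* (1ℚ ℚ.- t (suc j))) (frames-formula f f0 f-suc r (suc j) (sym (ℕₚ.+-suc j r))) ⟩
    Q (N ℕ.* r) ℚ.* P (suc j) ℚ.* Q N ℚ.* (1ℚ ℚ.- t (suc j))
      ≡⟨ solve 4 (λ a b c d → a :* b :* c :* d := c :* a :* (b :* d)) refl (Q (N ℕ.* r)) (P (suc j)) (Q N) (1ℚ ℚ.- t (suc j)) ⟩
    Q N ℚ.* Q (N ℕ.* r) ℚ.* (P (suc j) ℚ.* (1ℚ ℚ.- t (suc j)))
      ≡⟨ cong₂ ℚ._*_ (trans (sym (Q-+ N (N ℕ.* r))) (cong Q (sym (ℕₚ.*-suc N r)))) (P-step j) ⟩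
    Q (N ℕ.* suc r) ℚ.* P j ∎
    where
    step : fromℕ (f (suc r)) ℚ.+ fromℕ (f r) ℚ.* Q r ≡ fromℕ (f r) ℚ.* Q N
    step = trans (cong (fromℕ (f (suc r)) ℚ.+_) (sym (fromℕ-* (f r) (q ℕ.^ r))))
      (trans (sym (fromℕ-+ (f (suc r)) (f r ℕ.* q ℕ.^ r)))
        (trans (cong fromℕ (f-suc r)) (fromℕ-* (f r) (q ℕ.^ N))))
    Qr : Q r ≡ t (suc j) ℚ.* Q N
    Qr = begin-equality
      Q r                                     ≡⟨ ℚₚ.*-identityˡ (Q r) ⟨
      1ℚ ℚ.* Q r                              ≡⟨ cong (ℚ._* Q r) (t*Q≡1 (suc j)) ⟨
      t (suc j) ℚ.* Q (suc j) ℚ.* Q r         ≡⟨ ℚₚ.*-assoc (t (suc j)) _ _ ⟩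
      t (suc j) ℚ.* (Q (suc j) ℚ.* Q r)       ≡⟨ cong (t (suc j) ℚ.*_) (Q-+ (suc j) r) ⟨
      t (suc j) ℚ.* Q (suc j ℕ.+ r)           ≡⟨ cong (λ n → t (suc j) ℚ.* Q n) (ℕₚ.+-suc j r) ⟨
      t (suc j) ℚ.* Q N                       ∎

  P-mono-≤ : ∀ {m n} → m ℕ.≤ n → P m ℚ.≤ P n
  P-mono-≤ {m} {n} m≤n = subst (λ i → P m ℚ.≤ P i) (ℕₚ.m∸n+n≡m m≤n) (P-mono (n ℕ.∸ m) m)

  ∣p∣≤ : ∀ {p e} → p ℚ.≤ e → ℚ.- p ℚ.≤ e → ℚ.∣ p ∣ ℚ.≤ e
  ∣p∣≤ {p} {e} p≤e -p≤e with ℚₚ.∣p∣≡p∨∣p∣≡-p p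
  ... | inj₁ eq = subst (ℚ._≤ e) (sym eq) p≤e
  ... | inj₂ eq = subst (ℚ._≤ e) (sym eq) -p≤e

  ∣x-y∣≤⇒x≤y+ : ∀ {x y e} → ℚ.∣ x ℚ.- y ∣ ℚ.≤ e → x ℚ.≤ y ℚ.+ e
  ∣x-y∣≤⇒x≤y+ {x} {y} {e} h = begin
    x                            ≡⟨ solve 2 (λ x y → x := y :+ (x :- y)) refl x y ⟩
    y ℚ.+ (x ℚ.- y)              ≤⟨ ℚₚ.+-monoʳ-≤ y (p≤∣p∣ (x ℚ.- y)) ⟩
    y ℚ.+ ℚ.∣ x ℚ.- y ∣          ≤⟨ ℚₚ.+-monoʳ-≤ y h ⟩
    y ℚ.+ e                      ∎
    where
    p≤∣p∣ : ∀ p → p ℚ.≤ ℚ.∣ p ∣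
    p≤∣p∣ p with ℚₚ.≤-total 0ℚ p
    ... | inj₁ 0≤p = ℚₚ.≤-reflexive (sym (ℚₚ.0≤p⇒∣p∣≡p 0≤p))
    ... | inj₂ p≤0 = ℚₚ.≤-trans p≤0 (ℚₚ.0≤∣p∣ p)

  x≤y+e⇒x-y≤e : ∀ {x y e} → x ℚ.≤ y ℚ.+ e → x ℚ.- y ℚ.≤ e
  x≤y+e⇒x-y≤e {x} {y} {e} h = begin
    x ℚ.- y            ≤⟨ ℚₚ.+-monoˡ-≤ (ℚ.- y) h ⟩
    y ℚ.+ e ℚ.- y      ≡⟨ solve 2 (λ y e → y :+ e :- y := e) refl y e ⟩
    e                  ∎

  ≤-+-pos : ∀ x {δ} → 0ℚ ℚ.< δ → x ℚ.≤ x ℚ.+ δ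
  ≤-+-pos x {δ} δ>0 = begin
    x            ≡⟨ ℚₚ.+-identityʳ x ⟨
    x ℚ.+ 0ℚ     ≤⟨ ℚₚ.+-monoʳ-≤ x (ℚₚ.<⇒≤ δ>0) ⟩
    x ℚ.+ δ      ∎

  -- `x` stands for P_s P_r / P_N, the value of the expectation. As `P` increases, P_s / P_N is at
  -- most 1.
  ratio≤P : ∀ s r N x → s ℕ.≤ N → x ℚ.* P N ≡ P s ℚ.* P r → x ℚ.≤ P r
  ratio≤P s r N x s≤N eq = ℚₚ.*-cancelʳ-≤-pos (P N) {{P-pos N}} (begin
    x ℚ.* P N      ≡⟨ eq ⟩
    P s ℚ.* P r    ≤⟨ ℚₚ.*-monoʳ-≤-nonNeg (P r) {{P≥0 r}} (P-mono-≤ s≤N) ⟩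
    P N ℚ.* P r    ≡⟨ ℚₚ.*-comm (P N) (P r) ⟩
    P r ℚ.* P N    ∎)

  ratio-pos : ∀ s r N x → x ℚ.* P N ≡ P s ℚ.* P r → ℚ.Positive x
  ratio-pos s r N x eq = ℚ.positive (ℚₚ.*-cancelʳ-<-nonNeg (P N) {{P≥0 N}} {0ℚ} {x} (begin-strict
    0ℚ ℚ.* P N     ≡⟨ ℚₚ.*-zeroˡ (P N) ⟩
    0ℚ             <⟨ ℚₚ.positive⁻¹ (P s ℚ.* P r) {{ℚₚ.pos*pos⇒pos (P s) {{P-pos s}} (P r) {{P-pos r}}}} ⟩
    P s ℚ.* P r    ≡⟨ eq ⟨
    x ℚ.* P N      ∎))

  -- From above, x ≤ P_r. From below, P_N ≤ P_r + ε/2 implies P_s ≤ x + ε/2, where P_s ≤ P_N absorbs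
  -- the factor in front of ε/2. Both P_r and P_s are within ε/2 of P_n.
  ∃-P-close : ∀ ε → 0ℚ ℚ.< ε → ∃[ K ] ∀ s r N x → K ℕ.≤ s → s ℕ.≤ N → K ℕ.≤ r → r ℕ.≤ N →
    x ℚ.* P N ≡ P s ℚ.* P r → ∀ n → K ℕ.≤ n → ℚ.∣ x ℚ.- P n ∣ ℚ.≤ ε
  ∃-P-close ε ε>0 = K , λ s r N x K≤s s≤N K≤r r≤N eq n K≤n →
    let K≤N = ℕₚ.≤-trans K≤s s≤N
        Ps≤x+ε₂ : P s ℚ.≤ x ℚ.+ ε₂
        Ps≤x+ε₂ = ℚₚ.*-cancelʳ-≤-pos (P N) {{P-pos N}} (begin
          P s ℚ.* P N                            ≤⟨ ℚₚ.*-monoˡ-≤-nonNeg (P s) {{P≥0 s}} (∣x-y∣≤⇒x≤y+ (close N r K≤N K≤r)) ⟩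
          P s ℚ.* (P r ℚ.+ ε₂)                   ≡⟨ ℚₚ.*-distribˡ-+ (P s) (P r) ε₂ ⟩
          P s ℚ.* P r ℚ.+ P s ℚ.* ε₂             ≡⟨ cong (ℚ._+ P s ℚ.* ε₂) eq ⟨
          x ℚ.* P N ℚ.+ P s ℚ.* ε₂               ≤⟨ ℚₚ.+-monoʳ-≤ (x ℚ.* P N) (ℚₚ.*-monoʳ-≤-nonNeg ε₂ {{ε₂≥0}} (P-mono-≤ s≤N)) ⟩
          x ℚ.* P N ℚ.+ P N ℚ.* ε₂               ≡⟨ solve 3 (λ x y e → x :* y :+ y :* e := (x :+ e) :* y) refl x (P N) ε₂ ⟩
          (x ℚ.+ ε₂) ℚ.* P N                     ∎)
    in ∣p∣≤
      (x≤y+e⇒x-y≤e (begin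
        x                    ≤⟨ ratio≤P s r N x s≤N eq ⟩
        P r                  ≤⟨ ∣x-y∣≤⇒x≤y+ (close r n K≤r K≤n) ⟩
        P n ℚ.+ ε₂           ≤⟨ ℚₚ.+-monoʳ-≤ (P n) ε₂≤ε ⟩
        P n ℚ.+ ε            ∎))
      (begin
        ℚ.- (x ℚ.- P n)      ≡⟨ solve 2 (λ x y → :- (x :- y) := y :- x) refl x (P n) ⟩
        P n ℚ.- x            ≤⟨ x≤y+e⇒x-y≤e (begin
          P n                      ≤⟨ ∣x-y∣≤⇒x≤y+ (close n s K≤n K≤s) ⟩
          P s ℚ.+ ε₂               ≤⟨ ℚₚ.+-monoˡ-≤ ε₂ Ps≤x+ε₂ ⟩
          x ℚ.+ ε₂ ℚ.+ ε₂          ≡⟨ solve 2 (λ x e → x :+ con ½ :* e :+ con ½ :* e := x :+ e) refl x ε ⟩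
          x ℚ.+ ε                  ∎) ⟩
        ε                    ∎)
    where
    ε₂ = ½ ℚ.* ε
    instance
      ε-pos = ℚ.positive ε>0
      ε₂-pos = ℚₚ.pos*pos⇒pos ½ ε
    ε₂≥0 : ℚ.NonNegative ε₂
    ε₂≥0 = ℚₚ.pos⇒nonNeg ε₂
    ε₂≤ε : ε₂ ℚ.≤ ε
    ε₂≤ε = begin
      ε₂                 ≤⟨ ≤-+-pos ε₂ (ℚₚ.positive⁻¹ ε₂) ⟩
      ε₂ ℚ.+ ε₂          ≡⟨ solve 1 (λ e → con ½ :* e :+ con ½ :* e := e) refl ε ⟩
      ε                  ∎
    K = proj₁ (P-cauchy ε₂ (ℚₚ.positive⁻¹ ε₂))
    close = proj₂ (P-cauchy ε₂ (ℚₚ.positive⁻¹ ε₂))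

  -- The partial products of positive index are bounded by 4, and j q⁻ʲ ≤ 1 weakens the geometric
  -- decay to 1/j, for which the Archimedean property suffices.
  t*P-small : ∀ ε → 0ℚ ℚ.< ε → ∃[ J ] ∀ j n → J ℕ.≤ j → t j ℚ.* P (suc n) ℚ.≤ ε
  t*P-small ε ε>0 = suc b , λ j n b<j → begin
    t j ℚ.* P (suc n)
      ≤⟨ ℚₚ.*-monoˡ-≤-nonNeg (t j) {{t≥0 j}} (P-suc≤4 n) ⟩
    t j ℚ.* 4ℚ
      ≡⟨ ℚₚ.*-identityʳ _ ⟨
    t j ℚ.* 4ℚ ℚ.* 1ℚ
      ≤⟨ ℚₚ.*-monoˡ-≤-nonNeg (t j ℚ.* 4ℚ) {{ℚₚ.nonNeg*nonNeg⇒nonNeg (t j) {{t≥0 j}} 4ℚ}} (ℚₚ.≤-trans 1≤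
           (ℚₚ.*-monoʳ-≤-nonNeg (ε ℚ.* ¼) {{ℚₚ.pos⇒nonNeg (ε ℚ.* ¼)}} (fromℕ-mono-≤ b<j))) ⟩
    t j ℚ.* 4ℚ ℚ.* (fromℕ j ℚ.* (ε ℚ.* ¼))
      ≡⟨ solve 3 (λ x f e → x :* con 4ℚ :* (f :* (e :* con ¼)) := f :* x :* e) refl (t j) (fromℕ j) ε ⟩
    fromℕ j ℚ.* t j ℚ.* ε
      ≤⟨ ℚₚ.*-monoʳ-≤-nonNeg ε {{ℚₚ.pos⇒nonNeg ε}} (n*t≤1 j) ⟩
    1ℚ ℚ.* ε
      ≡⟨ ℚₚ.*-identityˡ ε ⟩
    ε ∎
    where
    4ℚ = (ℤ.+ 4) ℚ./ 1
    ¼ = (ℤ.+ 1) ℚ./ 4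
    instance
      ε-pos = ℚ.positive ε>0
      ε¼-pos = ℚₚ.pos*pos⇒pos ε ¼
    arch = archimedean (ε ℚ.* ¼) (ℚₚ.positive⁻¹ (ε ℚ.* ¼))
    b = proj₁ arch
    1≤ = proj₂ arch

  ≤-1/-cross : ∀ a b c d .{{_ : ℚ.NonZero c}} .{{_ : ℚ.NonZero d}} → ℚ.Positive c → ℚ.Positive d →
    a ℚ.* d ℚ.≤ b ℚ.* c → a ℚ.* ℚ.1/ c ℚ.≤ b ℚ.÷ d
  ≤-1/-cross a b c d c>0 d>0 ad≤bc = ℚₚ.*-cancelʳ-≤-pos (c ℚ.* d) {{ℚₚ.pos*pos⇒pos c {{c>0}} d {{d>0}}}} (begin
    a ℚ.* ℚ.1/ c ℚ.* (c ℚ.* d)      ≡⟨ solve 4 (λ a c′ c d → a :* c′ :* (c :* d) := a :* d :* (c′ :* c)) refl a (ℚ.1/ c) c d ⟩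
    a ℚ.* d ℚ.* (ℚ.1/ c ℚ.* c)      ≡⟨ trans (cong (a ℚ.* d ℚ.*_) (ℚₚ.*-inverseˡ c)) (ℚₚ.*-identityʳ _) ⟩
    a ℚ.* d                         ≤⟨ ad≤bc ⟩
    b ℚ.* c                         ≡⟨ trans (cong (b ℚ.* c ℚ.*_) (ℚₚ.*-inverseˡ d)) (ℚₚ.*-identityʳ _) ⟨
    b ℚ.* c ℚ.* (ℚ.1/ d ℚ.* d)      ≡⟨ solve 4 (λ b d′ c d → b :* c :* (d′ :* d) := b :* d′ :* (c :* d)) refl b (ℚ.1/ d) c d ⟩
    b ℚ.* ℚ.1/ d ℚ.* (c ℚ.* d)      ∎)

  -- Here `e` is the expectation, `T` the number of forms, `gl` = a / P_r the order of GL_r, `f` = c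
  -- P_s / P_N the number of frames and `b` the cost of isotropy. The hypothesis `a * b ≡ c` is the
  -- cancellation of the powers of q, after which only partial products remain.
  first-moment-value : ∀ e T gl f a b c pN ps pr → ℚ.Positive T → ℚ.Positive c →
    gl ℚ.* pr ≡ a → f ℚ.* pN ≡ c ℚ.* ps → a ℚ.* b ≡ c →
    e ℚ.* T ℚ.* gl ℚ.* b ≡ f ℚ.* T → e ℚ.* pN ≡ ps ℚ.* pr
  first-moment-value e T gl f a b c pN ps pr T>0 c>0 gl-eq f-eq ab≡c moment =
    *-cancelʳ-≡ c {{c>0}} (*-cancelʳ-≡ T {{T>0}} (begin-equality
      e ℚ.* pN ℚ.* c ℚ.* T
        ≡⟨ cong (λ x → e ℚ.* pN ℚ.* x ℚ.* T) (trans (cong (ℚ._* b) gl-eq) ab≡c) ⟨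
      e ℚ.* pN ℚ.* (gl ℚ.* pr ℚ.* b) ℚ.* T
        ≡⟨ solve 6 (λ e pN gl pr b T → e :* pN :* (gl :* pr :* b) :* T := e :* T :* gl :* b :* (pN :* pr)) refl e pN gl pr b T ⟩
      e ℚ.* T ℚ.* gl ℚ.* b ℚ.* (pN ℚ.* pr)
        ≡⟨ cong (ℚ._* (pN ℚ.* pr)) moment ⟩
      f ℚ.* T ℚ.* (pN ℚ.* pr)
        ≡⟨ solve 4 (λ f T pN pr → f :* T :* (pN :* pr) := f :* pN :* (pr :* T)) refl f T pN pr ⟩
      f ℚ.* pN ℚ.* (pr ℚ.* T)
        ≡⟨ cong (ℚ._* (pr ℚ.* T)) f-eq ⟩
      c ℚ.* ps ℚ.* (pr ℚ.* T)
        ≡⟨ solve 4 (λ c ps pr T → c :* ps :* (pr :* T) := ps :* pr :* c :* T) refl c ps pr T ⟩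
      ps ℚ.* pr ℚ.* c ℚ.* T ∎))

  -- The same computation when the powers of q leave an excess `d`; its inverse `u` is the
  -- exponentially small factor, and the quotient `pj / pN` is bounded by 1.
  first-moment-ratio : ∀ e T gl f a b c d u pN pk pj → ℚ.Positive T → ℚ.Positive c → ℚ.Positive d → ℚ.Positive pN → ℚ.NonNegative pk →
    gl ℚ.* pk ≡ a → f ℚ.* pN ≡ c ℚ.* pj → a ℚ.* b ≡ c ℚ.* d → u ℚ.* d ≡ 1ℚ → pj ℚ.≤ pN →
    gl ℚ.* (e ℚ.* T) ℚ.* b ℚ.≤ f ℚ.* T → e ℚ.≤ u ℚ.* pk
  first-moment-ratio e T gl f a b c d u pN pk pj T>0 c>0 d>0 pN>0 pk≥0 gl-eq f-eq ab≡cd ud≡1 pj≤pN moment =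
    ℚₚ.*-cancelʳ-≤-pos D {{D>0}} (begin
      e ℚ.* D
        ≡⟨ solve 5 (λ e c d pN T → e :* (c :* d :* pN :* T) := e :* T :* (c :* d) :* pN) refl e c d pN T ⟩
      e ℚ.* T ℚ.* (c ℚ.* d) ℚ.* pN
        ≡⟨ cong (λ x → e ℚ.* T ℚ.* x ℚ.* pN) (trans (cong (ℚ._* b) gl-eq) ab≡cd) ⟨
      e ℚ.* T ℚ.* (gl ℚ.* pk ℚ.* b) ℚ.* pN
        ≡⟨ solve 6 (λ e T gl pk b pN → e :* T :* (gl :* pk :* b) :* pN := gl :* (e :* T) :* b :* (pN :* pk)) refl e T gl pk b pN ⟩
      gl ℚ.* (e ℚ.* T) ℚ.* b ℚ.* (pN ℚ.* pk)
        ≤⟨ ℚₚ.*-monoʳ-≤-nonNeg (pN ℚ.* pk) {{ℚₚ.nonNeg*nonNeg⇒nonNeg pN {{ℚₚ.pos⇒nonNeg pN {{pN>0}}}} pk {{pk≥0}}}} moment ⟩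
      f ℚ.* T ℚ.* (pN ℚ.* pk)
        ≡⟨ solve 4 (λ f T pN pk → f :* T :* (pN :* pk) := f :* pN :* (pk :* T)) refl f T pN pk ⟩
      f ℚ.* pN ℚ.* (pk ℚ.* T)
        ≡⟨ cong (ℚ._* (pk ℚ.* T)) f-eq ⟩
      c ℚ.* pj ℚ.* (pk ℚ.* T)
        ≤⟨ ℚₚ.*-monoʳ-≤-nonNeg (pk ℚ.* T) {{ℚₚ.nonNeg*nonNeg⇒nonNeg pk {{pk≥0}} T {{ℚₚ.pos⇒nonNeg T {{T>0}}}}}}
             (ℚₚ.*-monoˡ-≤-nonNeg c {{ℚₚ.pos⇒nonNeg c {{c>0}}}} pj≤pN) ⟩
      c ℚ.* pN ℚ.* (pk ℚ.* T)
        ≡⟨ trans (cong (ℚ._* (c ℚ.* pN ℚ.* (pk ℚ.* T))) ud≡1) (ℚₚ.*-identityˡ _) ⟨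
      u ℚ.* d ℚ.* (c ℚ.* pN ℚ.* (pk ℚ.* T))
        ≡⟨ solve 6 (λ u d c pN pk T → u :* d :* (c :* pN :* (pk :* T)) := u :* pk :* (c :* d :* pN :* T)) refl u d c pN pk T ⟩
      u ℚ.* pk ℚ.* D ∎)
    where
    D = c ℚ.* d ℚ.* pN ℚ.* T
    D>0 : ℚ.Positive D
    D>0 = ℚₚ.pos*pos⇒pos (c ℚ.* d ℚ.* pN) {{ℚₚ.pos*pos⇒pos (c ℚ.* d) {{ℚₚ.pos*pos⇒pos c {{c>0}} d {{d>0}}}} pN {{pN>0}}}} T {{T>0}}

  moment-≤ : ∀ gl c T .{{_ : NonZero T}} b f → gl ℕ.* c ℕ.* b ℕ.≤ f ℕ.* T →
    fromℕ gl ℚ.* ((ℤ.+ c) ℚ./ T ℚ.* fromℕ T) ℚ.* fromℕ b ℚ.≤ fromℕ f ℚ.* fromℕ T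
  moment-≤ gl c T b f h = begin
    fromℕ gl ℚ.* ((ℤ.+ c) ℚ./ T ℚ.* fromℕ T) ℚ.* fromℕ b   ≡⟨ cong (λ x → fromℕ gl ℚ.* x ℚ.* fromℕ b) (/-*-cancel c T) ⟩
    fromℕ gl ℚ.* fromℕ c ℚ.* fromℕ b                       ≡⟨ cong (ℚ._* fromℕ b) (fromℕ-* gl c) ⟨
    fromℕ (gl ℕ.* c) ℚ.* fromℕ b                           ≡⟨ fromℕ-* (gl ℕ.* c) b ⟨
    fromℕ (gl ℕ.* c ℕ.* b)                                 ≤⟨ fromℕ-mono-≤ h ⟩
    fromℕ (f ℕ.* T)                                        ≡⟨ fromℕ-* f T ⟩
    fromℕ f ℚ.* fromℕ T                                    ∎

  moment-≡ : ∀ c T .{{_ : NonZero T}} gl b f → c ℕ.* gl ℕ.* b ≡ f ℕ.* T →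
    (ℤ.+ c) ℚ./ T ℚ.* fromℕ T ℚ.* fromℕ gl ℚ.* fromℕ b ≡ fromℕ f ℚ.* fromℕ T
  moment-≡ c T gl b f h = begin-equality
    (ℤ.+ c) ℚ./ T ℚ.* fromℕ T ℚ.* fromℕ gl ℚ.* fromℕ b     ≡⟨ cong (λ x → x ℚ.* fromℕ gl ℚ.* fromℕ b) (/-*-cancel c T) ⟩
    fromℕ c ℚ.* fromℕ gl ℚ.* fromℕ b                       ≡⟨ cong (ℚ._* fromℕ b) (fromℕ-* c gl) ⟨
    fromℕ (c ℕ.* gl) ℚ.* fromℕ b                           ≡⟨ fromℕ-* (c ℕ.* gl) b ⟨
    fromℕ (c ℕ.* gl ℕ.* b)                                 ≡⟨ cong fromℕ h ⟩
    fromℕ (f ℕ.* T)                                        ≡⟨ fromℕ-* f T ⟩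
    fromℕ f ℚ.* fromℕ T                                    ∎

  /-mono-≤ : ∀ a b T .{{_ : NonZero T}} → a ℕ.≤ b → (ℤ.+ a) ℚ./ T ℚ.≤ (ℤ.+ b) ℚ./ T
  /-mono-≤ a b T a≤b = ℚₚ.*-cancelʳ-≤-pos (fromℕ T) {{fromℕ-pos T}}
    (subst₂ ℚ._≤_ (sym (/-*-cancel a T)) (sym (/-*-cancel b T)) (fromℕ-mono-≤ a≤b))

  *-/-mono-≤ : ∀ n a b T .{{_ : NonZero T}} → n ℕ.* a ℕ.≤ b → fromℕ n ℚ.* ((ℤ.+ a) ℚ./ T) ℚ.≤ (ℤ.+ b) ℚ./ T
  *-/-mono-≤ n a b T na≤b = ℚₚ.*-cancelʳ-≤-pos (fromℕ T) {{fromℕ-pos T}} (begin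
    fromℕ n ℚ.* ((ℤ.+ a) ℚ./ T) ℚ.* fromℕ T      ≡⟨ ℚₚ.*-assoc (fromℕ n) _ _ ⟩
    fromℕ n ℚ.* ((ℤ.+ a) ℚ./ T ℚ.* fromℕ T)      ≡⟨ cong (fromℕ n ℚ.*_) (/-*-cancel a T) ⟩
    fromℕ n ℚ.* fromℕ a                          ≡⟨ fromℕ-* n a ⟨
    fromℕ (n ℕ.* a)                              ≤⟨ fromℕ-mono-≤ na≤b ⟩
    fromℕ b                                      ≡⟨ /-*-cancel b T ⟨
    (ℤ.+ b) ℚ./ T ℚ.* fromℕ T                    ∎)

  ∣x-0∣≤ : ∀ {x ε δ} → 0ℚ ℚ.≤ x → x ℚ.≤ ε → 0ℚ ℚ.< δ → ℚ.∣ x ℚ.- 0ℚ ∣ ℚ.≤ ε ℚ.+ δ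
  ∣x-0∣≤ {x} {ε} {δ} 0≤x x≤ε δ>0 = begin
    ℚ.∣ x ℚ.- 0ℚ ∣   ≡⟨ cong ℚ.∣_∣ (ℚₚ.+-identityʳ x) ⟩
    ℚ.∣ x ∣          ≡⟨ ℚₚ.0≤p⇒∣p∣≡p 0≤x ⟩
    x                ≤⟨ x≤ε ⟩
    ε                ≤⟨ ≤-+-pos ε δ>0 ⟩
    ε ℚ.+ δ          ∎

  second-moment-ratio : ∀ a x y c .{{_ : ℚ.NonZero c}} .{{_ : ℚ.NonZero (x ℚ.* x)}} →
    ℚ.Positive c → ℚ.Positive x → ℚ.NonNegative y →
    a ℚ.* x ℚ.≤ y → x ℚ.≤ c → a ℚ.* ℚ.1/ c ℚ.≤ y ℚ.÷ (x ℚ.* x)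
  second-moment-ratio a x y c c>0 x>0 y≥0 ax≤y x≤c = ≤-1/-cross a y c (x ℚ.* x) c>0 (ℚₚ.pos*pos⇒pos x {{x>0}} x {{x>0}}) (begin
    a ℚ.* (x ℚ.* x)    ≡⟨ ℚₚ.*-assoc a x x ⟨
    a ℚ.* x ℚ.* x      ≤⟨ ℚₚ.*-monoʳ-≤-nonNeg x {{ℚₚ.pos⇒nonNeg x {{x>0}}}} ax≤y ⟩
    y ℚ.* x            ≤⟨ ℚₚ.*-monoˡ-≤-nonNeg y {{y≥0}} x≤c ⟩
    y ℚ.* c            ∎)

-- Exponents and limits

module Exponents {q : ℕ} .{{_ : NonTrivial q}} (F : FiniteField q) where
  open SecondMoment F

  -- The number of pairs is k(k-1)/2 + k j; doubling it and adding `k` avoids both the half and the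
  -- subtraction.
  2*#pairs : ∀ k j → 2 ℕ.* #pairs k (k ℕ.+ j) ℕ.+ k ≡ k ℕ.* (k ℕ.+ 2 ℕ.* j)
  2*#pairs zero    j = refl
  2*#pairs (suc k) j = trans (identity₁ k j (#pairs k (k ℕ.+ j)))
    (trans (cong (ℕ._+ (2 ℕ.* (k ℕ.+ j) ℕ.+ 1)) (2*#pairs k j)) (identity₂ k j))
    where
    identity₁ : ∀ k j x → 2 ℕ.* (k ℕ.+ j ℕ.+ x) ℕ.+ suc k ≡ 2 ℕ.* x ℕ.+ k ℕ.+ (2 ℕ.* (k ℕ.+ j) ℕ.+ 1)
    identity₁ = solve-∀
    identity₂ : ∀ k j → k ℕ.* (k ℕ.+ 2 ℕ.* j) ℕ.+ (2 ℕ.* (k ℕ.+ j) ℕ.+ 1) ≡ suc k ℕ.* (suc k ℕ.+ 2 ℕ.* j)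
    identity₂ = solve-∀

  2*#pairs-all : ∀ n → 2 ℕ.* #pairs (suc n) (suc n) ≡ suc n ℕ.* n
  2*#pairs-all n = ℕₚ.+-cancelʳ-≡ (suc n) _ _ (trans
    (cong (λ m → 2 ℕ.* #pairs (suc n) m ℕ.+ suc n) (sym (ℕₚ.+-identityʳ (suc n))))
    (trans (2*#pairs (suc n) 0) (identity n)))
    where
    identity : ∀ n → suc n ℕ.* (suc n ℕ.+ 2 ℕ.* 0) ≡ suc n ℕ.* n ℕ.+ suc n
    identity = solve-∀

  -- (r² - 1) / 8 for r = 2 s + 1
  triangular : ℕ → ℕ
  triangular s = #pairs (suc s) (suc s)

  triangular≡ : ∀ s → (suc (s ℕ.* 2) ℕ.^ 2 ℕ.∸ 1) ℕ./ 8 ≡ triangular s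
  triangular≡ s = trans (cong (λ n → (n ℕ.∸ 1) ℕ./ 8) square) (ℕ.m*n/n≡m (triangular s) 8)
    where
    expand : ∀ s → suc (s ℕ.* 2) ℕ.* (suc (s ℕ.* 2) ℕ.* 1) ≡ suc (4 ℕ.* (suc s ℕ.* s))
    expand = solve-∀
    regroup : ∀ x → 4 ℕ.* (2 ℕ.* x) ≡ x ℕ.* 8
    regroup = solve-∀
    square : suc (s ℕ.* 2) ℕ.^ 2 ≡ suc (triangular s ℕ.* 8)
    square = trans (expand s) (cong suc (trans (cong (4 ℕ.*_) (sym (2*#pairs-all s))) (regroup (triangular s))))

  s≤triangular : ∀ s → s ℕ.≤ triangular s
  s≤triangular s = ℕₚ.m≤m+n s (#pairs s s)

  #pairs-2s+1 : ∀ s → #pairs (suc (s ℕ.* 2)) (suc (s ℕ.* 2)) ≡ suc (s ℕ.* 2) ℕ.* s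
  #pairs-2s+1 s = ℕₚ.*-cancelˡ-≡ _ _ 2 (trans (2*#pairs-all (s ℕ.* 2)) (identity s))
    where
    identity : ∀ s → suc (s ℕ.* 2) ℕ.* (s ℕ.* 2) ≡ 2 ℕ.* (suc (s ℕ.* 2) ℕ.* s)
    identity = solve-∀

  -- With k = s + 1 and N = 3 s + 1, the k-dimensional subspaces form a family of dimension k(N -
  -- k), which falls short of the number of conditions for lying in the radical by s(s+1)/2.
  #pairs-radical : ∀ s → suc s ℕ.* suc s ℕ.+ #pairs (suc s) (s ℕ.+ (s ℕ.+ suc s)) ≡
    (s ℕ.+ (s ℕ.+ suc s)) ℕ.* suc s ℕ.+ triangular s
  #pairs-radical s = ℕₚ.*-cancelˡ-≡ _ _ 2 (ℕₚ.+-cancelʳ-≡ (suc s) _ _ (trans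
    (cong (λ n → 2 ℕ.* (suc s ℕ.* suc s ℕ.+ #pairs (suc s) n) ℕ.+ suc s) (reorder s))
    (trans (identity₁ s (#pairs (suc s) (suc s ℕ.+ (s ℕ.+ s))))
      (trans (cong (2 ℕ.* (suc s ℕ.* suc s) ℕ.+_) (2*#pairs (suc s) (s ℕ.+ s)))
        (trans (identity₂ s) (trans (cong (λ x → 2 ℕ.* ((s ℕ.+ (s ℕ.+ suc s)) ℕ.* suc s) ℕ.+ x ℕ.+ suc s) (sym (2*#pairs-all s)))
          (identity₃ s (triangular s))))))))
    where
    reorder : ∀ s → s ℕ.+ (s ℕ.+ suc s) ≡ suc s ℕ.+ (s ℕ.+ s)
    reorder = solve-∀
    identity₁ : ∀ s x → 2 ℕ.* (suc s ℕ.* suc s ℕ.+ x) ℕ.+ suc s ≡ 2 ℕ.* (suc s ℕ.* suc s) ℕ.+ (2 ℕ.* x ℕ.+ suc s)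
    identity₁ = solve-∀
    identity₂ : ∀ s → 2 ℕ.* (suc s ℕ.* suc s) ℕ.+ suc s ℕ.* (suc s ℕ.+ 2 ℕ.* (s ℕ.+ s)) ≡
      2 ℕ.* ((s ℕ.+ (s ℕ.+ suc s)) ℕ.* suc s) ℕ.+ suc s ℕ.* s ℕ.+ suc s
    identity₂ = solve-∀
    identity₃ : ∀ s x → 2 ℕ.* ((s ℕ.+ (s ℕ.+ suc s)) ℕ.* suc s) ℕ.+ 2 ℕ.* x ℕ.+ suc s ≡
      2 ℕ.* ((s ℕ.+ (s ℕ.+ suc s)) ℕ.* suc s ℕ.+ x) ℕ.+ suc s
    identity₃ = solve-∀

  odd⇒2s+1 : ∀ r → Odd r → r ≡ suc ((r ℕ./ 2) ℕ.* 2)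
  odd⇒2s+1 r odd = trans (ℕ.m≡m%n+[m/n]*n r 2) (cong (ℕ._+ (r ℕ./ 2) ℕ.* 2) odd)

  dimension≡ : ∀ s → (3 ℕ.* suc (s ℕ.* 2) ℕ.∸ 1) ℕ./ 2 ≡ s ℕ.+ suc (s ℕ.* 2)
  dimension≡ s = trans (cong (λ n → (n ℕ.∸ 1) ℕ./ 2) (identity s)) (ℕ.m*n/n≡m (s ℕ.+ suc (s ℕ.* 2)) 2)
    where
    identity : ∀ s → 3 ℕ.* suc (s ℕ.* 2) ≡ suc ((s ℕ.+ suc (s ℕ.* 2)) ℕ.* 2)
    identity = solve-∀

-- Values of the moments and passage to the limit

module Moments {q : ℕ} .{{_ : NonTrivial q}} (F : FiniteField q) where
  open SecondMoment F
  open Exponents F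
  open RationalLimits q
  open EulerProduct q using (P; t; P-pos; P≥0; t≥0; C)
  open ℚₚ.≤-Reasoning

  #frames-formula : ∀ {N} r j → j ℕ.+ r ≡ N → fromℕ (#frames N r) ℚ.* P N ≡ Q (N ℕ.* r) ℚ.* P j
  #frames-formula {N} = frames-formula (#frames N) (#frames-zero N) (#frames-suc N)

  #GL-formula : ∀ r → fromℕ (#frames r r) ℚ.* P r ≡ Q (r ℕ.* r)
  #GL-formula r = trans (#frames-formula r 0 refl) (ℚₚ.*-identityʳ _)

  #hom-pos : ∀ N m → ℚ.Positive (fromℕ (#hom N m))
  #hom-pos N m = fromℕ-pos (#hom N m) {{hom-Λ²-nonEmpty N m}}

  -- The second hypothesis balances the dimension r s of the family of r-dimensional subspaces
  -- against m conditions per pair. It is met by m = 1, r = 2 s + 1 and by m = 2, r = s + 1.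
  𝔼X-formula : ∀ {m r s N} → N ≡ s ℕ.+ r → m ℕ.* #pairs r r ≡ r ℕ.* s → 𝔼 N m (X r) ℚ.* P N ≡ P s ℚ.* P r
  𝔼X-formula {m} {r} {s} {N} N≡ exponent = first-moment-value
    E T gl (fromℕ (#frames N r)) (Q (r ℕ.* r)) Qm (Q (N ℕ.* r)) (P N) (P s) (P r)
    (#hom-pos N m) (Q-pos (N ℕ.* r)) (#GL-formula r) (#frames-formula r s (sym N≡))
    (trans (sym (Q-+ (r ℕ.* r) (m ℕ.* #pairs r r))) (cong Q (sym exponents))) moment
    where
    E = 𝔼 N m (X r)
    T = fromℕ (#hom N m)
    gl = fromℕ (#frames r r)
    Qm = Q (m ℕ.* #pairs r r)
    exponents : N ℕ.* r ≡ r ℕ.* r ℕ.+ m ℕ.* #pairs r r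
    exponents = trans (cong (ℕ._* r) N≡) (trans (identity r s) (cong (r ℕ.* r ℕ.+_) (sym exponent)))
      where
      identity : ∀ r s → (s ℕ.+ r) ℕ.* r ≡ r ℕ.* r ℕ.+ r ℕ.* s
      identity = solve-∀
    moment : E ℚ.* T ℚ.* gl ℚ.* Qm ≡ fromℕ (#frames N r) ℚ.* T
    moment = moment-≡ (∑ˡ (hom-Λ² N m) (X r)) (#hom N m) {{hom-Λ²-nonEmpty N m}} (#frames r r) (q ℕ.^ (m ℕ.* #pairs r r)) (#frames N r)
      (subst (λ x → ∑ˡ (hom-Λ² N m) (X r) ℕ.* #frames r r ℕ.* x ≡ #frames N r ℕ.* #hom N m)
        (ℕₚ.^-*-assoc q m (#pairs r r)) (first-moment N m r))

  ℙX>0-moment : ∀ s k N → s ℕ.+ (s ℕ.+ k) ≡ N →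
    fromℕ (#frames k k) ℚ.* (ℙ N 1 (λ B → 0 ℕₚ.<? X (s ℕ.+ k) B) ℚ.* fromℕ (#hom N 1)) ℚ.* Q (#pairs k N) ℚ.≤
      fromℕ (#frames N k) ℚ.* fromℕ (#hom N 1)
  ℙX>0-moment s k N N≡ = moment-≤ (#frames k k) (length (List.filter (λ B → 0 ℕₚ.<? X (s ℕ.+ k) B) (hom-Λ² N 1)))
    (#hom N 1) {{hom-Λ²-nonEmpty N 1}} (q ℕ.^ #pairs k N) (#frames N k)
    (subst (λ x → #frames k k ℕ.* length (List.filter (λ B → 0 ℕₚ.<? X (s ℕ.+ k) B) (hom-Λ² N 1)) ℕ.* x ℕ.≤ #frames N k ℕ.* #hom N 1)
      (cong (ℕ._^ #pairs k N) (ℕₚ.^-identityʳ q)) (#positive-≤ {s} {k} {N} N≡))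

  ℙX>0≤ : ∀ s k N → k ≡ suc s → s ℕ.+ (s ℕ.+ k) ≡ N →
    ℙ N 1 (λ B → 0 ℕₚ.<? X (s ℕ.+ k) B) ℚ.≤ t (triangular s) ℚ.* P k
  ℙX>0≤ s k N k≡ N≡ = first-moment-ratio
    (ℙ N 1 (λ B → 0 ℕₚ.<? X (s ℕ.+ k) B)) (fromℕ (#hom N 1)) (fromℕ (#frames k k)) (fromℕ (#frames N k))
    (Q (k ℕ.* k)) (Q (#pairs k N)) (Q (N ℕ.* k)) (Q (triangular s)) (t (triangular s)) (P N) (P k) (P (s ℕ.+ s))
    (#hom-pos N 1) (Q-pos (N ℕ.* k)) (Q-pos (triangular s)) (P-pos N) (P≥0 k)
    (#GL-formula k) (#frames-formula k (s ℕ.+ s) 2s+k≡N)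
    (trans (sym (Q-+ (k ℕ.* k) (#pairs k N))) (trans (cong Q (exponents k N k≡ N≡)) (Q-+ (N ℕ.* k) (triangular s))))
    (t*Q≡1 (triangular s)) (P-mono-≤ (ℕₚ.≤-trans (ℕₚ.m≤m+n (s ℕ.+ s) k) (ℕₚ.≤-reflexive 2s+k≡N))) (ℙX>0-moment s k N N≡)
    where
    2s+k≡N : s ℕ.+ s ℕ.+ k ≡ N
    2s+k≡N = trans (ℕₚ.+-assoc s s k) N≡
    exponents : ∀ k N → k ≡ suc s → s ℕ.+ (s ℕ.+ k) ≡ N → k ℕ.* k ℕ.+ #pairs k N ≡ N ℕ.* k ℕ.+ triangular s
    exponents _ _ refl refl = #pairs-radical s

  probability-mono : ∀ N m {p₁ p₂} {P₁ : Pred (Bilinear N m) p₁} {P₂ : Pred (Bilinear N m) p₂} (P₁? : Decidable P₁) (P₂? : Decidable P₂) →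
    (∀ B → P₁ B → P₂ B) → ℙ N m P₁? ℚ.≤ ℙ N m P₂?
  probability-mono N m P₁? P₂? P₁⇒P₂ = /-mono-≤
    (length (List.filter P₁? (hom-Λ² N m))) (length (List.filter P₂? (hom-Λ² N m))) (#hom N m) {{hom-Λ²-nonEmpty N m}}
    (subst₂ ℕ._≤_ (sym (length-filter P₁? (hom-Λ² N m))) (sym (length-filter P₂? (hom-Λ² N m)))
      (∑ˡ-mono (hom-Λ² N m) λ B → 𝟙-mono (P₁? B) (P₂? B) (P₁⇒P₂ B)))

  0≤probability : ∀ N m {p} {P : Pred (Bilinear N m) p} (P? : Decidable P) → 0ℚ ℚ.≤ ℙ N m P?
  0≤probability N m P? = ℚₚ.nonNegative⁻¹ (ℙ N m P?)
    {{ℚₚ.normalize-nonNeg (length (List.filter P? (hom-Λ² N m))) (#hom N m) {{hom-Λ²-nonEmpty N m}}}}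

  -- X² = X + X(X - 1), so the total of X cancels once from both sides of `second-moment` and the
  -- factor r = n + 1 drops to n.
  second-moment-bound : ∀ N n → suc N ≡ suc n ℕ.+ suc n →
    fromℕ n ℚ.* 𝔼 N 2 (X (suc n)) ℚ.≤ 𝔼 N 2 (λ B → X (suc n) B ℕ.* (X (suc n) B ℕ.∸ 1))
  second-moment-bound N n N+1≡2r = *-/-mono-≤ n (∑ˡ H (X r)) (∑ˡ H (λ B → X r B ℕ.* (X r B ℕ.∸ 1))) (#hom N 2) {{hom-Λ²-nonEmpty N 2}}
    (ℕₚ.+-cancelˡ-≤ (∑ˡ H (X r)) (n ℕ.* ∑ˡ H (X r)) (∑ˡ H (λ B → X r B ℕ.* (X r B ℕ.∸ 1)))
      (ℕₚ.≤-trans (second-moment {N} {r} N+1≡2r)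
        (ℕₚ.≤-reflexive (trans (∑ˡ-cong H λ B → square (X r B)) (∑ˡ-+ H (X r) (λ B → X r B ℕ.* (X r B ℕ.∸ 1)))))))
    where
    r = suc n
    H = hom-Λ² N 2
    square : ∀ x → x ℕ.* x ≡ x ℕ.+ x ℕ.* (x ℕ.∸ 1)
    square zero    = refl
    square (suc x) = ℕₚ.*-suc (suc x) x

  dim : ℕ → ℕ
  dim r = (3 ℕ.* r ℕ.∸ 1) ℕ./ 2

  exponent : ℕ → ℕ
  exponent r = (r ℕ.^ 2 ℕ.∸ 1) ℕ./ 8

  module _ (r : ℕ) (odd : Odd r) where

    private
      s = r ℕ./ 2
      r≡ : r ≡ suc (s ℕ.* 2)
      r≡ = odd⇒2s+1 r odd

    dim-odd : dim r ≡ s ℕ.+ r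
    dim-odd = subst (λ x → dim x ≡ s ℕ.+ x) (sym r≡) (dimension≡ s)

    exponent-odd : exponent r ≡ triangular s
    exponent-odd = subst (λ x → exponent x ≡ triangular s) (sym r≡) (triangular≡ s)

    𝔼X-odd : 𝔼 (dim r) 1 (X r) ℚ.* P (dim r) ≡ P s ℚ.* P r
    𝔼X-odd = 𝔼X-formula {1} {r} {s} {dim r} dim-odd
      (trans (ℕₚ.*-identityˡ (#pairs r r)) (subst (λ x → #pairs x x ≡ x ℕ.* s) (sym r≡) (#pairs-2s+1 s)))

    ℙX>0-odd : ℙ (dim r) 1 (λ B → 0 ℕₚ.<? X r B) ℚ.≤ t (exponent r) ℚ.* P (suc s)
    ℙX>0-odd = transport r (dim r) (suc s) (exponent r) refl r≡s+k (sym dim-odd) exponent-odd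
      where
      r≡s+k : r ≡ s ℕ.+ suc s
      r≡s+k = trans r≡ (identity s)
        where
        identity : ∀ s → suc (s ℕ.* 2) ≡ s ℕ.+ suc s
        identity = solve-∀
      transport : ∀ r N k e → k ≡ suc s → r ≡ s ℕ.+ k → s ℕ.+ r ≡ N → e ≡ triangular s →
        ℙ N 1 (λ B → 0 ℕₚ.<? X r B) ℚ.≤ t e ℚ.* P k
      transport r N k e k≡ refl N≡ refl = ℙX>0≤ s k N k≡ N≡

    s≤exponent : s ℕ.≤ exponent r
    s≤exponent = ℕₚ.≤-trans (s≤triangular s) (ℕₚ.≤-reflexive (sym exponent-odd))

    s≤dim : s ℕ.≤ dim r
    s≤dim = ℕₚ.≤-trans (ℕₚ.m≤m+n s r) (ℕₚ.≤-reflexive (sym dim-odd))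

    r≤dim : r ℕ.≤ dim r
    r≤dim = ℕₚ.≤-trans (ℕₚ.m≤n+m r s) (ℕₚ.≤-reflexive (sym dim-odd))

  half-large : ∀ K r → suc (K ℕ.* 2) ℕ.≤ r → K ℕ.≤ r ℕ./ 2
  half-large K r h = subst (ℕ._≤ r ℕ./ 2) (ℕ.m*n/n≡m K 2) (ℕ./-monoˡ-≤ 2 (ℕₚ.<⇒≤ h))

  𝔼X⟶C : (λ r → fromℚ (𝔼 ((3 ℕ.* r ℕ.∸ 1) ℕ./ 2) 1 (X r))) ⟶ C along Odd
  -- r ≥ 2 K + 1 makes s = `r / 2` at least `K`, which puts s, r and N all in the tail where partial
  -- products are close.
  𝔼X⟶C ε ε>0 = let K , close = ∃-P-close ε ε>0 in suc (K ℕ.* 2) , λ r large odd δ δ>0 → K , λ n K≤n →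
    let K≤s = half-large K r large in
    ℚₚ.≤-trans (close (r ℕ./ 2) r (dim r) (𝔼 (dim r) 1 (X r)) K≤s (s≤dim r odd)
        (ℕₚ.≤-trans K≤s (ℕ.m/n≤m r 2)) (r≤dim r odd) (𝔼X-odd r odd) n K≤n)
      (≤-+-pos ε δ>0)

  -- The rational bound involves P at index s + 1. Since `P` increases, every approximant of C from
  -- that index on is at least as large.
  ℙX>0≤ᴿ : ∀ r → Odd r →
    fromℚ (ℙ ((3 ℕ.* r ℕ.∸ 1) ℕ./ 2) 1 (λ B → 0 ℕₚ.<? X r B)) ≤ᴿ (q ^- ((r ℕ.^ 2 ℕ.∸ 1) ℕ./ 8)) ·ᴿ C
  ℙX>0≤ᴿ r odd ε ε>0 = suc (r ℕ./ 2) , λ n s<n → begin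
    ℙ (dim r) 1 (λ B → 0 ℕₚ.<? X r B)       ≤⟨ ℙX>0-odd r odd ⟩
    t (exponent r) ℚ.* P (suc (r ℕ./ 2))    ≤⟨ ℚₚ.*-monoˡ-≤-nonNeg (t (exponent r)) {{t≥0 (exponent r)}} (P-mono-≤ s<n) ⟩
    t (exponent r) ℚ.* P n                  ≤⟨ ≤-+-pos _ ε>0 ⟩
    t (exponent r) ℚ.* P n ℚ.+ ε            ∎

  0≤t*P : ∀ j n → 0ℚ ℚ.≤ t j ℚ.* P n
  0≤t*P j n = ℚₚ.nonNegative⁻¹ (t j ℚ.* P n) {{ℚₚ.nonNeg*nonNeg⇒nonNeg (t j) {{t≥0 j}} (P n) {{P≥0 n}}}}

  tC⟶0 : (λ r → (q ^- ((r ℕ.^ 2 ℕ.∸ 1) ℕ./ 8)) ·ᴿ C) ⟶ fromℚ 0ℚ along Odd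
  -- The approximants are inspected from index 1 on, because `t*P-small` concerns partial products
  -- of positive index.
  tC⟶0 ε ε>0 = let J , small = t*P-small ε ε>0 in suc (J ℕ.* 2) , λ r large odd δ δ>0 → 1 , λ { (suc n) _ →
    ∣x-0∣≤ (0≤t*P (exponent r) (suc n))
      (small (exponent r) n (ℕₚ.≤-trans (half-large J r large) (s≤exponent r odd))) δ>0 }

  -- X takes integer values, so exceeding a positive threshold already means being positive, and one
  -- bound serves all thresholds.
  ℙ⟶0 : ∀ ε → 0ℚ ℚ.< ε →
    (λ r → fromℚ (ℙ ((3 ℕ.* r ℕ.∸ 1) ℕ./ 2) 1 (λ B → ε ℚₚ.<? fromℕ (X r B)))) ⟶ fromℚ 0ℚ along Odd
  ℙ⟶0 ε₀ ε₀>0 ε ε>0 = let J , small = t*P-small ε ε>0 in suc (J ℕ.* 2) , λ r large odd δ δ>0 → 0 , λ n _ →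
    ∣x-0∣≤ (0≤probability (dim r) 1 (λ B → ε₀ ℚₚ.<? fromℕ (X r B)))
      (begin
        ℙ (dim r) 1 (λ B → ε₀ ℚₚ.<? fromℕ (X r B))   ≤⟨ probability-mono (dim r) 1 (λ B → ε₀ ℚₚ.<? fromℕ (X r B)) (λ B → 0 ℕₚ.<? X r B)
                                                          (λ B → positive (X r B)) ⟩
        ℙ (dim r) 1 (λ B → 0 ℕₚ.<? X r B)            ≤⟨ ℙX>0-odd r odd ⟩
        t (exponent r) ℚ.* P (suc (r ℕ./ 2))         ≤⟨ small (exponent r) (r ℕ./ 2) (ℕₚ.≤-trans (half-large J r large) (s≤exponent r odd)) ⟩
        ε                                            ∎)
      δ>0
    where
    positive : ∀ x → ε₀ ℚ.< fromℕ x → 0 ℕ.< x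
    positive zero    ε₀<0 = contradiction (ℚₚ.<-trans ε₀>0 ε₀<0) (ℚₚ.<-irrefl refl)
    positive (suc x) _    = s≤s z≤n

  module _ (n N : ℕ) (N≡ : N ≡ n ℕ.+ suc n) where

    private
      r = suc n
      𝔼X = 𝔼 N 2 (X r)
      𝔼XX = 𝔼 N 2 (λ B → X r B ℕ.* (X r B ℕ.∸ 1))

    𝔼X-pencil : 𝔼X ℚ.* P N ≡ P n ℚ.* P r
    𝔼X-pencil = 𝔼X-formula {2} {r} {n} {N} N≡ (2*#pairs-all n)

    𝔼X>0 : ℚ.Positive 𝔼X
    𝔼X>0 = ratio-pos n r N 𝔼X 𝔼X-pencil

    -- From index r on, the approximant P_k of C dominates P_r and hence 𝔼X, so n / P_k ≤ n / 𝔼X; by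
    -- `second-moment-bound`, n / 𝔼X is at most the ratio in question. Positivity of 𝔼X makes that
    -- ratio meaningful.
    second-moment-≤ᴿ : Σ (ℚ.NonZero (𝔼X ℚ.* 𝔼X)) λ nz →
      fromℕ n ·ᴿ EulerProduct.1/C q ≤ᴿ fromℚ ((𝔼XX ℚ.÷ (𝔼X ℚ.* 𝔼X)) {{nz}})
    second-moment-≤ᴿ = nz , λ ε ε>0 → r , λ k r≤k → ℚₚ.≤-trans
      (second-moment-ratio (fromℕ n) 𝔼X 𝔼XX (P k) {{ℚₚ.pos⇒nonZero (P k) {{P-pos k}}}} {{nz}} (P-pos k) 𝔼X>0
        (ℚₚ.normalize-nonNeg (∑ˡ (hom-Λ² N 2) (λ B → X r B ℕ.* (X r B ℕ.∸ 1))) (#hom N 2) {{hom-Λ²-nonEmpty N 2}})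
        (second-moment-bound N n (cong suc N≡))
        (ℚₚ.≤-trans (ratio≤P n r N 𝔼X (ℕₚ.≤-trans (ℕₚ.m≤m+n n r) (ℕₚ.≤-reflexive (sym N≡))) 𝔼X-pencil) (P-mono-≤ r≤k)))
      (≤-+-pos _ ε>0)
      where
      nz : ℚ.NonZero (𝔼X ℚ.* 𝔼X)
      nz = ℚₚ.pos⇒nonZero (𝔼X ℚ.* 𝔼X) {{ℚₚ.pos*pos⇒pos 𝔼X {{𝔼X>0}} 𝔼X {{𝔼X>0}}}}

theorem7p1 :
  (q : ℕ) (q-primePower : IsPrimePower q) (F : FiniteField q) →
  let open LinearAlgebra F
      C = EulerProduct.C q {{primePower⇒nonTrivial q-primePower}}
      1/C = EulerProduct.1/C q {{primePower⇒nonTrivial q-primePower}}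
      q^-_ = _^-_ q {{primePower⇒nonTrivial q-primePower}}
  in
  -- (i)
  ( let N = λ (r : ℕ) → (3 * r ∸ 1) / 2 in
      ((λ r → fromℚ (𝔼 (N r) 1 (X r))) ⟶ C along Odd)
    × (∀ r → Odd r →
        fromℚ (ℙ (N r) 1 (λ B → 0 <? X r B)) ≤ᴿ (q^- ((r ^ 2 ∸ 1) / 8)) ·ᴿ C)
    × ((λ r → (q^- ((r ^ 2 ∸ 1) / 8)) ·ᴿ C) ⟶ fromℚ 0ℚ along Odd)
    × (∀ (ε : ℚ) → 0ℚ ℚ.< ε →
        (λ r → fromℚ (ℙ (N r) 1 (λ B → ε ℚₚ.<? fromℕ (X r B)))) ⟶ fromℚ 0ℚ along Odd)
  )
  ×
  -- (ii)
  ( ∀ r → 1 ≤ r →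
    let N = 2 * r ∸ 1 in
      (∀ (B : Bilinear N 2) → IsAlternating B → ∃[ H ] IsIsotropicSubspace r B H)
    × (∀ (B : Bilinear N 2) → IsAlternating B → 1 ≤ X r B)
    × (let 𝔼X = 𝔼 N 2 (X r)
           𝔼XX = 𝔼 N 2 (λ B → X r B * (X r B ∸ 1))
       in Σ (ℚ.NonZero (𝔼X ℚ.* 𝔼X)) λ nz →
            fromℕ (r ∸ 1) ·ᴿ 1/C ≤ᴿ fromℚ ((𝔼XX ℚ.÷ (𝔼X ℚ.* 𝔼X)) {{nz}}))
  )
theorem7p1 q q-primePower F = (𝔼X⟶C , ℙX>0≤ᴿ , tC⟶0 , ℙ⟶0) , λ
    { (suc n) _ →
        ∃-isotropicSubspace n (n+[1+n]≡1+n*2 n)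
      , (λ B alt → ∃⇒1≤X (suc n) B (∃-isotropicSubspace n (n+[1+n]≡1+n*2 n) B alt))
      , second-moment-≤ᴿ n (2 * suc n ∸ 1) (cong (λ m → n + suc m) (ℕₚ.+-identityʳ n)) }
  where
  open SecondMoment {{primePower⇒nonTrivial q-primePower}} F using (∃-isotropicSubspace; ∃⇒1≤X)
  open Moments {{primePower⇒nonTrivial q-primePower}} F
  n+[1+n]≡1+n*2 : ∀ n → n + suc (n + 0) ≡ suc (n * 2)
  n+[1+n]≡1+n*2 = solve-∀
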